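{- Let $0\le n\le q-2k$. Suppose that for every arc $G\subset\mathbb{F}_q^k$ of size $2k-2+n$, the column space of the matrix $H_G^{\uparrow n}$ contains the vector $v\in\mathbb{F}_q^{\binom{2k-2+n}{k-1}}$ with $v_i=1$ for $i\in\{1,\dots,k\}$ and $v_i=0$ otherwise (coordinates numbered according to the colex order of the rows). Then the normal rational curve $\mathcal{R}_k$ is the unique arc in $\mathbb{F}_q^k$ of size $q+1$ up to linear equivalence.
   Context: $\mathbb{F}_q$ is a finite field of order $q$ and characteristic $p$. An arc in $\mathbb{F}_q^k$ is an ordered family of at least $k$ vectors in which every subfamily of size $k$ is a basis; subfamilies inherit the order. Two arcs $G,G'$ are linearly equivalent if, for a basis $B$, the matrix whose columns are the vectors of $G$ in coordinates w.r.t. $B$ can be transformed into the corresponding matrix of $G'$ by elementary row operations, column permutations, and multiplying columns by nonzero scalars. The normal rational curve is $\mathcal{R}_k=\{(1,t,t^2,\dots,t^{k-1}): t\in\mathbb{F}_q\}\cup\{(0,\dots,0,1)\}$. $\binom{X}{m}$ is the set of $m$-subsets of $X$. For a basis $B$, a vector $u$ and $C\in\binom{G}{k-1}$, $\det(u,C)_B$ is the determinant of the matrix with first row $u$ and remaining rows the elements of $C$ in the order inherited from $G$, all in coordinates w.r.t. $B$. For $0\le n\le|G|-k+1$, $M_G^{\uparrow n}$ has rows indexed by $\binom{G}{k-1}$, columns indexed by pairs $(U,A)$ with $U\in\binom{G}{n}$, $A\in\binom{G\setminus U}{k-2}$, and $(C,(U,A))$-entry $\prod_{u\in U}\det(u,C)_B$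 if $A\subset C\subset G\setminus U$, else $0$. For an ordered set, $A$ precedes $A'$ in colex order if the largest element of $A\triangle A'$ lies in $A'$. For $C\in\binom{G}{k-1}$ let $L_C$ be the last element of $\binom{G\setminus C}{n}$ in colex order, and let $J_G^{\uparrow n}$ be the diagonal matrix indexed by $\binom{G}{k-1}$ with $(C,C)$-entry $\prod_{y\in L_C}\det(y,C)_B^{ -1}$. Then $H_G^{\uparrow n}=J_G^{\uparrow n}M_G^{\uparrow n}$, with its rows listed in colex order. -}

module Defs where

open import Level using (0ℓ)
open import Data.Nat as ℕ using (ℕ; zero; suc; _∸_; _<ᵇ_; _≡ᵇ_)
open import Data.Bool using (Bool; true; false; if_then_else_; not; _∧_)
open import Data.Fin as Fin using (Fin; zero; suc; toℕ; fromℕ<; punchIn)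
open import Data.Fin.Subset using (Subset; ∣_∣; _⊆_; ∁; inside; outside)
open import Data.Fin.Subset.Properties using (_⊆?_)
open import Data.Vec using (Vec; []; _∷_)
open import Data.Vec.Properties using (≡-dec)
open import Data.List as List using (List; []; _∷_; _++_; filter; length; foldr)
open import Data.Product using (Σ; _×_; _,_)
open import Function.Bundles using (_↔_)
open import Data.Fin.Permutation using (Permutation′; _⟨$⟩ʳ_)
open import Relation.Binary.PropositionalEquality using (_≡_; _≢_)
open import Relation.Binary.Construct.Closure.ReflexiveTransitive using (Star)
open import Relation.Nullary using (¬_; Dec; yes; no; does)
open import Algebra.Structures using (IsCommutativeRing)
import Data.Bool as B

record FiniteField (q : ℕ) : Set₁ where
  infixl 7 _*_
  infixl 6 _+_
  field
    Carrier : Set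
    _+_ _*_ : Carrier → Carrier → Carrier
    -_      : Carrier → Carrier
    0# 1#   : Carrier
    _⁻¹     : Carrier → Carrier
    isCommutativeRing : IsCommutativeRing _≡_ _+_ _*_ -_ 0# 1#
    0≢1     : 0# ≢ 1#
    inverse : ∀ x → x ≢ 0# → x * (x ⁻¹) ≡ 1#
    enum    : Fin q ↔ Carrier

-- Everything below is relative to a finite field F and a dimension k.
-- Vectors of F_q^k are written in coordinates w.r.t. the standard basis B
-- (H_G^{↑n} does not depend on the choice of B).

module FF {q : ℕ} (F : FiniteField q) where
  open FiniteField F public
  open Function.Bundles.Inverse enum using (to)

  Vect : ℕ → Set
  Vect k = Fin k → Carrier

  _≈ᵥ_ : ∀ {k} → Vect k → Vect k → Set
  u ≈ᵥ v = ∀ j → u j ≡ v j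

  sumL : List Carrier → Carrier
  sumL = foldr _+_ 0#

  prodL : List Carrier → Carrier
  prodL = foldr _*_ 1#

  sumFin : ∀ {m} → (Fin m → Carrier) → Carrier
  sumFin {zero}  f = 0#
  sumFin {suc m} f = f zero + sumFin (λ i → f (suc i))

  pow : Carrier → ℕ → Carrier
  pow t zero    = 1#
  pow t (suc i) = t * pow t i

  sgn : ℕ → Carrier
  sgn zero    = 1#
  sgn (suc i) = - sgn i

  -- Determinant of the k×k matrix whose rows are the given list of
  -- vectors (Laplace expansion along the first row).  Only used on lists
  -- of length exactly k; the other clauses are junk values.

  det : ∀ {k} → List (Vect k) → Carrier
  det {zero}  []       = 1#
  det {zero}  (_ ∷ _)  = 0#
  det {suc m} []       = 0#
  det {suc m} (r ∷ rs) =
    sumFin (λ j → sgn (toℕ j) * r j * det (List.map (λ v c → v (punchIn j c)) rs))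

  -- Subsets of the index set Fin N of an ordered family of size N.
  -- Index 0 is the first (smallest) element of the family.

  members : ∀ {N} → Subset N → List (Fin N)
  members []             = []
  members (true  ∷ s)    = zero ∷ List.map suc (members s)
  members (false ∷ s)    = List.map suc (members s)

  allSubsets : ∀ N → List (Subset N)
  allSubsets zero    = [] ∷ []
  allSubsets (suc N) = List.map (true ∷_) (allSubsets N) ++ List.map (false ∷_) (allSubsets N)

  subsetsOfSize : ∀ N → ℕ → List (Subset N)
  subsetsOfSize N m = filter (λ s → ∣ s ∣ ℕ.≟ m) (allSubsets N)

  -- colex order: A precedes A' iff the largest element of A △ A' lies in A'.
  -- (Recursion: the tail holds the larger elements; if the tails agree,
  --  the only possible difference is the smallest element.)
  colexLt : ∀ {N} → Subset N → Subset N → Bool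
  colexLt []       []       = false
  colexLt (a ∷ as) (b ∷ bs) =
    if does (≡-dec B._≟_ as bs) then (not a ∧ b) else colexLt as bs

  colexLast : ∀ {N} → Subset N → List (Subset N) → Subset N
  colexLast d []       = d
  colexLast d (s ∷ ss) = let t = colexLast s ss in if colexLt s t then t else s

  colexRank : ∀ {N} → ℕ → Subset N → ℕ
  colexRank {N} m C = length (filter (λ C' → B.T? (colexLt C' C)) (subsetsOfSize N m))

  Family : ℕ → ℕ → Set
  Family k N = Fin N → Vect k

  sub : ∀ {k N} → Family k N → Subset N → List (Vect k)
  sub G S = List.map G (members S)

  linComb : ∀ {k} (vs : List (Vect k)) → (Fin (length vs) → Carrier) → Vect k
  linComb vs c j = sumFin (λ i → c i * List.lookup vs i j)

  IsBasis : ∀ {k} → List (Vect k) → Set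
  IsBasis {k} vs = (v : Vect k) →
    Σ (Fin (length vs) → Carrier) λ c →
      (linComb vs c ≈ᵥ v) ×
      (∀ c' → linComb vs c' ≈ᵥ v → ∀ i → c' i ≡ c i)

  IsArc : ∀ {k N} → Family k N → Set
  IsArc {k} {N} G = (k ℕ.≤ N) × (∀ (S : Subset N) → ∣ S ∣ ≡ k → IsBasis (sub G S))

  Mat : ℕ → ℕ → Set
  Mat k N = Fin k → Fin N → Carrier

  swapIdx : ∀ {k} → Fin k → Fin k → Fin k → Fin k
  swapIdx i j r = if does (r Fin.≟ i) then j else if does (r Fin.≟ j) then i else r

  data Step {k N : ℕ} (M M' : Mat k N) : Set where
    rowSwap  : (i j : Fin k) → (∀ r c → M' r c ≡ M (swapIdx i j r) c) → Step M M'
    rowScale : (i : Fin k) (a : Carrier) → a ≢ 0# →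
               (∀ r c → M' r c ≡ (if does (r Fin.≟ i) then a * M r c else M r c)) → Step M M'
    rowAdd   : (i j : Fin k) → i ≢ j → (a : Carrier) →
               (∀ r c → M' r c ≡ (if does (r Fin.≟ i) then M r c + a * M j c else M r c)) → Step M M'
    colPerm  : (σ : Permutation′ N) → (∀ r c → M' r c ≡ M r (σ ⟨$⟩ʳ c)) → Step M M'
    colScale : (λs : Fin N → Carrier) → (∀ c → λs c ≢ 0#) →
               (∀ r c → M' r c ≡ λs c * M r c) → Step M M'

  toMat : ∀ {k N} → Family k N → Mat k N
  toMat G r c = G c r

  LinEquiv : ∀ {k N} → Family k N → Family k N → Set
  LinEquiv G G' = Star Step (toMat G) (toMat G')

  NRC : (k : ℕ) → Family k (suc q)
  NRC k i with toℕ i ℕ.<? q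
  ... | yes i<q = λ j → pow (to (fromℕ< i<q)) (toℕ j)
  ... | no  _   = λ j → if toℕ j ≡ᵇ (k ∸ 1) then 1# else 0#

  -- The matrices M_G^{↑n}, J_G^{↑n}, H_G^{↑n} (rows C ∈ binom(G,k-1),
  -- columns (U,A) with U ∈ binom(G,n), A ∈ binom(G∖U,k-2)).

  module _ {k N : ℕ} (G : Family k N) (n : ℕ) where

    detUC : Vect k → Subset N → Carrier
    detUC u C = det (u ∷ sub G C)

    Mentry : Subset N → Subset N → Subset N → Carrier
    Mentry C U A with A ⊆? C | C ⊆? ∁ U
    ... | yes _ | yes _ = prodL (List.map (λ u → detUC (G u) C) (members U))
    ... | _     | _     = 0#

    L : Subset N → Subset N
    L C = colexLast C (filter (λ U → U ⊆? ∁ C) (subsetsOfSize N n))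

    -- (C,C) entry of J_G^{↑n}
    Jentry : Subset N → Carrier
    Jentry C = prodL (List.map (λ y → (detUC (G y) C) ⁻¹) (members (L C)))

    Hentry : Subset N → Subset N → Subset N → Carrier
    Hentry C U A = Jentry C * Mentry C U A

    columns : List (Subset N × Subset N)
    columns = List.concatMap
      (λ U → List.map (U ,_) (filter (λ A → A ⊆? ∁ U) (subsetsOfSize N (k ∸ 2))))
      (subsetsOfSize N n)

    vTarget : Subset N → Carrier
    vTarget C = if colexRank (k ∸ 1) C <ᵇ k then 1# else 0#

    vInColSpaceH : Set
    vInColSpaceH =
      Σ (Subset N → Subset N → Carrier) λ x →
        ∀ (C : Subset N) → ∣ C ∣ ≡ k ∸ 1 →
          sumL (List.map (λ { (U , A) → Hentry C U A * x U A }) columns) ≡ vTarget C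

{-# OPTIONS --safe #-}
-- Let G be an arc of size q + 1, and for a (k-1)-subset C let α_C be the
-- product of det(g,C)⁻¹ over the points g of G outside C.  Project G from a
-- (k-2)-subset A to a line.  By Wilson's theorem α_{A∪e} is, up to a constant
-- depending on A only, the value at e of the product of the k-2 linear forms
-- that vanish at the points of the line missed by G (a form of Segre's lemma
-- of tangents).  By Lagrange interpolation the numbers
-- w_C = α_C ∏_{u ∈ G'∖C} det(u,C)⁻¹ therefore form a left kernel vector of
-- M_{G'}^{↑n} for every subarc G' of size 2k-2+n.
--
-- Pairing w with J⁻¹v yields, for every basis K ⊂ G with coordinates ℓ_c, a
-- relation Σ_c a_c ∏_{y∈Y} ℓ_c(y)⁻¹ = 0 for all (k-2)-subsets Y of G∖K, with
-- nonzero a_c independent of Y.  Exchanging one point of Y shows that the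
-- vectors (ℓ_c(y)⁻¹)_c of any three points y outside Y satisfy k-2 independent
-- linear equations.  So all of them lie in a plane, and inverting the
-- coordinates of a plane through the vertices of K gives a normal rational curve.
module Submission where

open import Defs
open import Data.Nat as ℕ using (ℕ; zero; suc; _≤_; z≤n; s≤s)
import Data.Nat.Properties as ℕP
open import Data.Fin as Fin using (Fin; zero; suc; punchIn; punchOut; _↑ˡ_; _↑ʳ_; splitAt; toℕ; fromℕ; fromℕ<; finToFun; funToFin)
import Data.Fin.Properties as FinP
open import Data.Fin.Permutation as Perm using (Permutation; permutation; _⟨$⟩ʳ_)
open import Data.Product using (Σ; ∃; _×_; _,_; proj₁; proj₂)
open import Data.Sum using (_⊎_; inj₁; inj₂)
open import Data.List as List using (List; []; _∷_; length; _++_; filter)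
open import Data.List.Membership.Propositional using (_∈_; _∉_; find)
import Data.List.Membership.DecPropositional as DecMembership
import Data.Vec.Functional as VF
import Data.Vec.Functional.Properties as VFP
open import Function using (_∘_; id)
open import Function.Definitions using (Injective)
open import Relation.Nullary using (¬_; Dec; yes; no; contradiction; ¬?; does)
open import Relation.Binary.PropositionalEquality using (_≡_; _≢_; refl; sym; trans; cong; subst; _≗_; cong₂; module ≡-Reasoning)
open import Level using (0ℓ)
open import Data.Bool as Bool using (Bool; true; false; if_then_else_; not; _∨_; _∧_; T?)
open import Data.Integer as ℤ using (ℤ; -[1+_]) renaming (+_ to pos)
import Data.Integer.Properties as ℤP
import Data.Sign as Sign
import Data.Maybe as Maybe
open import Function.Bundles using (Inverse)
open import Relation.Nullary.Decidable using (map′; dec⇒maybe; dec-true; dec-false; _⊎-dec_; _×-dec_)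
open import Algebra.Bundles using (CommutativeRing)
import Algebra.Properties.Ring
import Algebra.Properties.Semiring.Mult
import Algebra.Properties.Semiring.Sum
import Algebra.Properties.CommutativeMonoid.Sum
import Algebra.Solver.Ring
import Algebra.Solver.Ring.AlmostCommutativeRing as ACR
open import Data.List.Relation.Unary.All as All using (All; []; _∷_)
open import Data.List.Relation.Unary.AllPairs as AllPairs using (AllPairs; []; _∷_)
open import Data.List.Relation.Unary.Any as Any using (here; there)
import Data.List.Properties as ListP
open import Data.List.Relation.Binary.Pointwise as Pointwise using (Pointwise; []; _∷_)
open import Data.Unit using (⊤; tt)
open import Data.Fin.Subset using (Subset; ∣_∣; _⊆_; ∁)
open import Data.Vec as Vec using ([]; _∷_; lookup; replicate; _[_]≔_; zipWith)
import Data.Vec.Properties as VecP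
open import Data.List.Relation.Unary.Unique.Propositional using (Unique)
import Data.List.Relation.Unary.Unique.Propositional.Properties as UniqueP
import Data.List.Membership.Propositional.Properties as ∈P
open import Data.Nat.Solver using (module +-*-Solver)
open import Data.Fin.Subset.Properties using (_⊆?_)
import Data.List.Relation.Unary.AllPairs.Properties as AllPairsP
import Data.Bool.Properties as BoolP
open import Relation.Binary.Construct.Closure.ReflexiveTransitive using (Star; ε; _◅_; _◅◅_)
import Data.List.Relation.Unary.All.Properties as AllP
open ≡-Reasoning

-- Why inverting a plane yields the curve: if the vectors (ζ_c(g))_c lie in a plane, then, up to a
-- constant, ζ_c(g) is the value of a linear form in two variables, with zero `node c`, at a
-- parameter of g. Multiplying the reciprocals ℓ_c(g) by the product of all k forms turns them into
-- binary forms of degree k - 1, and Lagrange interpolation at the nodes compares these with the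
-- monomials. The vertices of K themselves sit at the parameters `node c`. The bound `n + 2 * k ≤ q`
-- enters by counting: the subarcs of size 2k-2+n must fit into q + 1 points, and the exchange
-- argument needs a basis, three points and k - 2 further ones, 2k + 1 in all. An obstacle is that
-- determinants take their rows in the inherited order, so a sign appears whenever a subset grows.
-- Such signs are carried as unspecified s with s * s = 1 and are removed by s^q = s, which treats
-- all characteristics alike. Dimension counts are replaced by the pigeonhole principle on finite
-- sets.

-- Injections between finite sets and their extension

Inj : ∀ {A B : Set} → (A → B) → Set
Inj f = Injective _≡_ _≡_ f

infix 4 _∈?_
_∈?_ : ∀ {n} (i : Fin n) (xs : List (Fin n)) → Dec (i ∈ xs)
_∈?_ = DecMembership._∈?_ FinP._≟_

Disjoint : ∀ {A B C : Set} → (A → C) → (B → C) → Set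
Disjoint f g = ∀ i j → f i ≢ g j

-- A missed value y would let `punchOut` compress f into a set with one element fewer. This
-- pigeonhole step stands behind all later arguments that would otherwise count dimensions.
injective⇒surjective : ∀ {n} (f : Fin n → Fin n) → Inj f → ∀ y → ∃ λ x → f x ≡ y
injective⇒surjective {suc n} f inj y with FinP.any? (λ x → f x FinP.≟ y)
... | yes hit = hit
... | no miss = contradiction (FinP.injective⇒≤ {f = g} g-inj) (ℕP.<⇒≱ (ℕP.n<1+n n))
  where
  y≢f : ∀ x → y ≢ f x
  y≢f x e = miss (x , sym e)
  g : Fin (suc n) → Fin n
  g x = punchOut (y≢f x)
  g-inj : Inj g
  g-inj {a} {b} e = inj (FinP.punchOut-injective (y≢f a) (y≢f b) e)

abstract
  -- The sizes stay two separate indices because the q + 1 points are also enumerated by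
  -- `Fin (N + m)`, whose size equals `suc q` only propositionally.
  injective⇒permutation : ∀ {m n} → m ≡ n → (f : Fin m → Fin n) → Inj f →
    Σ (Permutation m n) λ π → ∀ i → π ⟨$⟩ʳ i ≡ f i
  injective⇒permutation {m} refl f inj = permutation f g (λ y → proj₂ (surj y)) (λ x → inj (proj₂ (surj (f x)))) , λ _ → refl
    where
    surj : ∀ y → ∃ λ x → f x ≡ y
    surj = injective⇒surjective f inj
    g : Fin m → Fin m
    g y = proj₁ (surj y)

fresh : ∀ {a M} (f : Fin a → Fin M) → a ℕ.< M → ∃ λ x → ∀ i → f i ≢ x
fresh {a} {M} f a<M with FinP.any? (λ x → FinP.all? (λ i → ¬? (f i FinP.≟ x)))
... | yes found = found
... | no none = contradiction (FinP.injective⇒≤ {f = g} g-inj) (ℕP.<⇒≱ a<M)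
  where
  hit : ∀ x → ∃ λ i → f i ≡ x
  hit x with FinP.any? (λ i → f i FinP.≟ x)
  ... | yes h = h
  ... | no ¬h = contradiction (x , λ i e → ¬h (i , e)) none
  g : Fin M → Fin a
  g x = proj₁ (hit x)
  g-inj : Inj g
  g-inj {x} {y} e = trans (sym (proj₂ (hit x))) (trans (cong f e) (proj₂ (hit y)))

∷-injective : ∀ {a} {A : Set} {x : A} {f : Fin a → A} → Inj f → (∀ i → f i ≢ x) → Inj (x VF.∷ f)
∷-injective inj ne {zero}  {zero}  e = refl
∷-injective inj ne {zero}  {suc j} e = contradiction (sym e) (ne j)
∷-injective inj ne {suc i} {zero}  e = contradiction e (ne i)
∷-injective inj ne {suc i} {suc j} e = cong suc (inj e)

abstract
  -- Greedy choice: fewer than M used values always leave a `fresh` one. Auxiliary points outside a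
  -- given basis are chosen in this way.
  extend : ∀ {a M} b (f : Fin a → Fin M) → Inj f → a ℕ.+ b ℕ.≤ M →
    Σ (Fin b → Fin M) λ g → Inj g × Disjoint f g
  extend zero f inj le = (λ ()) , (λ { {()} }) , λ _ ()
  extend {a} {M} (suc b) f inj le with fresh f (ℕP.≤-trans (subst (suc a ℕ.≤_) (sym (ℕP.+-suc a b)) (ℕP.m≤m+n (suc a) b)) le)
  ... | x , x∉f with extend b (x VF.∷ f) (∷-injective inj x∉f) (subst (ℕ._≤ M) (ℕP.+-suc a b) le)
  ... | g , g-inj , dis = (x VF.∷ g) , ∷-injective g-inj (λ i e → dis zero i (sym e)) ,
        λ { i zero → x∉f i ; i (suc j) → dis (suc i) j }

splitCase : ∀ m {n} (i : Fin (m ℕ.+ n)) → (∃ λ j → i ≡ j ↑ˡ n) ⊎ (∃ λ j → i ≡ m ↑ʳ j)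
splitCase m i with splitAt m i in eq
... | inj₁ j = inj₁ (j , sym (FinP.splitAt⁻¹-↑ˡ eq))
... | inj₂ j = inj₂ (j , sym (FinP.splitAt⁻¹-↑ʳ eq))

++-elim : ∀ {m n} (P : Fin (m ℕ.+ n) → Set) → (∀ i → P (i ↑ˡ n)) → (∀ i → P (m ↑ʳ i)) → ∀ i → P i
++-elim {m} P l r i with splitCase m i
... | inj₁ (j , refl) = l j
... | inj₂ (j , refl) = r j

++-injective : ∀ {A : Set} {m n} {f : Fin m → A} {g : Fin n → A} → Inj f → Inj g → Disjoint f g → Inj (f VF.++ g)
++-injective {m = m} {n} {f} {g} fi gi dis {i} {j} e with splitCase m i | splitCase m j
... | inj₁ (i , refl) | inj₁ (j , refl) rewrite VFP.lookup-++ˡ f g i | VFP.lookup-++ˡ f g j = cong (_↑ˡ n) (fi e)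
... | inj₁ (i , refl) | inj₂ (j , refl) rewrite VFP.lookup-++ˡ f g i | VFP.lookup-++ʳ f g j = contradiction e (dis i j)
... | inj₂ (i , refl) | inj₁ (j , refl) rewrite VFP.lookup-++ʳ f g i | VFP.lookup-++ˡ f g j = contradiction (sym e) (dis j i)
... | inj₂ (i , refl) | inj₂ (j , refl) rewrite VFP.lookup-++ʳ f g i | VFP.lookup-++ʳ f g j = cong (m ↑ʳ_) (gi e)

Disjoint-++ʳ : ∀ {A B : Set} {m n} {h : B → A} {f : Fin m → A} {g : Fin n → A} →
  Disjoint h f → Disjoint h g → Disjoint h (f VF.++ g)
Disjoint-++ʳ {m = m} {f = f} {g} df dg i j e with splitCase m j
... | inj₁ (j , refl) rewrite VFP.lookup-++ˡ f g j = df i j e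
... | inj₂ (j , refl) rewrite VFP.lookup-++ʳ f g j = dg i j e

-- Field arithmetic, finite sums and products

module FieldArithmetic {q : ℕ} (F : FiniteField q) where

  open FF F public

  commutativeRing : CommutativeRing 0ℓ 0ℓ
  commutativeRing = record { isCommutativeRing = isCommutativeRing }

  open CommutativeRing commutativeRing public
    using ( +-assoc; +-comm; +-identityˡ; +-identityʳ; -‿inverseˡ; -‿inverseʳ
          ; *-assoc; *-comm; *-identityˡ; *-identityʳ; distribˡ; distribʳ; zeroˡ; zeroʳ
          ; semiring; ring; *-commutativeMonoid)
  open Algebra.Properties.Ring ring public using (-‿involutive; -‿+-comm; -‿distribˡ-*; -‿distribʳ-*; -0#≈0#)
  private
    module Mult = Algebra.Properties.Semiring.Mult semiring

  infixr 8 _·1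
  _·1 : ℕ → Carrier
  n ·1 = n Mult.× 1#

  ⟦_⟧ℤ : ℤ → Carrier
  ⟦ pos n ⟧ℤ      = n ·1
  ⟦ -[1+ n ] ⟧ℤ = - (suc n ·1)

  private
    neg-+ : ∀ x y → - (x + y) ≡ - x + - y
    neg-+ x y = sym (-‿+-comm x y)

    cancel₁ : ∀ a x y → (a + x) + - (a + y) ≡ x + - y
    cancel₁ a x y = begin
      (a + x) + - (a + y)     ≡⟨ cong ((a + x) +_) (neg-+ a y) ⟩
      (a + x) + (- a + - y)   ≡⟨ cong (_+ (- a + - y)) (+-comm a x) ⟩
      (x + a) + (- a + - y)   ≡⟨ +-assoc x a _ ⟩
      x + (a + (- a + - y))   ≡⟨ cong (x +_) (sym (+-assoc a _ _)) ⟩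
      x + ((a + - a) + - y)   ≡⟨ cong (λ z → x + (z + - y)) (-‿inverseʳ a) ⟩
      x + (0# + - y)          ≡⟨ cong (x +_) (+-identityˡ _) ⟩
      x + - y ∎
      where open ≡-Reasoning

    ⊖-homo : ∀ m n → ⟦ m ℤ.⊖ n ⟧ℤ ≡ m ·1 + - (n ·1)
    ⊖-homo m zero          = sym (trans (cong (m ·1 +_) -0#≈0#) (+-identityʳ _))
    ⊖-homo zero (suc n)    = sym (+-identityˡ _)
    ⊖-homo (suc m) (suc n) = begin
      ⟦ suc m ℤ.⊖ suc n ⟧ℤ      ≡⟨ cong ⟦_⟧ℤ (ℤP.[1+m]⊖[1+n]≡m⊖n m n) ⟩
      ⟦ m ℤ.⊖ n ⟧ℤ              ≡⟨ ⊖-homo m n ⟩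
      m ·1 + - (n ·1)           ≡⟨ sym (cancel₁ 1# _ _) ⟩
      suc m ·1 + - (suc n ·1)   ∎
      where open ≡-Reasoning

    ℤ-+-homo : ∀ i j → ⟦ i ℤ.+ j ⟧ℤ ≡ ⟦ i ⟧ℤ + ⟦ j ⟧ℤ
    ℤ-+-homo (pos m) (pos n)           = Mult.×-homo-+ 1# m n
    ℤ-+-homo (pos m) -[1+ n ]        = ⊖-homo m (suc n)
    ℤ-+-homo -[1+ m ] (pos n)        = trans (⊖-homo n (suc m)) (+-comm _ _)
    ℤ-+-homo -[1+ m ] -[1+ n ]     = begin
      - (1# + (1# + (m ℕ.+ n) ·1))    ≡⟨ cong (λ z → - (1# + z)) (Mult.×-homo-+ 1# (suc m) n) ⟩
      - (1# + (suc m ·1 + n ·1))      ≡⟨ cong -_ (sym (+-assoc 1# _ _)) ⟩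
      - ((1# + suc m ·1) + n ·1)      ≡⟨ cong (λ z → - (z + n ·1)) (+-comm 1# _) ⟩
      - ((suc m ·1 + 1#) + n ·1)      ≡⟨ cong -_ (+-assoc _ 1# _) ⟩
      - (suc m ·1 + suc n ·1)         ≡⟨ neg-+ _ _ ⟩
      - (suc m ·1) + - (suc n ·1)     ∎
      where open ≡-Reasoning

    ◃⁻-homo : ∀ n → ⟦ Sign.- ℤ.◃ n ⟧ℤ ≡ - (n ·1)
    ◃⁻-homo zero    = sym -0#≈0#
    ◃⁻-homo (suc n) = refl

    ℤ-*-homo : ∀ i j → ⟦ i ℤ.* j ⟧ℤ ≡ ⟦ i ⟧ℤ * ⟦ j ⟧ℤ
    ℤ-*-homo (pos m) (pos n)       = trans (cong ⟦_⟧ℤ (ℤP.+◃n≡+n (m ℕ.* n))) (Mult.×1-homo-* m n)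
    ℤ-*-homo (pos m) -[1+ n ]    = trans (◃⁻-homo (m ℕ.* suc n)) (trans (cong -_ (Mult.×1-homo-* m (suc n))) (-‿distribʳ-* _ _))
    ℤ-*-homo -[1+ m ] (pos n)    = trans (◃⁻-homo (suc m ℕ.* n)) (trans (cong -_ (Mult.×1-homo-* (suc m) n)) (-‿distribˡ-* _ _))
    ℤ-*-homo -[1+ m ] -[1+ n ] = trans (Mult.×1-homo-* (suc m) (suc n)) (begin
      a * b           ≡⟨ cong (_* b) (sym (-‿involutive a)) ⟩
      (- (- a)) * b   ≡⟨ sym (-‿distribˡ-* _ _) ⟩
      - ((- a) * b)   ≡⟨ -‿distribʳ-* _ _ ⟩
      (- a) * (- b)   ∎)
      where
      a = suc m ·1
      b = suc n ·1

    ℤ-neg-homo : ∀ i → ⟦ ℤ.- i ⟧ℤ ≡ - ⟦ i ⟧ℤ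
    ℤ-neg-homo (pos zero)    = sym -0#≈0#
    ℤ-neg-homo (pos (suc n)) = refl
    ℤ-neg-homo -[1+ n ]    = sym (-‿involutive _)

    -- Agrees with ⟦_⟧ℤ, but sends 1 to 1# definitionally.
    ⟦_⟧ : ℤ → Carrier
    ⟦ pos 1 ⟧      = 1#
    ⟦ -[1+ 0 ] ⟧ = - 1#
    ⟦ i ⟧        = ⟦ i ⟧ℤ

    ⟦⟧≡ : ∀ i → ⟦ i ⟧ ≡ ⟦ i ⟧ℤ
    ⟦⟧≡ (pos 0)            = refl
    ⟦⟧≡ (pos 1)            = sym (+-identityʳ 1#)
    ⟦⟧≡ (pos (suc (suc n)))  = refl
    ⟦⟧≡ -[1+ 0 ]         = cong -_ (sym (+-identityʳ 1#))
    ⟦⟧≡ -[1+ suc n ]     = refl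

  -- Integer rather than field coefficients: cancellation is then decided by evaluation.
  ℤ⟶F : CommutativeRing.rawRing ℤP.+-*-commutativeRing ACR.-Raw-AlmostCommutative⟶ ACR.fromCommutativeRing commutativeRing
  ℤ⟶F = record
    { ⟦_⟧    = ⟦_⟧
    ; +-homo = λ i j → trans (⟦⟧≡ (i ℤ.+ j)) (trans (ℤ-+-homo i j) (sym (cong₂ _+_ (⟦⟧≡ i) (⟦⟧≡ j))))
    ; *-homo = λ i j → trans (⟦⟧≡ (i ℤ.* j)) (trans (ℤ-*-homo i j) (sym (cong₂ _*_ (⟦⟧≡ i) (⟦⟧≡ j))))
    ; -‿homo = λ i → trans (⟦⟧≡ (ℤ.- i)) (trans (ℤ-neg-homo i) (sym (cong -_ (⟦⟧≡ i))))
    ; 0-homo = refl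
    ; 1-homo = refl }

  ⟦⟧-≟ : ∀ i j → Maybe.Maybe (⟦ i ⟧ ≡ ⟦ j ⟧)
  ⟦⟧-≟ i j = Maybe.map (cong ⟦_⟧) (dec⇒maybe (i ℤ.≟ j))

  module RingSolver = Algebra.Solver.Ring (CommutativeRing.rawRing ℤP.+-*-commutativeRing) (ACR.fromCommutativeRing commutativeRing) ℤ⟶F ⟦⟧-≟
  open RingSolver public using (solve; _:=_; _:+_; _:*_; :-_)

  :0 :1 : ∀ {n} → RingSolver.Polynomial n
  :0 = RingSolver.con (pos 0)
  :1 = RingSolver.con (pos 1)

  infix 4 _≟_
  abstract
    _≟_ : (x y : Carrier) → Dec (x ≡ y)
    x ≟ y = map′ from-injective (cong from) (from x FinP.≟ from y)
      where
      open Inverse enum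
      from-injective : from x ≡ from y → x ≡ y
      from-injective eq = trans (sym (strictlyInverseˡ x)) (trans (cong to eq) (strictlyInverseˡ y))

  1≢0 : 1# ≢ 0#
  1≢0 e = 0≢1 (sym e)

  x*y≡1⇒x≢0 : ∀ {x y} → x * y ≡ 1# → x ≢ 0#
  x*y≡1⇒x≢0 {x} {y} xy e = 0≢1 (trans (sym (zeroˡ y)) (trans (cong (_* y) (sym e)) xy))

  *-cancelˡ : ∀ {x y z} → x ≢ 0# → x * y ≡ x * z → y ≡ z
  *-cancelˡ {x} {y} {z} x≢0 eq = begin
    y                 ≡⟨ lemma y ⟩
    x ⁻¹ * (x * y)    ≡⟨ cong (x ⁻¹ *_) eq ⟩
    x ⁻¹ * (x * z)    ≡⟨ sym (lemma z) ⟩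
    z                 ∎
    where
    lemma : ∀ w → w ≡ x ⁻¹ * (x * w)
    lemma w = trans (sym (*-identityˡ w)) (trans (cong (_* w) (sym (inverse x x≢0)))
      (solve 3 (λ a b c → a :* b :* c := b :* (a :* c)) refl x (x ⁻¹) w))

  x*y≡0⇒y≡0 : ∀ {x y} → x ≢ 0# → x * y ≡ 0# → y ≡ 0#
  x*y≡0⇒y≡0 {x} x≢0 e = *-cancelˡ x≢0 (trans e (sym (zeroʳ x)))

  *-≢0 : ∀ {x y} → x ≢ 0# → y ≢ 0# → x * y ≢ 0#
  *-≢0 x≢0 y≢0 e = y≢0 (x*y≡0⇒y≡0 x≢0 e)

  -‿≢0 : ∀ {x} → x ≢ 0# → - x ≢ 0#
  -‿≢0 {x} x≢0 e = x≢0 (trans (sym (-‿involutive x)) (trans (cong -_ e) -0#≈0#))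

  x-y≡0⇒x≡y : ∀ {x y} → x + - y ≡ 0# → x ≡ y
  x-y≡0⇒x≡y {x} {y} e = trans (solve 2 (λ a b → a := (a :+ :- b) :+ b) refl x y) (trans (cong (_+ y) e) (+-identityˡ y))

  x+y≡0⇒x≡-y : ∀ {x y} → x + y ≡ 0# → x ≡ - y
  x+y≡0⇒x≡-y {x} {y} e = x-y≡0⇒x≡y (trans (cong (x +_) (-‿involutive y)) e)

  -- The inverse made total by inv 0# = 1#: in a product over a whole index
  -- set the vanishing factors then drop out.
  abstract
    inv : Carrier → Carrier
    inv x = if does (x ≟ 0#) then 1# else x ⁻¹

    inv-0 : ∀ {x} → x ≡ 0# → inv x ≡ 1#
    inv-0 {x} e rewrite dec-true (x ≟ 0#) e = refl

    inv-⁻¹ : ∀ {x} → x ≢ 0# → inv x ≡ x ⁻¹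
    inv-⁻¹ {x} ne rewrite dec-false (x ≟ 0#) ne = refl

  *-inv : ∀ {x} → x ≢ 0# → x * inv x ≡ 1#
  *-inv {x} ne = trans (cong (x *_) (inv-⁻¹ ne)) (inverse x ne)

  inv-* : ∀ {x} → x ≢ 0# → inv x * x ≡ 1#
  inv-* ne = trans (*-comm _ _) (*-inv ne)

  inv≢0 : ∀ x → inv x ≢ 0#
  inv≢0 x with x ≟ 0#
  ... | yes e = λ z → 1≢0 (trans (sym (inv-0 e)) z)
  ... | no ne = x*y≡1⇒x≢0 (inv-* ne)

  inv-unique : ∀ {x y} → x * y ≡ 1# → inv x ≡ y
  inv-unique {x} {y} e = *-cancelˡ x≢0 (trans (*-inv x≢0) (sym e))
    where x≢0 = x*y≡1⇒x≢0 e

  inv-distrib-* : ∀ {x y} → x ≢ 0# → y ≢ 0# → inv (x * y) ≡ inv x * inv y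
  inv-distrib-* {x} {y} x≢0 y≢0 = inv-unique (begin
    x * y * (inv x * inv y)     ≡⟨ solve 4 (λ a b c d → a :* b :* (c :* d) := (a :* c) :* (b :* d)) refl x y _ _ ⟩
    x * inv x * (y * inv y)     ≡⟨ cong₂ _*_ (*-inv x≢0) (*-inv y≢0) ⟩
    1# * 1#                     ≡⟨ *-identityˡ 1# ⟩
    1#                          ∎)
    where open ≡-Reasoning

  inv-involutive : ∀ {x} → x ≢ 0# → inv (inv x) ≡ x
  inv-involutive ne = inv-unique (inv-* ne)

  inv-neg : ∀ {x} → x ≢ 0# → inv (- x) ≡ - inv x
  inv-neg {x} ne = inv-unique (trans (solve 2 (λ a b → (:- a) :* (:- b) := a :* b) refl x (inv x)) (*-inv ne))

  private
    module Sum = Algebra.Properties.Semiring.Sum semiring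
    module Prod = Algebra.Properties.CommutativeMonoid.Sum *-commutativeMonoid

  ∑ : ∀ {n} → (Fin n → Carrier) → Carrier
  ∑ = sumFin

  ∏ : ∀ {n} → (Fin n → Carrier) → Carrier
  ∏ {zero}  f = 1#
  ∏ {suc n} f = f zero * ∏ (f ∘ suc)

  private
    ∑≡sum : ∀ {n} (f : Fin n → Carrier) → ∑ f ≡ Sum.sum f
    ∑≡sum {zero}  f = refl
    ∑≡sum {suc n} f = cong (f zero +_) (∑≡sum (f ∘ suc))

    ∏≡sum : ∀ {n} (f : Fin n → Carrier) → ∏ f ≡ Prod.sum f
    ∏≡sum {zero}  f = refl
    ∏≡sum {suc n} f = cong (f zero *_) (∏≡sum (f ∘ suc))

  ∑-cong : ∀ {n} {f g : Fin n → Carrier} → f ≗ g → ∑ f ≡ ∑ g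
  ∑-cong {zero}  e = refl
  ∑-cong {suc n} e = cong₂ _+_ (e zero) (∑-cong (e ∘ suc))

  ∏-cong : ∀ {n} {f g : Fin n → Carrier} → f ≗ g → ∏ f ≡ ∏ g
  ∏-cong {zero}  e = refl
  ∏-cong {suc n} e = cong₂ _*_ (e zero) (∏-cong (e ∘ suc))

  ∑-zero : ∀ {n} {f : Fin n → Carrier} → (∀ i → f i ≡ 0#) → ∑ f ≡ 0#
  ∑-zero {zero}  z = refl
  ∑-zero {suc n} z = trans (cong₂ _+_ (z zero) (∑-zero (z ∘ suc))) (+-identityˡ _)

  ∏-one : ∀ {n} {f : Fin n → Carrier} → (∀ i → f i ≡ 1#) → ∏ f ≡ 1#
  ∏-one {zero}  z = refl
  ∏-one {suc n} z = trans (cong₂ _*_ (z zero) (∏-one (z ∘ suc))) (*-identityˡ _)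

  ∑-+ : ∀ {n} (f g : Fin n → Carrier) → ∑ (λ i → f i + g i) ≡ ∑ f + ∑ g
  ∑-+ f g = trans (∑≡sum (λ i → f i + g i)) (trans (Sum.∑-distrib-+ f g) (sym (cong₂ _+_ (∑≡sum f) (∑≡sum g))))

  ∏-* : ∀ {n} (f g : Fin n → Carrier) → ∏ (λ i → f i * g i) ≡ ∏ f * ∏ g
  ∏-* f g = trans (∏≡sum (λ i → f i * g i)) (trans (Prod.∑-distrib-+ f g) (sym (cong₂ _*_ (∏≡sum f) (∏≡sum g))))

  *-∑ : ∀ {n} x (f : Fin n → Carrier) → x * ∑ f ≡ ∑ (λ i → x * f i)
  *-∑ x f = trans (cong (x *_) (∑≡sum f)) (trans (Sum.*-distribˡ-sum x f) (sym (∑≡sum (λ i → x * f i))))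

  ∑-comm : ∀ {m n} (f : Fin m → Fin n → Carrier) → ∑ (λ i → ∑ (f i)) ≡ ∑ (λ j → ∑ (λ i → f i j))
  ∑-comm {m} {n} f = trans (rows f) (trans (Sum.∑-comm f) (sym (rows (λ j i → f i j))))
    where
    rows : ∀ {m n} (f : Fin m → Fin n → Carrier) → ∑ (λ i → ∑ (f i)) ≡ Sum.sum (λ i → Sum.sum (f i))
    rows f = trans (∑-cong (λ i → ∑≡sum (f i))) (∑≡sum (λ i → Sum.sum (f i)))

  ∑-remove : ∀ {n} (i : Fin (suc n)) f → ∑ f ≡ f i + ∑ (f ∘ punchIn i)
  ∑-remove i f = trans (∑≡sum f) (trans (Sum.sum-remove f) (cong (f i +_) (sym (∑≡sum (f ∘ punchIn i)))))

  ∏-remove : ∀ {n} (i : Fin (suc n)) f → ∏ f ≡ f i * ∏ (f ∘ punchIn i)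
  ∏-remove i f = trans (∏≡sum f) (trans (Prod.sum-remove f) (cong (f i *_) (sym (∏≡sum (f ∘ punchIn i)))))

  ∏-permute : ∀ {m n} f (π : Permutation m n) → ∏ f ≡ ∏ (λ i → f (π ⟨$⟩ʳ i))
  ∏-permute f π = trans (∏≡sum f) (trans (Prod.sum-permute f π) (sym (∏≡sum (λ i → f (π ⟨$⟩ʳ i)))))

  ∑-single : ∀ {n} (i : Fin n) {f : Fin n → Carrier} → (∀ j → j ≢ i → f j ≡ 0#) → ∑ f ≡ f i
  ∑-single {suc n} i {f} z = trans (∑-remove i f)
    (trans (cong (f i +_) (∑-zero (λ j → z _ (FinP.punchInᵢ≢i i j)))) (+-identityʳ _))

  ∏-single : ∀ {n} (i : Fin n) {f : Fin n → Carrier} → (∀ j → j ≢ i → f j ≡ 1#) → ∏ f ≡ f i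
  ∏-single {suc n} i {f} z = trans (∏-remove i f)
    (trans (cong (f i *_) (∏-one (λ j → z _ (FinP.punchInᵢ≢i i j)))) (*-identityʳ _))

  ∏-++ : ∀ m {n} (f : Fin (m ℕ.+ n) → Carrier) → ∏ f ≡ ∏ (λ i → f (i ↑ˡ n)) * ∏ (λ i → f (m ↑ʳ i))
  ∏-++ zero    f = sym (*-identityˡ _)
  ∏-++ (suc m) f = trans (cong (f zero *_) (∏-++ m (f ∘ suc))) (sym (*-assoc _ _ _))

  ∏-≢0 : ∀ {n} (f : Fin n → Carrier) → (∀ i → f i ≢ 0#) → ∏ f ≢ 0#
  ∏-≢0 {zero}  f ne = 1≢0
  ∏-≢0 {suc n} f ne = *-≢0 (ne zero) (∏-≢0 (f ∘ suc) (ne ∘ suc))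

  δ : ∀ {n} → Fin n → Fin n → Carrier
  δ i j = if does (i FinP.≟ j) then 1# else 0#

  δ-refl : ∀ {n} (i : Fin n) → δ i i ≡ 1#
  δ-refl i rewrite dec-true (i FinP.≟ i) refl = refl

  δ-≢ : ∀ {n} {i j : Fin n} → i ≢ j → δ i j ≡ 0#
  δ-≢ {i = i} {j} ne rewrite dec-false (i FinP.≟ j) ne = refl

  ∑-δˡ : ∀ {n} (i : Fin n) (f : Fin n → Carrier) → ∑ (λ j → δ i j * f j) ≡ f i
  ∑-δˡ i f = trans (∑-single i {λ j → δ i j * f j} (λ j ne → trans (cong (_* f j) (δ-≢ (ne ∘ sym))) (zeroˡ _)))
    (trans (cong (_* f i) (δ-refl i)) (*-identityˡ _))

  ∑-δʳ : ∀ {n} (i : Fin n) (f : Fin n → Carrier) → ∑ (λ j → f j * δ j i) ≡ f i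
  ∑-δʳ i f = trans (∑-single i {λ j → f j * δ j i} (λ j ne → trans (cong (f j *_) (δ-≢ ne)) (zeroʳ _)))
    (trans (cong (f i *_) (δ-refl i)) (*-identityʳ _))

-- Wilson's theorem, the projective line and Lagrange interpolation

module ProjectiveLine {q : ℕ} (F : FiniteField q) where

  open FieldArithmetic F

  open Inverse enum using (to; from; strictlyInverseˡ; strictlyInverseʳ)

  to-injective : Inj to
  to-injective {i} {j} e = trans (sym (strictlyInverseʳ i)) (trans (cong from e) (strictlyInverseʳ j))

  from-injective : Inj from
  from-injective {i} {j} e = trans (sym (strictlyInverseˡ i)) (trans (cong to e) (strictlyInverseˡ j))

  ∏F : (Carrier → Carrier) → Carrier
  ∏F f = ∏ (f ∘ to)

  ∏F-reindex : (f : Carrier → Carrier) (r : Fin q → Carrier) → Inj r → ∏ (f ∘ r) ≡ ∏F f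
  ∏F-reindex f r inj with injective⇒permutation refl (from ∘ r) (inj ∘ from-injective)
  ... | π , π≡ = sym (trans (∏-permute (f ∘ to) π)
    (∏-cong (λ i → cong f (trans (cong to (π≡ i)) (strictlyInverseˡ (r i))))))

  -- Wilson's theorem.  Inversion permutes F ∖ {0, -1}, hence there
  -- ∏ (1 + y) = ∏ (1 + y⁻¹) = ∏ (1 + y) ∏ y⁻¹; so ∏ y⁻¹ = 1 away from 0 and -1.
  ∏F-inv : ∏F inv ≡ - 1#
  ∏F-inv = begin
    ∏F inv                        ≡⟨ ∏-cong (inv-split ∘ to) ⟩
    ∏ (λ i → h (to i) * k (to i)) ≡⟨ ∏-* (h ∘ to) (k ∘ to) ⟩
    ∏F h * ∏F k                   ≡⟨ cong₂ _*_ ∏h≡1 ∏k≡-1 ⟩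
    1# * - 1#                     ≡⟨ *-identityˡ _ ⟩
    - 1#                          ∎
    where
    -1≢0 : - 1# ≢ 0#
    -1≢0 = -‿≢0 1≢0

    -- `σ` is inversion with 0 fixed; the total `inv` is not injective, as it sends both 0 and 1 to
    -- 1. In `g` and `h` the two exceptional factors are set to `1#`, and `k` carries the only
    -- factor left over, `inv (- 1#)`. In characteristic 2 the exceptional point `- 1#` is `1#` and
    -- the argument is the same.
    σ g h k : Carrier → Carrier
    σ y = if does (y ≟ 0#) then 0# else inv y
    g y = if does (y ≟ 0#) then 1# else if does (y ≟ - 1#) then 1# else (1# + y)
    h y = if does (y ≟ 0#) then 1# else if does (y ≟ - 1#) then 1# else inv y
    k y = if does (y ≟ - 1#) then - 1# else 1#

    inv-1 : inv (- 1#) ≡ - 1#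
    inv-1 = inv-unique (trans (solve 1 (λ a → (:- a) :* (:- a) := a :* a) refl 1#) (*-identityˡ 1#))

    inv-split : ∀ y → inv y ≡ h y * k y
    inv-split y with y ≟ 0# | y ≟ - 1#
    ... | yes e | yes e′ = contradiction (trans (sym e′) e) -1≢0
    ... | yes e | no _   = trans (inv-0 e) (sym (*-identityˡ _))
    ... | no _  | yes e′ = trans (cong inv e′) (trans inv-1 (sym (*-identityˡ _)))
    ... | no _  | no _   = sym (*-identityʳ _)

    σ-inj : Inj σ
    σ-inj {x} {y} e with x ≟ 0# | y ≟ 0#
    ... | yes a | yes b = trans a (sym b)
    ... | yes a | no b  = contradiction (sym e) (inv≢0 y)
    ... | no a  | yes b = contradiction e (inv≢0 x)
    ... | no a  | no b  = trans (sym (inv-involutive a)) (trans (cong inv e) (inv-involutive b))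

    g-σ : ∀ y → g (σ y) ≡ g y * h y
    g-σ y with y ≟ 0#
    g-σ y | yes _ with 0# ≟ 0#
    ... | yes _ = sym (*-identityˡ _)
    ... | no n  = contradiction refl n
    g-σ y | no y≢0 with inv y ≟ 0#
    ... | yes z = contradiction z (inv≢0 y)
    ... | no _  with y ≟ - 1# | inv y ≟ - 1#
    ...   | yes _ | yes _ = sym (*-identityˡ _)
    ...   | yes e | no n  = contradiction (trans (cong inv e) inv-1) n
    ...   | no n  | yes e = contradiction (trans (sym (inv-involutive y≢0)) (trans (cong inv e) inv-1)) n
    ...   | no _  | no _  = begin
      1# + inv y             ≡⟨ +-comm _ _ ⟩
      inv y + 1#             ≡⟨ cong₂ _+_ (sym (*-identityˡ _)) (sym (*-inv y≢0)) ⟩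
      1# * inv y + y * inv y ≡⟨ sym (distribʳ _ _ _) ⟩
      (1# + y) * inv y       ∎

    g≢0 : ∀ y → g y ≢ 0#
    g≢0 y with y ≟ 0# | y ≟ - 1#
    ... | yes _ | _     = 1≢0
    ... | no _  | yes _ = 1≢0
    ... | no _  | no n  = λ e → n (x+y≡0⇒x≡-y (trans (+-comm _ _) e))

    ∏h≡1 : ∏F h ≡ 1#
    ∏h≡1 = *-cancelˡ (∏-≢0 (g ∘ to) (g≢0 ∘ to)) (begin
      ∏F g * ∏F h                   ≡⟨ sym (∏-* (g ∘ to) (h ∘ to)) ⟩
      ∏ (λ i → g (to i) * h (to i)) ≡⟨ ∏-cong (λ i → sym (g-σ (to i))) ⟩
      ∏ (g ∘ (σ ∘ to))              ≡⟨ ∏F-reindex g (σ ∘ to) (to-injective ∘ σ-inj) ⟩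
      ∏F g                          ≡⟨ sym (*-identityʳ _) ⟩
      ∏F g * 1#                     ∎)

    ∏k≡-1 : ∏F k ≡ - 1#
    ∏k≡-1 = trans (∏-single (from (- 1#)) {k ∘ to} off) (trans (cong k (strictlyInverseˡ (- 1#))) on)
      where
      on : k (- 1#) ≡ - 1#
      on rewrite dec-true (- 1# ≟ - 1#) refl = refl
      off : ∀ j → j ≢ from (- 1#) → k (to j) ≡ 1#
      off j ne rewrite dec-false (to j ≟ - 1#) (λ e → ne (trans (sym (strictlyInverseʳ j)) (cong from e))) = refl

  abstract
    -- Vectors are functions that are compared pointwise, so the pigeonhole principle is applied to
    -- their codes in `Fin (q ^ k)`. For linear T this replaces the rank-nullity theorem.
    Vect-injective⇒surjective : ∀ {k} (T : Vect k → Vect k) → (∀ {u v} → u ≈ᵥ v → T u ≈ᵥ T v) →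
      (∀ {u v} → T u ≈ᵥ T v → u ≈ᵥ v) → ∀ w → ∃ λ v → T v ≈ᵥ w
    Vect-injective⇒surjective {k} T resp inj w with injective⇒surjective (enc ∘ T ∘ dec) code-inj (enc w)
      where
      enc : Vect k → Fin (q ℕ.^ k)
      enc v = funToFin (from ∘ v)
      dec : Fin (q ℕ.^ k) → Vect k
      dec i j = to (finToFun i j)
      enc-injective : ∀ {u v} → enc u ≡ enc v → u ≈ᵥ v
      enc-injective {u} {v} e j = from-injective (trans (sym (FinP.finToFun-funToFin (from ∘ u) j))
        (trans (cong (λ z → finToFun z j) e) (FinP.finToFun-funToFin (from ∘ v) j)))
      funToFin-cong : ∀ {m n} {f g : Fin m → Fin n} → f ≗ g → funToFin f ≡ funToFin g
      funToFin-cong {zero}  e = refl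
      funToFin-cong {suc m} e = cong₂ Fin.combine (e zero) (funToFin-cong (e ∘ suc))
      dec-injective : ∀ {i j} → dec i ≈ᵥ dec j → i ≡ j
      dec-injective {i} {j} e = trans (sym (FinP.funToFin-finToFin {k} i))
        (trans (funToFin-cong (λ l → to-injective (e l))) (FinP.funToFin-finToFin {k} j))
      code-inj : Inj (enc ∘ T ∘ dec)
      code-inj e = dec-injective (inj (enc-injective e))
    ... | i , e = (λ j → to (finToFun i j)) , λ j → from-injective (trans (sym (FinP.finToFun-funToFin _ j))
        (trans (cong (λ z → finToFun z j) e) (FinP.finToFun-funToFin (from ∘ w) j)))

  V2 : Set
  V2 = Carrier × Carrier

  -- The 2×2 determinant. Two nonzero vectors are the same point of the projective line exactly when
  -- it vanishes, and `br z` is a linear form with zero z.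
  br : V2 → V2 → Carrier
  br (a , b) (c , d) = a * d + - (b * c)

  br-self : ∀ p → br p p ≡ 0#
  br-self (a , b) = solve 2 (λ a b → a :* b :+ :- (b :* a) := :0) refl a b

  br-anti : ∀ p r → br p r ≡ - br r p
  br-anti (a , b) (c , d) = solve 4 (λ a b c d → a :* d :+ :- (b :* c) := :- (c :* b :+ :- (d :* a))) refl a b c d

  br-sym≢0 : ∀ p r → br p r ≢ 0# → br r p ≢ 0#
  br-sym≢0 p r ne e = ne (trans (br-anti p r) (trans (cong -_ e) -0#≈0#))

  -- The three-term Plücker relation, arranged as the expansion of the form `br z` in the forms
  -- `br e₀` and `br e₁`.
  br-plücker : ∀ e₀ e₁ z e → br e₀ e₁ * br z e ≡ br z e₁ * br e₀ e + br e₀ z * br e₁ e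
  br-plücker (a , b) (c , d) (x , y) (s , t) = solve 8 (λ a b c d x y s t →
    (a :* d :+ :- (b :* c)) :* (x :* t :+ :- (y :* s)) :=
    (x :* d :+ :- (y :* c)) :* (a :* t :+ :- (b :* s)) :+ (a :* y :+ :- (b :* x)) :* (c :* t :+ :- (d :* s)))
    refl a b c d x y s t

  sumL-cong : ∀ {A : Set} {f g : A → Carrier} {xs} → All (λ x → f x ≡ g x) xs → sumL (List.map f xs) ≡ sumL (List.map g xs)
  sumL-cong []       = refl
  sumL-cong (e ∷ es) = cong₂ _+_ e (sumL-cong es)

  sumL-+ : ∀ {A : Set} (f g : A → Carrier) xs →
    sumL (List.map (λ x → f x + g x) xs) ≡ sumL (List.map f xs) + sumL (List.map g xs)
  sumL-+ f g []       = sym (+-identityˡ _)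
  sumL-+ f g (x ∷ xs) = trans (cong ((f x + g x) +_) (sumL-+ f g xs))
    (solve 4 (λ a b c d → (a :+ b) :+ (c :+ d) := (a :+ c) :+ (b :+ d)) refl (f x) (g x) _ _)

  *-sumL : ∀ {A : Set} c (f : A → Carrier) xs → c * sumL (List.map f xs) ≡ sumL (List.map (λ x → c * f x) xs)
  *-sumL c f []       = zeroʳ c
  *-sumL c f (x ∷ xs) = trans (distribˡ _ _ _) (cong (c * f x +_) (*-sumL c f xs))

  brs : List V2 → V2 → Carrier
  brs T e = prodL (List.map (λ z → br z e) T)

  -- For e in E the factor u = e is `inv 0#`, that is `1#`. The product is then the Lagrange
  -- denominator, taken over the other points of E.
  invbrs : List V2 → V2 → Carrier
  invbrs E e = prodL (List.map (λ u → inv (br u e)) E)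

  Independent : List V2 → Set
  Independent = AllPairs (λ u v → br u v ≢ 0#)

  -- Lagrange interpolation for products of linear forms: writing the first
  -- z of T through e₀ and e₁ splits the sum into the sums for E ∖ e₀ and E ∖ e₁.
  interpolation : ∀ E T → Independent E → length E ≡ 2 ℕ.+ length T →
    sumL (List.map (λ e → brs T e * invbrs E e) E) ≡ 0#
  interpolation (e₀ ∷ e₁ ∷ []) [] ((n ∷ []) ∷ _) refl = begin
    1# * (inv (br e₀ e₀) * (inv (br e₁ e₀) * 1#)) + (1# * (inv (br e₀ e₁) * (inv (br e₁ e₁) * 1#)) + 0#)
      ≡⟨ cong₂ (λ a b → 1# * (a * (inv (br e₁ e₀) * 1#)) + (1# * (inv (br e₀ e₁) * (b * 1#)) + 0#)) (inv-0 (br-self e₀)) (inv-0 (br-self e₁)) ⟩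
    1# * (1# * (inv (br e₁ e₀) * 1#)) + (1# * (inv (br e₀ e₁) * (1# * 1#)) + 0#)
      ≡⟨ cong (λ a → 1# * (1# * (a * 1#)) + (1# * (inv (br e₀ e₁) * (1# * 1#)) + 0#)) (trans (cong inv (br-anti e₁ e₀)) (inv-neg n)) ⟩
    1# * (1# * (- inv (br e₀ e₁) * 1#)) + (1# * (inv (br e₀ e₁) * (1# * 1#)) + 0#)
      ≡⟨ solve 1 (λ x → :1 :* (:1 :* ((:- x) :* :1)) :+ (:1 :* (x :* (:1 :* :1)) :+ :0) := :0) refl (inv (br e₀ e₁)) ⟩
    0# ∎
  interpolation (e₀ ∷ e₁ ∷ E) (z ∷ T) ((n₀₁ ∷ n₀) ∷ (n₁ ∷ ns)) eq = x*y≡0⇒y≡0 n₀₁ (begin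
    br e₀ e₁ * sumL (List.map term (e₀ ∷ e₁ ∷ E))
      ≡⟨ *-sumL _ term (e₀ ∷ e₁ ∷ E) ⟩
    sumL (List.map (λ e → br e₀ e₁ * term e) (e₀ ∷ e₁ ∷ E))
      ≡⟨ sumL-cong (All.universal split (e₀ ∷ e₁ ∷ E)) ⟩
    sumL (List.map (λ e → br z e₁ * t₁ e + br e₀ z * t₀ e) (e₀ ∷ e₁ ∷ E))
      ≡⟨ sumL-+ (λ e → br z e₁ * t₁ e) (λ e → br e₀ z * t₀ e) (e₀ ∷ e₁ ∷ E) ⟩
    sumL (List.map (λ e → br z e₁ * t₁ e) (e₀ ∷ e₁ ∷ E)) + sumL (List.map (λ e → br e₀ z * t₀ e) (e₀ ∷ e₁ ∷ E))
      ≡⟨ sym (cong₂ _+_ (*-sumL (br z e₁) t₁ (e₀ ∷ e₁ ∷ E)) (*-sumL (br e₀ z) t₀ (e₀ ∷ e₁ ∷ E))) ⟩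
    br z e₁ * sumL (List.map t₁ (e₀ ∷ e₁ ∷ E)) + br e₀ z * sumL (List.map t₀ (e₀ ∷ e₁ ∷ E))
      ≡⟨ cong₂ (λ a b → br z e₁ * a + br e₀ z * b) sum₁ sum₀ ⟩
    br z e₁ * 0# + br e₀ z * 0#
      ≡⟨ solve 2 (λ a b → a :* :0 :+ b :* :0 := :0) refl (br z e₁) (br e₀ z) ⟩
    0# ∎)
    where
    term t₀ t₁ : V2 → Carrier
    term e = (br z e * brs T e) * (inv (br e₀ e) * (inv (br e₁ e) * invbrs E e))
    -- The leading factor x * inv x is `0#` at e₀ and `1#` at the other points of the list. So `t₁`
    -- is the summand of the problem with e₀ removed from E and z from T; `t₀` does the same for e₁.
    t₁ e = (br e₀ e * inv (br e₀ e)) * (brs T e * (inv (br e₁ e) * invbrs E e))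
    t₀ e = (br e₁ e * inv (br e₁ e)) * (brs T e * (inv (br e₀ e) * invbrs E e))

    split : ∀ e → br e₀ e₁ * term e ≡ br z e₁ * t₁ e + br e₀ z * t₀ e
    split e = begin
      br e₀ e₁ * term e
        ≡⟨ solve 6 (λ d a b c f g → d :* ((a :* b) :* (c :* (f :* g))) := (d :* a) :* (b :* (c :* (f :* g)))) refl
             (br e₀ e₁) (br z e) (brs T e) (inv (br e₀ e)) (inv (br e₁ e)) (invbrs E e) ⟩
      (br e₀ e₁ * br z e) * (brs T e * (inv (br e₀ e) * (inv (br e₁ e) * invbrs E e)))
        ≡⟨ cong (_* (brs T e * (inv (br e₀ e) * (inv (br e₁ e) * invbrs E e)))) (br-plücker e₀ e₁ z e) ⟩
      (br z e₁ * br e₀ e + br e₀ z * br e₁ e) * (brs T e * (inv (br e₀ e) * (inv (br e₁ e) * invbrs E e)))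
        ≡⟨ solve 8 (λ p x r y b c f g → (p :* x :+ r :* y) :* (b :* (c :* (f :* g))) :=
               p :* ((x :* c) :* (b :* (f :* g))) :+ r :* ((y :* f) :* (b :* (c :* g)))) refl
             (br z e₁) (br e₀ e) (br e₀ z) (br e₁ e) (brs T e) (inv (br e₀ e)) (inv (br e₁ e)) (invbrs E e) ⟩
      br z e₁ * t₁ e + br e₀ z * t₀ e ∎

    unit : ∀ {x} y → x ≢ 0# → (x * inv x) * y ≡ y
    unit y ne = trans (cong (_* y) (*-inv ne)) (*-identityˡ y)

    vanish : ∀ e x y → (br e e * x) * y ≡ 0#
    vanish e x y = trans (cong (λ w → (w * x) * y) (br-self e)) (trans (cong (_* y) (zeroˡ x)) (zeroˡ y))

    sum₁ : sumL (List.map t₁ (e₀ ∷ e₁ ∷ E)) ≡ 0#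
    sum₁ = trans (cong₂ _+_ (vanish e₀ _ _) (sumL-cong {xs = e₁ ∷ E} (unit _ n₀₁ ∷ All.map (λ ne → unit _ ne) n₀)))
      (trans (+-identityˡ _) (interpolation (e₁ ∷ E) T (n₁ ∷ ns) (ℕP.suc-injective eq)))

    sum₀ : sumL (List.map t₀ (e₀ ∷ e₁ ∷ E)) ≡ 0#
    sum₀ = trans (cong₂ _+_ (unit _ (br-sym≢0 e₀ e₁ n₀₁)) (cong₂ _+_ (vanish e₁ _ _) (sumL-cong {xs = E} (All.map (λ ne → unit _ ne) n₁))))
      (trans (cong (brs T e₀ * (inv (br e₀ e₀) * invbrs E e₀) +_) (+-identityˡ _)) (interpolation (e₀ ∷ E) T (n₀ ∷ ns) (ℕP.suc-injective eq)))

  PairwiseIndependent : ∀ {n} → (Fin n → V2) → Set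
  PairwiseIndependent p = ∀ {i j} → i ≢ j → br (p i) (p j) ≢ 0#

  -- Segre's lemma of tangents in its most primitive form.  For e ≠ e′ the
  -- ratios [g,e] / [g,e′] run over all of F as g runs over the points other
  -- than e′, so Wilson's theorem compares the two products.
  ∏-inv-br-const : (p : Fin (suc q) → V2) → PairwiseIndependent p → ∀ e e′ →
    ∏ (λ g → inv (br (p g) (p e))) ≡ ∏ (λ g → inv (br (p g) (p e′)))
  ∏-inv-br-const p ind e e′ with e FinP.≟ e′
  ... | yes refl = refl
  ... | no e≢e′ = begin
    ∏ (inv ∘ x)                        ≡⟨ ∏-remove e′ (inv ∘ x) ⟩
    inv (x e′) * X                     ≡⟨ cong (λ w → inv w * X) (br-anti (p e′) (p e)) ⟩
    inv (- D) * X                      ≡⟨ cong (_* X) (inv-neg D≢0) ⟩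
    (- inv D) * X                      ≡⟨ solve 2 (λ a b → (:- a) :* b := :- (b :* a)) refl (inv D) X ⟩
    - (X * inv D)                      ≡⟨ cong -_ X*invD ⟩
    - (- 1# * Y)                       ≡⟨ solve 1 (λ a → :- ((:- :1) :* a) := :1 :* a) refl Y ⟩
    1# * Y                             ≡⟨ cong (_* Y) (sym (inv-0 (br-self (p e′)))) ⟩
    inv (y e′) * Y                     ≡⟨ sym (∏-remove e′ (inv ∘ y)) ⟩
    ∏ (inv ∘ y)                        ∎
    where
    x y : Fin (suc q) → Carrier
    x g = br (p g) (p e)
    y g = br (p g) (p e′)
    ι : Fin q → Fin (suc q)
    ι = punchIn e′
    D X Y : Carrier
    D = br (p e) (p e′)
    X = ∏ (inv ∘ x ∘ ι)
    Y = ∏ (inv ∘ y ∘ ι)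
    D≢0 : D ≢ 0#
    D≢0 = ind e≢e′
    y≢0 : ∀ i → y (ι i) ≢ 0#
    y≢0 i = ind (FinP.punchInᵢ≢i e′ i)

    r h : Fin q → Carrier
    r i = x (ι i) * inv (y (ι i))
    -- At the point e both x and the ratio r vanish, and their total inverses are `1#`. There `h`
    -- supplies the factor inv D, which is the inverse of y at e.
    h i = if does (ι i FinP.≟ e) then inv D else 1#

    -- By the Plücker relation, equal ratios at two different points would make the bracket of these
    -- points vanish.
    r-inj : Inj r
    r-inj {i} {j} eq with ι i FinP.≟ ι j
    ... | yes s = FinP.punchIn-injective e′ i j s
    ... | no ne = contradiction cross (*-≢0 D≢0 (ind (ne ∘ sym)))
      where
      clear : ∀ a b c → b ≢ 0# → a * inv b * (b * c) ≡ a * c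
      clear a b c b≢0 = trans (solve 4 (λ a b i c → a :* i :* (b :* c) := a :* (b :* i) :* c) refl a b (inv b) c)
        (cong (_* c) (trans (cong (a *_) (*-inv b≢0)) (*-identityʳ a)))
      xy : x (ι i) * y (ι j) ≡ x (ι j) * y (ι i)
      xy = trans (sym (clear (x (ι i)) (y (ι i)) (y (ι j)) (y≢0 i))) (trans (cong (_* (y (ι i) * y (ι j))) eq)
        (trans (cong (r j *_) (*-comm _ _)) (clear (x (ι j)) (y (ι j)) (y (ι i)) (y≢0 j))))
      cross : D * br (p (ι j)) (p (ι i)) ≡ 0#
      cross = begin
        D * br (p (ι j)) (p (ι i))
          ≡⟨ br-plücker (p e) (p e′) (p (ι j)) (p (ι i)) ⟩
        y (ι j) * br (p e) (p (ι i)) + br (p e) (p (ι j)) * br (p e′) (p (ι i))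
          ≡⟨ cong₂ (λ a b → y (ι j) * a + b) (br-anti (p e) (p (ι i))) (cong₂ _*_ (br-anti (p e) (p (ι j))) (br-anti (p e′) (p (ι i)))) ⟩
        y (ι j) * - x (ι i) + (- x (ι j)) * (- y (ι i))
          ≡⟨ solve 4 (λ a b c d → b :* (:- a) :+ (:- c) :* (:- d) := c :* d :+ :- (a :* b)) refl (x (ι i)) (y (ι j)) (x (ι j)) (y (ι i)) ⟩
        x (ι j) * y (ι i) + - (x (ι i) * y (ι j))
          ≡⟨ cong (λ w → x (ι j) * y (ι i) + - w) xy ⟩
        x (ι j) * y (ι i) + - (x (ι j) * y (ι i))
          ≡⟨ -‿inverseʳ _ ⟩
        0# ∎

    pointwise : ∀ i → inv (x (ι i)) * h i ≡ inv (r i) * inv (y (ι i))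
    pointwise i with ι i FinP.≟ e
    ... | yes s = cong₂ _*_ (trans (inv-0 x≡0) (sym (inv-0 (trans (cong (_* inv (y (ι i))) x≡0) (zeroˡ _))))) (cong (λ w → inv (br (p w) (p e′))) (sym s))
      where
      x≡0 : x (ι i) ≡ 0#
      x≡0 = trans (cong x s) (br-self (p e))
    ... | no ne = begin
      inv (x (ι i)) * 1#                                         ≡⟨ cong (inv (x (ι i)) *_) (sym (*-inv (y≢0 i))) ⟩
      inv (x (ι i)) * (y (ι i) * inv (y (ι i)))                  ≡⟨ sym (*-assoc _ _ _) ⟩
      inv (x (ι i)) * y (ι i) * inv (y (ι i))                    ≡⟨ cong (λ w → inv (x (ι i)) * w * inv (y (ι i))) (sym (inv-involutive (y≢0 i))) ⟩
      inv (x (ι i)) * inv (inv (y (ι i))) * inv (y (ι i))        ≡⟨ cong (_* inv (y (ι i))) (sym (inv-distrib-* (ind ne) (inv≢0 _))) ⟩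
      inv (r i) * inv (y (ι i))                                  ∎

    ∏h : ∏ h ≡ inv D
    ∏h = trans (∏-single i₀ {h} off) on
      where
      i₀ = punchOut {i = e′} {j = e} (e≢e′ ∘ sym)
      ιi₀ : ι i₀ ≡ e
      ιi₀ = FinP.punchIn-punchOut (e≢e′ ∘ sym)
      on : h i₀ ≡ inv D
      on rewrite dec-true (ι i₀ FinP.≟ e) ιi₀ = refl
      off : ∀ j → j ≢ i₀ → h j ≡ 1#
      off j ne rewrite dec-false (ι j FinP.≟ e) (λ s → ne (FinP.punchIn-injective e′ j i₀ (trans s (sym ιi₀)))) = refl

    X*invD : X * inv D ≡ - 1# * Y
    X*invD = begin
      X * inv D                                    ≡⟨ cong (X *_) (sym ∏h) ⟩
      X * ∏ h                                      ≡⟨ sym (∏-* (inv ∘ x ∘ ι) h) ⟩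
      ∏ (λ i → inv (x (ι i)) * h i)                ≡⟨ ∏-cong pointwise ⟩
      ∏ (λ i → inv (r i) * inv (y (ι i)))          ≡⟨ ∏-* (inv ∘ r) (inv ∘ y ∘ ι) ⟩
      ∏ (inv ∘ r) * Y                              ≡⟨ cong (_* Y) (trans (∏F-reindex inv r r-inj) ∏F-inv) ⟩
      - 1# * Y                                     ∎

  0₂ : V2
  0₂ = 0# , 0#

  br-0₂ : ∀ r → br 0₂ r ≡ 0#
  br-0₂ (x , y) = solve 2 (λ x y → :0 :* y :+ :- (:0 :* x) := :0) refl x y

  -- Cramer's rule for two independent linear forms that both vanish at p.
  br-zero⇒0₂ : ∀ p r s → br r s ≢ 0# → br r p ≡ 0# → br s p ≡ 0# → p ≡ 0₂
  br-zero⇒0₂ (a , b) (c , d) (s , t) ne e₁ e₂ = cong₂ _,_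
    (x*y≡0⇒y≡0 ne (trans (solve 6 (λ a b c d s t → (c :* t :+ :- (d :* s)) :* a := s :* (c :* b :+ :- (d :* a)) :+ :- (c :* (s :* b :+ :- (t :* a)))) refl a b c d s t) (both s c)))
    (x*y≡0⇒y≡0 ne (trans (solve 6 (λ a b c d s t → (c :* t :+ :- (d :* s)) :* b := t :* (c :* b :+ :- (d :* a)) :+ :- (d :* (s :* b :+ :- (t :* a)))) refl a b c d s t) (both t d)))
    where
    both : ∀ x y → x * (c * b + - (d * a)) + - (y * (s * b + - (t * a))) ≡ 0#
    both x y = trans (cong₂ (λ m n → x * m + - (y * n)) e₁ e₂)
      (solve 2 (λ x y → x :* :0 :+ :- (y :* :0) := :0) refl x y)

  -- The points of the projective line, in the order in which NRC lists its points.
  point : Fin (suc q) → V2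
  point i with toℕ i ℕ.<? q
  ... | yes i<q = 1# , to (fromℕ< i<q)
  ... | no _    = 0# , 1#

  point-independent : PairwiseIndependent point
  point-independent {i} {j} i≢j with toℕ i ℕ.<? q | toℕ j ℕ.<? q
  ... | yes i<q | yes j<q = λ e → i≢j (FinP.toℕ-injective (FinP.fromℕ<-injective _ _ i<q j<q (to-injective (sym (x-y≡0⇒x≡y
          (trans (solve 2 (λ a b → b :+ :- a := :1 :* b :+ :- (a :* :1)) refl (to (fromℕ< i<q)) (to (fromℕ< j<q))) e))))))
  ... | yes i<q | no _    = λ e → 1≢0 (trans (solve 1 (λ a → :1 := :1 :* :1 :+ :- (a :* :0)) refl (to (fromℕ< i<q))) e)
  ... | no _    | yes j<q = λ e → -‿≢0 1≢0 (trans (solve 1 (λ a → :- :1 := :0 :* a :+ :- (:1 :* :1)) refl (to (fromℕ< j<q))) e)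
  ... | no i≮q  | no j≮q  = contradiction (FinP.toℕ-injective (trans (last i i≮q) (sym (last j j≮q)))) i≢j
    where
    last : ∀ (i : Fin (suc q)) → ¬ toℕ i ℕ.< q → toℕ i ≡ q
    last i i≮q = ℕP.≤-antisym (ℕP.≤-pred (FinP.toℕ<n i)) (ℕP.≮⇒≥ i≮q)

  point≢0₂ : ∀ i → point i ≢ 0₂
  point≢0₂ i with toℕ i ℕ.<? q
  ... | yes _ = λ e → 1≢0 (cong proj₁ e)
  ... | no _  = λ e → 1≢0 (cong proj₂ e)

  infixr 7 _•_
  _•_ : Carrier → V2 → V2
  c • (a , b) = c * a , c * b

  normalise : ∀ p → p ≢ 0₂ → ∃ λ i → ∃ λ c → c ≢ 0# × p ≡ c • point i
  normalise (s , t) ne with s ≟ 0#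
  ... | no s≢0 = i , s , s≢0 , lemma
    where
    i = Fin.inject₁ (from (inv s * t))
    lemma : (s , t) ≡ s • point i
    lemma with toℕ i ℕ.<? q
    ... | yes i<q = cong₂ _,_ (sym (*-identityʳ s)) (sym (begin
        s * to (fromℕ< i<q)         ≡⟨ cong (λ w → s * to w) (FinP.toℕ-injective (trans (FinP.toℕ-fromℕ< i<q) (FinP.toℕ-inject₁ _))) ⟩
        s * to (from (inv s * t))   ≡⟨ cong (s *_) (strictlyInverseˡ _) ⟩
        s * (inv s * t)             ≡⟨ sym (*-assoc _ _ _) ⟩
        s * inv s * t               ≡⟨ cong (_* t) (*-inv s≢0) ⟩
        1# * t                      ≡⟨ *-identityˡ t ⟩
        t                           ∎))
    ... | no i≮q = contradiction (subst (ℕ._< q) (sym (FinP.toℕ-inject₁ (from (inv s * t)))) (FinP.toℕ<n (from (inv s * t)))) i≮q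
  ... | yes s≡0 = fromℕ q , t , (λ t≡0 → ne (cong₂ _,_ s≡0 t≡0)) , lemma
    where
    lemma : (s , t) ≡ t • point (fromℕ q)
    lemma with toℕ (fromℕ q) ℕ.<? q
    ... | yes l = contradiction (subst (ℕ._< q) (FinP.toℕ-fromℕ q) l) (ℕP.<-irrefl refl)
    ... | no _  = cong₂ _,_ (trans s≡0 (sym (zeroʳ t))) (sym (*-identityʳ t))

  abstract
    -- Otherwise each of the q + 1 points of the line is proportional to some p j with j outside the
    -- list. A nonzero vector is proportional to one point only, so choosing such j is injective,
    -- hence surjective, although it never takes the value x.
    missing-point : ∀ x xs (p : Fin (suc q) → V2) → (∀ i → i ∉ x ∷ xs → p i ≢ 0₂) →
      ∃ λ z → z ≢ 0₂ × (∀ j → j ∉ x ∷ xs → br z (p j) ≢ 0#)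
    missing-point x xs p nz with FinP.any? free?
      where
      free? : ∀ i → Dec (∀ j → j ∈ x ∷ xs ⊎ br (point i) (p j) ≢ 0#)
      free? i = FinP.all? (λ j → (j ∈? (x ∷ xs)) ⊎-dec ¬? (br (point i) (p j) ≟ 0#))
    ... | yes (i , f) = point i , point≢0₂ i , z-free
      where
      z-free : ∀ j → j ∉ x ∷ xs → br (point i) (p j) ≢ 0#
      z-free j nin with f j
      ... | inj₁ m = contradiction m nin
      ... | inj₂ n = n
    ... | no ¬f = contradiction (here refl) (subst (_∉ x ∷ xs) (proj₂ surj) (proj₁ (proj₂ (hit (proj₁ surj)))))
      where
      hit : ∀ i → ∃ λ j → j ∉ x ∷ xs × br (point i) (p j) ≡ 0#
      hit i with FinP.any? (λ j → ¬? ((j ∈? (x ∷ xs)) ⊎-dec ¬? (br (point i) (p j) ≟ 0#)))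
      ... | no none = contradiction (i , dec) ¬f
        where
        dec : ∀ j → j ∈ x ∷ xs ⊎ br (point i) (p j) ≢ 0#
        dec j with (j ∈? (x ∷ xs)) ⊎-dec ¬? (br (point i) (p j) ≟ 0#)
        ... | yes y = y
        ... | no n  = contradiction (j , n) none
      ... | yes (j , n) with br (point i) (p j) ≟ 0#
      ...   | yes e = j , n ∘ inj₁ , e
      ...   | no e  = contradiction (inj₂ e) n
      h : Fin (suc q) → Fin (suc q)
      h i = proj₁ (hit i)
      h-inj : Inj h
      h-inj {i} {i′} e with i FinP.≟ i′
      ... | yes s = s
      ... | no ne = contradiction (br-zero⇒0₂ (p (h i)) (point i) (point i′) (point-independent ne) (proj₂ (proj₂ (hit i)))
                      (trans (cong (λ w → br (point i′) (p w)) e) (proj₂ (proj₂ (hit i′))))) (nz _ (proj₁ (proj₂ (hit i))))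
      surj : ∃ λ i → h i ≡ x
      surj = injective⇒surjective h h-inj x

  -- The points xs may be moved so that the family covers the whole projective line.
  fill : (xs : List (Fin (suc q))) (p : Fin (suc q) → V2) →
    (∀ i → i ∉ xs → p i ≢ 0₂) → (∀ i j → i ≢ j → i ∉ xs → j ∉ xs → br (p i) (p j) ≢ 0#) →
    ∃ λ p′ → PairwiseIndependent p′ × (∀ i → i ∉ xs → p′ i ≡ p i)
  fill [] p nz ind = p , (λ {i} {j} ne → ind i j ne (λ ()) (λ ())) , λ _ _ → refl
  fill (x ∷ xs) p nz ind = found
    where
    z : V2
    z = proj₁ (missing-point x xs p nz)

    p₁ : Fin (suc q) → V2
    p₁ i = if does (i FinP.≟ x) then z else p i

    outside : ∀ {i} → i ≢ x → i ∉ xs → i ∉ x ∷ xs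
    outside ne nin (here e)   = ne e
    outside ne nin (there m)  = nin m

    z-free : ∀ j → j ∉ x ∷ xs → br z (p j) ≢ 0#
    z-free = proj₂ (proj₂ (missing-point x xs p nz))

    nz₁ : ∀ i → i ∉ xs → p₁ i ≢ 0₂
    nz₁ i nin with i FinP.≟ x
    ... | yes _ = proj₁ (proj₂ (missing-point x xs p nz))
    ... | no ne = nz i (outside ne nin)

    ind₁ : ∀ i j → i ≢ j → i ∉ xs → j ∉ xs → br (p₁ i) (p₁ j) ≢ 0#
    ind₁ i j i≢j i∉ j∉ with i FinP.≟ x | j FinP.≟ x
    ... | yes a | yes b = contradiction (trans a (sym b)) i≢j
    ... | yes _ | no b  = z-free j (outside b j∉)
    ... | no a  | yes _ = br-sym≢0 z (p i) (z-free i (outside a i∉))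
    ... | no a  | no b  = ind i j i≢j (outside a i∉) (outside b j∉)

    p₁-off : ∀ i → i ≢ x → p₁ i ≡ p i
    p₁-off i ne rewrite dec-false (i FinP.≟ x) ne = refl

    found : ∃ λ p′ → PairwiseIndependent p′ × (∀ i → i ∉ x ∷ xs → p′ i ≡ p i)
    found with fill xs p₁ nz₁ ind₁
    ... | p′ , ind′ , agree = p′ , ind′ , λ i nin → trans (agree i (nin ∘ there)) (p₁-off i (nin ∘ here))

-- Determinants from the Laplace expansion

module Determinants {q : ℕ} (F : FiniteField q) where

  open FieldArithmetic F

  -- H j l stands for the value at the ordered pair (j , punchIn j l). The first component compares
  -- the pairs (zero , suc l) and (suc l , zero); the recursion handles the pairs without zero.
  Antisymmetric : ∀ {n} → (Fin (suc n) → Fin n → Carrier) → Set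
  Antisymmetric {zero}  H = ⊤
  Antisymmetric {suc n} H = (∀ l → H zero l ≡ - H (suc l) zero) × Antisymmetric (λ j l → H (suc j) (suc l))

  Antisymmetric-cong : ∀ {n} {H H′ : Fin (suc n) → Fin n → Carrier} → (∀ j l → H j l ≡ H′ j l) → Antisymmetric H → Antisymmetric H′
  Antisymmetric-cong {zero}  e _ = tt
  Antisymmetric-cong {suc n} e (a , r) =
    (λ l → trans (sym (e zero l)) (trans (a l) (cong -_ (e (suc l) zero)))) ,
    Antisymmetric-cong (λ j l → e (suc j) (suc l)) r

  -- The ordered pairs of distinct indices are listed as (j , punchIn j l);
  -- a symmetric and an antisymmetric function of such pairs are orthogonal.
  symmetric⊥antisymmetric : ∀ {n} (g : Fin (suc n) → Fin (suc n) → Carrier) (H : Fin (suc n) → Fin n → Carrier) →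
    (∀ a b → g a b ≡ g b a) → Antisymmetric H → ∑ (λ j → ∑ (λ l → g j (punchIn j l) * H j l)) ≡ 0#
  symmetric⊥antisymmetric {zero}  g H gs _ = +-identityʳ 0#
  symmetric⊥antisymmetric {suc n} g H gs (a , r) = begin
    A + ∑ (λ j → B j + C j)                ≡⟨ cong (A +_) (∑-+ B C) ⟩
    A + (∑ B + ∑ C)                        ≡⟨ cong (λ c → A + (∑ B + c)) (symmetric⊥antisymmetric (λ a b → g (suc a) (suc b)) (λ j l → H (suc j) (suc l)) (λ a b → gs (suc a) (suc b)) r) ⟩
    A + (∑ B + 0#)                         ≡⟨ cong (A +_) (+-identityʳ _) ⟩
    A + ∑ B                                ≡⟨ sym (∑-+ (λ l → g zero (suc l) * H zero l) B) ⟩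
    ∑ (λ l → g zero (suc l) * H zero l + B l) ≡⟨ ∑-zero (λ l → trans (cong₂ (λ u v → u * v + B l) (gs zero (suc l)) (a l))
                                                (solve 2 (λ x y → x :* (:- y) :+ x :* y := :0) refl (g (suc l) zero) (H (suc l) zero))) ⟩
    0#                                     ∎
    where
    A = ∑ (λ l → g zero (suc l) * H zero l)
    B C : Fin (suc n) → Carrier
    B j = g (suc j) zero * H (suc j) zero
    C j = ∑ (λ l → g (suc j) (suc (punchIn j l)) * H (suc j) (suc l))

  private
    lift : ∀ {m n} → (Fin m → Fin n) → Fin (suc m) → Fin (suc n)
    lift h zero    = zero
    lift h (suc c) = suc (h c)

  -- Deleting two columns in either order leaves the same columns, but the later one is counted one
  -- place lower once the earlier one is gone, and this flips the sign. M is an arbitrary function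
  -- of the selected columns, so that the recursion can pass to selections which keep column zero,
  -- by `lift`.
  minors-antisymmetric : ∀ n (M : (Fin n → Fin (2 ℕ.+ n)) → Carrier) → (∀ {h h′} → h ≗ h′ → M h ≡ M h′) →
    Antisymmetric (λ j l → sgn (toℕ j) * sgn (toℕ l) * M (punchIn j ∘ punchIn l))
  minors-antisymmetric zero M ext = first , tt
    where
    first : ∀ l → _
    first zero = trans (cong (1# * 1# *_) (ext {punchIn zero ∘ punchIn zero} {punchIn (suc zero) ∘ punchIn zero} (λ ()))) (solve 1 (λ x → :1 :* :1 :* x := :- ((:- :1) :* :1 :* x)) refl (M (punchIn (suc zero) ∘ punchIn zero)))
  minors-antisymmetric (suc n) M ext = first , Antisymmetric-cong shift
    (minors-antisymmetric n (M ∘ lift) (λ e → ext (λ { zero → refl ; (suc c) → cong suc (e c) })))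
    where
    first : ∀ l → _
    first l = solve 2 (λ x s → :1 :* s :* x := :- ((:- s) :* :1 :* x)) refl (M (suc ∘ punchIn l)) (sgn (toℕ l))
    shift : ∀ j l → _
    shift j l = trans (cong (sgn (toℕ j) * sgn (toℕ l) *_) (ext {lift (punchIn j ∘ punchIn l)} {punchIn (suc j) ∘ punchIn (suc l)} (λ { zero → refl ; (suc c) → refl })))
      (solve 3 (λ a b x → a :* b :* x := (:- a) :* (:- b) :* x) refl (sgn (toℕ j)) (sgn (toℕ l)) (M (punchIn (suc j) ∘ punchIn (suc l))))

  deleteColumn : ∀ {k} → Fin (suc k) → Vect (suc k) → Vect k
  deleteColumn j v c = v (punchIn j c)

  cofactor : ∀ {k} → List (Vect (suc k)) → Fin (suc k) → Carrier
  cofactor rs j = sgn (toℕ j) * det (List.map (deleteColumn j) rs)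

  det-expand : ∀ {k} (r : Vect (suc k)) rs → det (r ∷ rs) ≡ ∑ (λ j → cofactor rs j * r j)
  det-expand {k} r rs = 
    (∑-cong {f = f} (λ j → solve 3 (λ a b c → a :* b :* c := a :* c :* b) refl (sgn (toℕ j)) (r j) (det (List.map (deleteColumn j) rs))))
    where
    f : Fin (suc k) → Carrier
    f j = sgn (toℕ j) * r j * det (List.map (deleteColumn j) rs)

  det-cong : ∀ {k} {vs ws : List (Vect k)} → Pointwise _≈ᵥ_ vs ws → det vs ≡ det ws
  det-cong {zero}  []       = refl
  det-cong {zero}  (_ ∷ _)  = refl
  det-cong {suc k} []       = refl
  det-cong {suc k} {r ∷ rs} {r′ ∷ rs′} (e ∷ es) = trans (det-expand r rs) (trans
    (∑-cong (λ j → cong₂ _*_ (cong (sgn (toℕ j) *_) (det-cong (Pointwise.map⁺ _ _ (Pointwise.map (λ e c → e (punchIn j c)) es)))) (e j)))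
    (sym (det-expand r′ rs′)))

  det-expand₂ : ∀ {n : ℕ} (x y : Vect (2 ℕ.+ n)) vs → det (x ∷ y ∷ vs) ≡
    ∑ (λ j → ∑ (λ l → (x j * y (punchIn j l)) * (sgn (toℕ j) * sgn (toℕ l) * det (List.map (λ v c → v (punchIn j (punchIn l c))) vs))))
  det-expand₂ {n} x y vs = trans (det-expand x (y ∷ vs)) (∑-cong λ j → begin
    sgn (toℕ j) * det (deleteColumn j y ∷ List.map (deleteColumn j) vs) * x j
      ≡⟨ cong (λ w → sgn (toℕ j) * w * x j) (det-expand (deleteColumn j y) (List.map (deleteColumn j) vs)) ⟩
    sgn (toℕ j) * ∑ (λ l → cofactor (List.map (deleteColumn j) vs) l * y (punchIn j l)) * x j
      ≡⟨ solve 3 (λ a b c → a :* b :* c := (a :* c) :* b) refl (sgn (toℕ j)) _ (x j) ⟩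
    (sgn (toℕ j) * x j) * ∑ (λ l → cofactor (List.map (deleteColumn j) vs) l * y (punchIn j l))
      ≡⟨ *-∑ (sgn (toℕ j) * x j) (λ l → cofactor (List.map (deleteColumn j) vs) l * y (punchIn j l)) ⟩
    ∑ (λ l → (sgn (toℕ j) * x j) * (cofactor (List.map (deleteColumn j) vs) l * y (punchIn j l)))
      ≡⟨ ∑-cong (λ l → trans (cong (λ w → (sgn (toℕ j) * x j) * (sgn (toℕ l) * det w * y (punchIn j l))) (sym (ListP.map-∘ {g = deleteColumn l} {f = deleteColumn j} vs)))
           (solve 5 (λ a b c d e → (a :* b) :* (c :* d :* e) := (b :* e) :* (a :* c :* d)) refl (sgn (toℕ j)) (x j) (sgn (toℕ l)) _ (y (punchIn j l)))) ⟩
    _ ∎)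

  private
    H₂ : ∀ {n} → List (Vect (2 ℕ.+ n)) → Fin (2 ℕ.+ n) → Fin (suc n) → Carrier
    H₂ vs j l = sgn (toℕ j) * sgn (toℕ l) * det (List.map (λ v c → v (punchIn j (punchIn l c))) vs)

    H₂-antisymmetric : ∀ {n} (vs : List (Vect (2 ℕ.+ n))) → Antisymmetric (H₂ vs)
    H₂-antisymmetric {n} vs = minors-antisymmetric n (λ h → det (List.map (λ v c → v (h c)) vs))
      (λ e → det-cong (Pointwise.map⁺ _ _ (Pointwise.refl (λ {v} c → cong v (e c)))))

    det₁-long : (x y : Vect 1) (vs : List (Vect 1)) → det (x ∷ y ∷ vs) ≡ 0#
    det₁-long x y vs = trans (+-identityʳ _) (zeroʳ _)

  det-equal-top : ∀ {k} (x : Vect k) vs → det (x ∷ x ∷ vs) ≡ 0#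
  det-equal-top {zero}        x vs = refl
  det-equal-top {suc zero}    x vs = det₁-long x x vs
  det-equal-top {suc (suc n)} x vs = trans (det-expand₂ x x vs)
    (symmetric⊥antisymmetric (λ a b → x a * x b) (H₂ vs) (λ a b → *-comm _ _) (H₂-antisymmetric vs))

  det-swap-top : ∀ {k} (x y : Vect k) vs → det (x ∷ y ∷ vs) ≡ - det (y ∷ x ∷ vs)
  det-swap-top {zero}        x y vs = sym -0#≈0#
  det-swap-top {suc zero}    x y vs = trans (det₁-long x y vs) (trans (sym -0#≈0#) (cong -_ (sym (det₁-long y x vs))))
  det-swap-top {suc (suc n)} x y vs = x+y≡0⇒x≡-y (begin
    det (x ∷ y ∷ vs) + det (y ∷ x ∷ vs)
      ≡⟨ cong₂ _+_ (det-expand₂ x y vs) (det-expand₂ y x vs) ⟩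
    ∑ (λ j → ∑ (λ l → (x j * y (punchIn j l)) * H₂ vs j l)) + ∑ (λ j → ∑ (λ l → (y j * x (punchIn j l)) * H₂ vs j l))
      ≡⟨ sym (∑-+ (λ j → ∑ (λ l → (x j * y (punchIn j l)) * H₂ vs j l)) (λ j → ∑ (λ l → (y j * x (punchIn j l)) * H₂ vs j l))) ⟩
    ∑ (λ j → ∑ (λ l → (x j * y (punchIn j l)) * H₂ vs j l) + ∑ (λ l → (y j * x (punchIn j l)) * H₂ vs j l))
      ≡⟨ ∑-cong (λ j → sym (∑-+ (λ l → (x j * y (punchIn j l)) * H₂ vs j l) (λ l → (y j * x (punchIn j l)) * H₂ vs j l))) ⟩
    ∑ (λ j → ∑ (λ l → (x j * y (punchIn j l)) * H₂ vs j l + (y j * x (punchIn j l)) * H₂ vs j l))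
      ≡⟨ ∑-cong (λ j → ∑-cong (λ l → sym (distribʳ (H₂ vs j l) (x j * y (punchIn j l)) (y j * x (punchIn j l))))) ⟩
    ∑ (λ j → ∑ (λ l → g j (punchIn j l) * H₂ vs j l))
      ≡⟨ symmetric⊥antisymmetric g (H₂ vs) g-sym (H₂-antisymmetric vs) ⟩
    0# ∎)
    where
    g : Fin (suc (suc n)) → Fin (suc (suc n)) → Carrier
    g a b = x a * y b + y a * x b
    g-sym : ∀ a b → g a b ≡ g b a
    g-sym a b = solve 4 (λ p r s t → p :* r :+ s :* t := t :* s :+ r :* p) refl (x a) (y b) (y a) (x b)

  det-swap : ∀ {k} pre (x y : Vect k) suf → det (pre ++ x ∷ y ∷ suf) ≡ - det (pre ++ y ∷ x ∷ suf)
  det-swap []        x y suf = det-swap-top x y suf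
  det-swap {zero}  (r ∷ pre) x y suf = sym -0#≈0#
  det-swap {suc k} (r ∷ pre) x y suf = begin
    det (r ∷ pre ++ x ∷ y ∷ suf)                        ≡⟨ det-expand r (pre ++ x ∷ y ∷ suf) ⟩
    ∑ (λ j → cofactor (pre ++ x ∷ y ∷ suf) j * r j)     ≡⟨ ∑-cong (λ j → trans (cong (_* r j) (cof j))
                                                            (solve 2 (λ a b → (:- a) :* b := (:- :1) :* (a :* b)) refl (cofactor (pre ++ y ∷ x ∷ suf) j) (r j))) ⟩
    ∑ (λ j → - 1# * (cofactor (pre ++ y ∷ x ∷ suf) j * r j)) ≡⟨ sym (*-∑ (- 1#) (λ j → cofactor (pre ++ y ∷ x ∷ suf) j * r j)) ⟩
    - 1# * ∑ (λ j → cofactor (pre ++ y ∷ x ∷ suf) j * r j) ≡⟨ cong (- 1# *_) (sym (det-expand r (pre ++ y ∷ x ∷ suf))) ⟩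
    - 1# * det (r ∷ pre ++ y ∷ x ∷ suf)                 ≡⟨ solve 1 (λ a → (:- :1) :* a := :- a) refl _ ⟩
    - det (r ∷ pre ++ y ∷ x ∷ suf)                      ∎
    where
    cof : ∀ j → cofactor (pre ++ x ∷ y ∷ suf) j ≡ - cofactor (pre ++ y ∷ x ∷ suf) j
    cof j = begin
      sgn (toℕ j) * det (List.map (deleteColumn j) (pre ++ x ∷ y ∷ suf))
        ≡⟨ cong (λ w → sgn (toℕ j) * det w) (ListP.map-++ (deleteColumn j) pre (x ∷ y ∷ suf)) ⟩
      sgn (toℕ j) * det (List.map (deleteColumn j) pre ++ deleteColumn j x ∷ deleteColumn j y ∷ List.map (deleteColumn j) suf)
        ≡⟨ cong (sgn (toℕ j) *_) (det-swap (List.map (deleteColumn j) pre) (deleteColumn j x) (deleteColumn j y) (List.map (deleteColumn j) suf)) ⟩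
      sgn (toℕ j) * - det (List.map (deleteColumn j) pre ++ deleteColumn j y ∷ deleteColumn j x ∷ List.map (deleteColumn j) suf)
        ≡⟨ cong (λ w → sgn (toℕ j) * - det w) (sym (ListP.map-++ (deleteColumn j) pre (y ∷ x ∷ suf))) ⟩
      sgn (toℕ j) * - det (List.map (deleteColumn j) (pre ++ y ∷ x ∷ suf))
        ≡⟨ solve 2 (λ a b → a :* (:- b) := :- (a :* b)) refl (sgn (toℕ j)) _ ⟩
      - cofactor (pre ++ y ∷ x ∷ suf) j ∎

  -- The second row is brought to the top and expanded: all its minors again repeat their first row.
  det-repeated : ∀ {k} (x : Vect k) pre suf → det (x ∷ pre ++ x ∷ suf) ≡ 0#
  det-repeated x [] suf = det-equal-top x suf
  det-repeated {zero}  x (y ∷ pre) suf = refl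
  det-repeated {suc k} x (y ∷ pre) suf = begin
    det (x ∷ y ∷ pre ++ x ∷ suf)     ≡⟨ det-swap-top x y (pre ++ x ∷ suf) ⟩
    - det (y ∷ x ∷ pre ++ x ∷ suf)   ≡⟨ cong -_ (det-expand y (x ∷ pre ++ x ∷ suf)) ⟩
    - ∑ (λ j → cofactor (x ∷ pre ++ x ∷ suf) j * y j) ≡⟨ cong -_ (∑-zero (λ j → trans (cong (λ w → sgn (toℕ j) * w * y j) (minor j))
                                                          (solve 2 (λ a b → a :* :0 :* b := :0) refl (sgn (toℕ j)) (y j)))) ⟩
    - 0#                             ≡⟨ -0#≈0# ⟩
    0#                               ∎
    where
    minor : ∀ j → det (List.map (deleteColumn j) (x ∷ pre ++ x ∷ suf)) ≡ 0#
    minor j = trans (cong (λ w → det (deleteColumn j x ∷ w)) (ListP.map-++ (deleteColumn j) pre (x ∷ suf)))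
      (det-repeated (deleteColumn j x) (List.map (deleteColumn j) pre) (List.map (deleteColumn j) suf))

  det-∈ : ∀ {k} (x : Vect k) pre vs → x ∈ vs → det (x ∷ pre ++ vs) ≡ 0#
  det-∈ x pre (.x ∷ vs) (here refl) = det-repeated x pre vs
  det-∈ x pre (y ∷ vs) (there m) = subst (λ w → det (x ∷ w) ≡ 0#) (ListP.++-assoc pre (y ∷ []) vs) (det-∈ x (pre ++ y ∷ []) vs m)

  unit : ∀ {k} → Fin k → Vect k
  unit = δ

  det-unit : ∀ k → det (List.tabulate (unit {k})) ≡ 1#
  det-unit zero    = refl
  det-unit (suc k) = begin
    det (unit zero ∷ rest)                 ≡⟨ det-expand (unit zero) rest ⟩
    ∑ (λ j → cofactor rest j * unit zero j) ≡⟨ ∑-cong {suc k} (λ j → *-comm (cofactor rest j) (unit zero j)) ⟩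
    ∑ (λ j → unit zero j * cofactor rest j) ≡⟨ ∑-δˡ zero (cofactor rest) ⟩
    1# * det (List.map (deleteColumn zero) rest) ≡⟨ *-identityˡ _ ⟩
    det (List.map (deleteColumn zero) rest)      ≡⟨ cong (det {k}) (ListP.map-tabulate (unit ∘ suc) (deleteColumn zero)) ⟩
    det {k} (List.tabulate (deleteColumn zero ∘ unit ∘ suc)) ≡⟨ det-cong {k} (Pointwise.tabulate⁺ {f = deleteColumn zero ∘ unit ∘ suc} {g = unit} shift) ⟩
    det (List.tabulate (unit {k}))         ≡⟨ det-unit k ⟩
    1#                                     ∎
    where
    rest : List (Vect (suc k))
    rest = List.tabulate (unit ∘ suc)
    shift : ∀ i → deleteColumn zero (unit (suc i)) ≈ᵥ unit i
    shift i c = refl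

  Linear : ∀ {k} → (Vect k → Carrier) → Set
  Linear {k} Λ = ∃ λ (a : Vect k) → ∀ v → Λ v ≡ ∑ (λ j → a j * v j)

  det-linear : ∀ {k} (vs : List (Vect k)) → Linear (λ v → det (v ∷ vs))
  det-linear {zero}  vs = (λ ()) , λ v → refl
  det-linear {suc k} vs = cofactor vs , λ v → det-expand v vs

  Linear-* : ∀ {k} c {Λ : Vect k → Carrier} → Linear Λ → Linear (λ v → c * Λ v)
  Linear-* c (a , e) = (λ j → c * a j) , λ v → trans (cong (c *_) (e v)) (trans (*-∑ c (λ j → a j * v j)) (∑-cong (λ j → sym (*-assoc c (a j) (v j)))))

  Linear-+ : ∀ {k} {Λ M : Vect k → Carrier} → Linear Λ → Linear M → Linear (λ v → Λ v + M v)
  Linear-+ (a , e) (b , f) = (λ j → a j + b j) , λ v → trans (cong₂ _+_ (e v) (f v))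
    (trans (sym (∑-+ (λ j → a j * v j) (λ j → b j * v j))) (∑-cong (λ j → sym (distribʳ (v j) (a j) (b j)))))

  Linear-∑ : ∀ {k n} {Λ : Fin n → Vect k → Carrier} → (∀ i → Linear (Λ i)) → Linear (λ v → ∑ (λ i → Λ i v))
  Linear-∑ {n = zero}  lin = (λ _ → 0#) , λ v → sym (∑-zero (λ j → zeroˡ (v j)))
  Linear-∑ {n = suc n} lin = Linear-+ (lin zero) (Linear-∑ (lin ∘ suc))

  Linear-cong : ∀ {k} {Λ : Vect k → Carrier} → Linear Λ → ∀ {u v} → u ≈ᵥ v → Λ u ≡ Λ v
  Linear-cong (a , e) uv = trans (e _) (trans (∑-cong (λ j → cong (a j *_) (uv j))) (sym (e _)))

  Linear-comb : ∀ {k n} {Λ : Vect k → Carrier} → Linear Λ → ∀ (c : Fin n → Carrier) (f : Fin n → Vect k) →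
    Λ (λ j → ∑ (λ i → c i * f i j)) ≡ ∑ (λ i → c i * Λ (f i))
  Linear-comb {Λ = Λ} (a , e) c f = begin
    Λ (λ j → ∑ (λ i → c i * f i j))             ≡⟨ e _ ⟩
    ∑ (λ j → a j * ∑ (λ i → c i * f i j))       ≡⟨ ∑-cong (λ j → *-∑ (a j) (λ i → c i * f i j)) ⟩
    ∑ (λ j → ∑ (λ i → a j * (c i * f i j)))     ≡⟨ ∑-comm (λ j i → a j * (c i * f i j)) ⟩
    ∑ (λ i → ∑ (λ j → a j * (c i * f i j)))     ≡⟨ ∑-cong (λ i → trans (∑-cong (λ j → solve 3 (λ x y z → x :* (y :* z) := y :* (x :* z)) refl (a j) (c i) (f i j)))
                                                       (trans (sym (*-∑ (c i) (λ j → a j * f i j))) (cong (c i *_) (sym (e (f i)))))) ⟩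
    ∑ (λ i → c i * Λ (f i))                     ∎

-- Arcs, spanning families and nonvanishing determinants

module SpanningFamilies {q : ℕ} (F : FiniteField q) where

  open FieldArithmetic F
  open ProjectiveLine F
  open Determinants F

  length-members : ∀ {N} (S : Subset N) → length (members S) ≡ ∣ S ∣
  length-members []          = refl
  length-members (true ∷ S)  = cong suc (trans (ListP.length-map suc (members S)) (length-members S))
  length-members (false ∷ S) = trans (ListP.length-map suc (members S)) (length-members S)

  ∈-members⁺ : ∀ {N} (S : Subset N) i → lookup S i ≡ true → i ∈ members S
  ∈-members⁺ (true ∷ S)  zero    e = here refl
  ∈-members⁺ (true ∷ S)  (suc i) e = there (∈P.∈-map⁺ suc (∈-members⁺ S i e))
  ∈-members⁺ (false ∷ S) (suc i) e = ∈P.∈-map⁺ suc (∈-members⁺ S i e)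

  ∈-members⁻ : ∀ {N} (S : Subset N) i → i ∈ members S → lookup S i ≡ true
  ∈-members⁻ (true ∷ S) i (here refl) = refl
  ∈-members⁻ (true ∷ S) i (there m) with ∈P.∈-map⁻ suc m
  ... | j , m′ , refl = ∈-members⁻ S j m′
  ∈-members⁻ (false ∷ S) i m with ∈P.∈-map⁻ suc m
  ... | j , m′ , refl = ∈-members⁻ S j m′

  members-unique : ∀ {N} (S : Subset N) → Unique (members S)
  members-unique []          = []
  members-unique (true ∷ S)  = All.tabulate (λ { m refl → zero∉ S m }) ∷ UniqueP.map⁺ FinP.suc-injective (members-unique S)
    where
    zero∉ : ∀ {N} (S : Subset N) → Fin.zero {N} ∉ List.map suc (members S)
    zero∉ S m with ∈P.∈-map⁻ suc m
    ... | _ , _ , ()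
  members-unique (false ∷ S) = UniqueP.map⁺ FinP.suc-injective (members-unique S)

  members-∅ : ∀ N → members (replicate N false) ≡ []
  members-∅ zero    = refl
  members-∅ (suc N) = cong (List.map suc) (members-∅ N)

  ∣∅∣ : ∀ N → ∣ replicate N false ∣ ≡ 0
  ∣∅∣ zero    = refl
  ∣∅∣ (suc N) = ∣∅∣ N

  ∣full∣ : ∀ k → ∣ replicate k true ∣ ≡ k
  ∣full∣ zero    = refl
  ∣full∣ (suc k) = cong suc (∣full∣ k)

  insert : ∀ {N} → Subset N → Fin N → Subset N
  insert A e = A [ e ]≔ true

  ∣insert∣ : ∀ {N} (A : Subset N) e → lookup A e ≡ false → ∣ insert A e ∣ ≡ suc ∣ A ∣
  ∣insert∣ (false ∷ A) zero    _ = refl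
  ∣insert∣ (true  ∷ A) (suc e) h = cong suc (∣insert∣ A e h)
  ∣insert∣ (false ∷ A) (suc e) h = ∣insert∣ A e h

  lookup-insert : ∀ {N} (A : Subset N) e i → lookup A i ≡ true → lookup (insert A e) i ≡ true
  lookup-insert A e i h with i FinP.≟ e
  ... | yes refl = VecP.lookup∘update i A true
  ... | no ne    = trans (VecP.lookup∘update′ ne A true) h

  -- Moving e from its sorted place to the front takes adjacent transpositions. The sign s depends
  -- on A and e alone, not on f or on the rows in `pre`, because a single sign has to serve all
  -- factors of a product over points.
  insert-det : ∀ {N} (A : Subset N) e → lookup A e ≡ false → ∃ λ s → s * s ≡ 1# ×
    (∀ {k} (f : Fin N → Vect k) pre → det (pre ++ List.map f (members (insert A e))) ≡ s * det (pre ++ f e ∷ List.map f (members A)))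
  insert-det (false ∷ A) zero h = 1# , *-identityˡ 1# , λ f pre → sym (*-identityˡ _)
  insert-det (false ∷ A) (suc e) h with insert-det A e h
  ... | s , ss , IH = s , ss , λ f pre → begin
    det (pre ++ List.map f (List.map suc (members (insert A e))))      ≡⟨ cong (λ w → det (pre ++ w)) (sym (ListP.map-∘ (members (insert A e)))) ⟩
    det (pre ++ List.map (f ∘ suc) (members (insert A e)))             ≡⟨ IH (f ∘ suc) pre ⟩
    s * det (pre ++ f (suc e) ∷ List.map (f ∘ suc) (members A))        ≡⟨ cong (λ w → s * det (pre ++ f (suc e) ∷ w)) (ListP.map-∘ (members A)) ⟩
    s * det (pre ++ f (suc e) ∷ List.map f (List.map suc (members A))) ∎
  insert-det (true ∷ A) (suc e) h with insert-det A e h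
  ... | s , ss , IH = - s , trans (solve 1 (λ s → (:- s) :* (:- s) := s :* s) refl s) ss , λ f pre → begin
    det (pre ++ f zero ∷ List.map f (List.map suc (members (insert A e))))
      ≡⟨ cong (λ w → det (pre ++ f zero ∷ w)) (sym (ListP.map-∘ (members (insert A e)))) ⟩
    det (pre ++ f zero ∷ List.map (f ∘ suc) (members (insert A e)))
      ≡⟨ cong det (sym (ListP.++-assoc pre (f zero ∷ []) _)) ⟩
    det ((pre ++ f zero ∷ []) ++ List.map (f ∘ suc) (members (insert A e)))
      ≡⟨ IH (f ∘ suc) (pre ++ f zero ∷ []) ⟩
    s * det ((pre ++ f zero ∷ []) ++ f (suc e) ∷ List.map (f ∘ suc) (members A))
      ≡⟨ cong (λ w → s * det w) (ListP.++-assoc pre (f zero ∷ []) _) ⟩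
    s * det (pre ++ f zero ∷ f (suc e) ∷ List.map (f ∘ suc) (members A))
      ≡⟨ cong (s *_) (det-swap pre (f zero) (f (suc e)) _) ⟩
    s * - det (pre ++ f (suc e) ∷ f zero ∷ List.map (f ∘ suc) (members A))
      ≡⟨ solve 2 (λ a b → a :* (:- b) := (:- a) :* b) refl s _ ⟩
    - s * det (pre ++ f (suc e) ∷ f zero ∷ List.map (f ∘ suc) (members A))
      ≡⟨ cong (λ w → - s * det (pre ++ f (suc e) ∷ f zero ∷ w)) (ListP.map-∘ (members A)) ⟩
    - s * det (pre ++ f (suc e) ∷ f zero ∷ List.map f (List.map suc (members A))) ∎

  det-move : ∀ {k} (x : Vect k) pre suf → ∃ λ s → s * s ≡ 1# × det (x ∷ pre ++ suf) ≡ s * det (pre ++ x ∷ suf)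
  det-move x pre suf = go [] pre
    where
    go : ∀ P pre → ∃ λ s → s * s ≡ 1# × det (P ++ x ∷ pre ++ suf) ≡ s * det (P ++ pre ++ x ∷ suf)
    go P [] = 1# , *-identityˡ 1# , sym (*-identityˡ _)
    go P (y ∷ pre) with go (P ++ y ∷ []) pre
    ... | s , ss , e = - s , trans (solve 1 (λ s → (:- s) :* (:- s) := s :* s) refl s) ss , (begin
      det (P ++ x ∷ y ∷ pre ++ suf)                   ≡⟨ det-swap P x y (pre ++ suf) ⟩
      - det (P ++ y ∷ x ∷ pre ++ suf)                 ≡⟨ cong (λ w → - det w) (sym (ListP.++-assoc P (y ∷ []) _)) ⟩
      - det ((P ++ y ∷ []) ++ x ∷ pre ++ suf)         ≡⟨ cong -_ e ⟩
      - (s * det ((P ++ y ∷ []) ++ pre ++ x ∷ suf))   ≡⟨ cong (λ w → - (s * det w)) (ListP.++-assoc P (y ∷ []) _) ⟩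
      - (s * det (P ++ y ∷ pre ++ x ∷ suf))           ≡⟨ solve 2 (λ a b → :- (a :* b) := (:- a) :* b) refl s _ ⟩
      - s * det (P ++ y ∷ pre ++ x ∷ suf)             ∎)

  -- Every k members span, stated dually: this avoids choosing coefficients.
  Spanning : ∀ {k N} → Family k N → Set
  Spanning {k} G = ∀ xs → Unique xs → length xs ≡ k → ∀ {Λ : Vect k → Carrier} → Linear Λ →
    (∀ x → x ∈ xs → Λ (G x) ≡ 0#) → ∀ v → Λ v ≡ 0#

  lookup-insert⁻ : ∀ {N} (A : Subset N) e i → i ≢ e → lookup (insert A e) i ≡ true → lookup A i ≡ true
  lookup-insert⁻ A e i ne h = trans (sym (VecP.lookup∘update′ ne A true)) h

  fromList : ∀ {N} → List (Fin N) → Subset N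
  fromList []       = replicate _ false
  fromList (x ∷ xs) = insert (fromList xs) x

  ∈-fromList⁻ : ∀ {N} (xs : List (Fin N)) i → lookup (fromList xs) i ≡ true → i ∈ xs
  ∈-fromList⁻ [] i h with trans (sym h) (VecP.lookup-replicate i false)
  ... | ()
  ∈-fromList⁻ (x ∷ xs) i h with i FinP.≟ x
  ... | yes e = here e
  ... | no ne = there (∈-fromList⁻ xs i (lookup-insert⁻ (fromList xs) x i ne h))

  ∣fromList∣ : ∀ {N} (xs : List (Fin N)) → Unique xs → ∣ fromList xs ∣ ≡ length xs
  ∣fromList∣ {N} [] _ = ∣∅∣ N
  ∣fromList∣ (x ∷ xs) (x∉ ∷ u) = trans (∣insert∣ (fromList xs) x x-new) (cong suc (∣fromList∣ xs u))
    where
    x-new : lookup (fromList xs) x ≡ false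
    x-new with lookup (fromList xs) x in e
    ... | false = refl
    ... | true  = contradiction refl (All.lookup x∉ (∈-fromList⁻ xs x e))

  arc⇒spanning : ∀ {k N} (G : Family k N) → IsArc G → Spanning G
  arc⇒spanning {k} G (_ , basis) xs u len {Λ} lin zeros v with basis (fromList xs) (trans (∣fromList∣ xs u) len) v
  ... | c , c≈v , _ = begin
    Λ v                                         ≡⟨ Linear-cong lin (λ j → sym (c≈v j)) ⟩
    Λ (linComb vs c)                            ≡⟨ Linear-comb lin c (List.lookup vs) ⟩
    ∑ (λ i → c i * Λ (List.lookup vs i))        ≡⟨ ∑-zero (λ i → trans (cong (c i *_) (vanish (List.lookup vs i) (∈P.∈-lookup i))) (zeroʳ _)) ⟩
    0#                                          ∎
    where
    vs = sub G (fromList xs)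
    vanish : ∀ w → w ∈ vs → Λ w ≡ 0#
    vanish w m with ∈P.∈-map⁻ G m
    ... | x , x∈ , refl = zeros x (∈-fromList⁻ xs x (∈-members⁻ (fromList xs) x x∈))

  spanning-∘ : ∀ {k N M} (G : Family k N) (ι : Fin M → Fin N) → Inj ι → Spanning G → Spanning (G ∘ ι)
  spanning-∘ G ι inj sp xs u len lin zeros = sp (List.map ι xs) (UniqueP.map⁺ inj u) (trans (ListP.length-map ι xs) len) lin zeros′
    where
    zeros′ : ∀ y → y ∈ List.map ι xs → _
    zeros′ y m with ∈P.∈-map⁻ ι m
    ... | x , x∈ , refl = zeros x x∈

  ⊆∧∣∣≡⇒≡ : ∀ {N} (p r : Subset N) → (∀ i → lookup p i ≡ true → lookup r i ≡ true) → ∣ p ∣ ≡ ∣ r ∣ → p ≡ r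
  ⊆∧∣∣≡⇒≡ p r sub eq = go p r sub (ℕP.≤-reflexive (sym eq))
    where
    ∣∣-mono : ∀ {N} (p r : Subset N) → (∀ i → lookup p i ≡ true → lookup r i ≡ true) → ∣ p ∣ ℕ.≤ ∣ r ∣
    ∣∣-mono [] [] s = ℕ.z≤n
    ∣∣-mono (true ∷ p) (true ∷ r) s = ℕ.s≤s (∣∣-mono p r (λ i → s (suc i)))
    ∣∣-mono (true ∷ p) (false ∷ r) s with s zero refl
    ... | ()
    ∣∣-mono (false ∷ p) (true ∷ r) s = ℕP.m≤n⇒m≤1+n (∣∣-mono p r (λ i → s (suc i)))
    ∣∣-mono (false ∷ p) (false ∷ r) s = ∣∣-mono p r (λ i → s (suc i))
    go : ∀ {N} (p r : Subset N) → (∀ i → lookup p i ≡ true → lookup r i ≡ true) → ∣ r ∣ ℕ.≤ ∣ p ∣ → p ≡ r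
    go [] [] s le = refl
    go (true ∷ p) (true ∷ r) s le = cong (true ∷_) (go p r (λ i → s (suc i)) (ℕP.≤-pred le))
    go (true ∷ p) (false ∷ r) s le with s zero refl
    ... | ()
    go (false ∷ p) (true ∷ r) s le = contradiction (ℕP.≤-trans le (∣∣-mono p r (λ i → s (suc i)))) (ℕP.<-irrefl refl)
    go (false ∷ p) (false ∷ r) s le = cong (false ∷_) (go p r (λ i → s (suc i)) le)

  -- If the determinant vanished at one basis, exchanging the basis vectors one
  -- by one for arbitrary ones would show that it vanishes identically.
  det-sub≢0 : ∀ {k N} (G : Family k N) → Spanning G → ∀ S → ∣ S ∣ ≡ k → det (sub G S) ≢ 0#
  det-sub≢0 {k} {N} G sp S₀ len zero₀ = 0≢1 (trans (sym everywhere) (det-unit k))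
    where
    vanish : ∀ j (S : Subset N) → (∀ i → lookup S i ≡ true → lookup S₀ i ≡ true) → j ℕ.+ ∣ S ∣ ≡ k →
      ∀ ws → length ws ≡ j → det (ws ++ sub G S) ≡ 0#
    vanish zero S S⊆ size [] refl = subst (λ S → det (sub G S) ≡ 0#) (sym (⊆∧∣∣≡⇒≡ S S₀ S⊆ (trans size (sym len)))) zero₀
    -- The determinant is a linear form in w, so testing it on the basis S₀ suffices. A basis vector
    -- already in S repeats a row; any other one is moved into S and falls under the induction
    -- hypothesis.
    vanish (suc j) S S⊆ size (w ∷ ws) eq = sp (members S₀) (members-unique S₀) (trans (length-members S₀) len)
      (det-linear (ws ++ sub G S)) at-basis w
      where
      at-basis : ∀ x → x ∈ members S₀ → det (G x ∷ ws ++ sub G S) ≡ 0#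
      at-basis x m with lookup S x in e
      ... | true  = det-∈ (G x) ws (sub G S) (∈P.∈-map⁺ G (∈-members⁺ S x e))
      ... | false with det-move (G x) ws (sub G S) | insert-det S x e
      ...   | s , ss , e₁ | t , t² , e₂ = begin
        det (G x ∷ ws ++ sub G S)                  ≡⟨ e₁ ⟩
        s * det (ws ++ G x ∷ sub G S)              ≡⟨ cong (s *_) inner ⟩
        s * 0#                                     ≡⟨ zeroʳ s ⟩
        0#                                         ∎
        where
        inner : det (ws ++ G x ∷ sub G S) ≡ 0#
        inner = x*y≡0⇒y≡0 (x*y≡1⇒x≢0 t²) (trans (sym (e₂ G ws)) (vanish j (insert S x) ins⊆
          (trans (cong (j ℕ.+_) (∣insert∣ S x e)) (trans (ℕP.+-suc j ∣ S ∣) size)) ws (ℕP.suc-injective eq)))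
          where
          ins⊆ : ∀ i → lookup (insert S x) i ≡ true → lookup S₀ i ≡ true
          ins⊆ i h with i FinP.≟ x
          ... | yes refl = ∈-members⁻ S₀ x m
          ... | no ne    = S⊆ i (lookup-insert⁻ S x i ne h)
    ∅ : Subset N
    ∅ = fromList []
    everywhere : det (List.tabulate (unit {k})) ≡ 0#
    everywhere = trans (cong det (trans (sym (ListP.++-identityʳ _)) (cong (λ w → List.tabulate unit ++ List.map G w) (sym (members-∅ N)))))
      (vanish k ∅ (λ i h → contradiction (∈-fromList⁻ [] i h) λ ()) (trans (cong (k ℕ.+_) (∣fromList∣ {N} [] [])) (ℕP.+-identityʳ k)) (List.tabulate unit) (ListP.length-tabulate unit))

  LinearlyIndependent : ∀ {n k} → (Fin n → Vect k) → Set
  LinearlyIndependent {n} f = ∀ (c : Fin n → Carrier) → (∀ j → ∑ (λ i → c i * f i j) ≡ 0#) → ∀ i → c i ≡ 0#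

  dot-difference : ∀ {k} (u v w : Vect k) → ∑ (λ j → u j * w j) ≡ ∑ (λ j → v j * w j) → ∑ (λ j → (u j + - v j) * w j) ≡ 0#
  dot-difference u v w e = begin
    ∑ (λ j → (u j + - v j) * w j)                          ≡⟨ ∑-cong (λ j → solve 3 (λ a b c → (a :+ :- b) :* c := a :* c :+ (:- :1) :* (b :* c)) refl (u j) (v j) (w j)) ⟩
    ∑ (λ j → u j * w j + - 1# * (v j * w j))               ≡⟨ ∑-+ (λ j → u j * w j) (λ j → - 1# * (v j * w j)) ⟩
    ∑ (λ j → u j * w j) + ∑ (λ j → - 1# * (v j * w j))     ≡⟨ cong₂ _+_ e (sym (*-∑ (- 1#) (λ j → v j * w j))) ⟩
    ∑ (λ j → v j * w j) + - 1# * ∑ (λ j → v j * w j)       ≡⟨ solve 1 (λ a → a :+ (:- :1) :* a := :0) refl _ ⟩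
    0#                                                     ∎

  UniqueCoordinates : ∀ {n k} → (Fin n → Vect k) → Vect k → Set
  UniqueCoordinates {n} f v = Σ (Fin n → Carrier) λ c → (∀ j → ∑ (λ i → c i * f i j) ≡ v j) ×
    (∀ (c′ : Fin n → Carrier) → (∀ j → ∑ (λ i → c′ i * f i j) ≡ v j) → ∀ i → c′ i ≡ c i)

  abstract
    -- Independence says that the map from coefficients to vectors is injective; by finiteness it is
    -- onto.
    independent⇒basis : ∀ {k} (f : Fin k → Vect k) → LinearlyIndependent f → ∀ v → UniqueCoordinates f v
    independent⇒basis {k} f ind v = c , proj₂ onto , λ c′ e → inj (λ j → trans (e j) (sym (proj₂ onto j)))
      where
      T : Vect k → Vect k
      T c j = ∑ (λ i → c i * f i j)
      inj : ∀ {c c′} → T c ≈ᵥ T c′ → c ≈ᵥ c′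
      inj {c} {c′} e i = x-y≡0⇒x≡y (ind (λ i → c i + - c′ i) (λ j → dot-difference c c′ (λ i → f i j) (e j)) i)
      onto : ∃ λ c → T c ≈ᵥ v
      onto = Vect-injective⇒surjective T (λ e j → ∑-cong (λ i → cong (_* f i j) (e i))) inj v
      c : Vect k
      c = proj₁ onto

  abstract
    -- Dual spanning says that u ↦ (u · f i)_i is injective, hence onto by finiteness. Preimages of
    -- the unit vectors form a dual basis, which reads off the coefficients of any linear relation.
    spanning⇒independent : ∀ {k} (f : Fin k → Vect k) →
      (∀ {Λ} → Linear Λ → (∀ i → Λ (f i) ≡ 0#) → ∀ v → Λ v ≡ 0#) → LinearlyIndependent f
    spanning⇒independent {k} f sp c e i = begin
      c i                                         ≡⟨ sym (∑-δʳ i c) ⟩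
      ∑ (λ l → c l * δ l i)                       ≡⟨ ∑-cong (λ l → cong (c l *_) (sym (proj₂ (dual i) l))) ⟩
      ∑ (λ l → c l * ∑ (λ j → d j * f l j))       ≡⟨ sym (Linear-comb {Λ = λ v → ∑ (λ j → d j * v j)} (d , λ v → refl) c f) ⟩
      ∑ (λ j → d j * ∑ (λ l → c l * f l j))       ≡⟨ ∑-zero (λ j → trans (cong (d j *_) (e j)) (zeroʳ _)) ⟩
      0#                                          ∎
      where
      T : Vect k → Vect k
      T u i = ∑ (λ j → u j * f i j)
      inj : ∀ {u v} → T u ≈ᵥ T v → u ≈ᵥ v
      inj {u} {v} eq j = x-y≡0⇒x≡y (trans (sym (∑-δʳ j (λ j → u j + - v j)))
        (sp {λ w → ∑ (λ j → (u j + - v j) * w j)} ((λ j → u j + - v j) , λ w → refl) (λ i → dot-difference u v (f i) (eq i)) (λ l → δ l j)))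
      dual : ∀ i → ∃ λ d → T d ≈ᵥ (λ l → δ l i)
      dual i = Vect-injective⇒surjective T (λ e i → ∑-cong (λ j → cong (_* f i j) (e j))) inj (λ l → δ l i)
      d : Vect k
      d = proj₁ (dual i)

  independent⇒IsBasis : ∀ {k} (vs : List (Vect k)) → length vs ≡ k → LinearlyIndependent (List.lookup vs) → IsBasis vs
  independent⇒IsBasis vs len ind = go (List.lookup vs) len ind
    where
    go : ∀ {n k} (f : Fin n → Vect k) → n ≡ k → LinearlyIndependent f → ∀ v → UniqueCoordinates f v
    go f refl ind v = independent⇒basis f ind v

  spanning⇒arc : ∀ {k N} (G : Family k N) → k ℕ.≤ N → Spanning G → IsArc G
  spanning⇒arc {k} G k≤N sp = k≤N , λ S size → independent⇒IsBasis (sub G S) (len S size)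
    (go (List.lookup (sub G S)) (len S size) (λ {Λ} lin zeros → sp (members S) (members-unique S) (trans (length-members S) size) lin
      (λ x m → Linear-∈ Λ (sub G S) zeros (∈P.∈-map⁺ G m))))
    where
    len : ∀ S → ∣ S ∣ ≡ k → length (sub G S) ≡ k
    len S size = trans (ListP.length-map G (members S)) (trans (length-members S) size)
    go : ∀ {n k} (f : Fin n → Vect k) → n ≡ k →
      (∀ {Λ} → Linear Λ → (∀ i → Λ (f i) ≡ 0#) → ∀ v → Λ v ≡ 0#) → LinearlyIndependent f
    go f refl sp = spanning⇒independent f sp
    Linear-∈ : ∀ (Λ : Vect k → Carrier) vs → (∀ i → Λ (List.lookup vs i) ≡ 0#) → ∀ {w} → w ∈ vs → Λ w ≡ 0#
    Linear-∈ Λ (v ∷ vs) z (here refl) = z zero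
    Linear-∈ Λ (v ∷ vs) z (there m)   = Linear-∈ Λ vs (λ i → z (suc i)) m

-- Sums over subsets, and Fermat's little theorem

module SubsetSums {q : ℕ} (F : FiniteField q) where

  open FieldArithmetic F
  open ProjectiveLine F
  open Determinants F
  open SpanningFamilies F

  true≢false : true ≢ false
  true≢false ()

  prodL-members : ∀ {N} (f : Fin N → Carrier) (S : Subset N) → prodL (List.map f (members S)) ≡ ∏ (λ i → if lookup S i then f i else 1#)
  prodL-members f []          = refl
  prodL-members f (true ∷ S)  = cong (f zero *_) (trans (cong prodL (sym (ListP.map-∘ (members S)))) (prodL-members (f ∘ suc) S))
  prodL-members f (false ∷ S) = trans (trans (cong prodL (sym (ListP.map-∘ (members S)))) (prodL-members (f ∘ suc) S)) (sym (*-identityˡ _))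

  sumL-members : ∀ {N} (f : Fin N → Carrier) (S : Subset N) → sumL (List.map f (members S)) ≡ ∑ (λ i → if lookup S i then f i else 0#)
  sumL-members f []          = refl
  sumL-members f (true ∷ S)  = cong (f zero +_) (trans (cong sumL (sym (ListP.map-∘ (members S)))) (sumL-members (f ∘ suc) S))
  sumL-members f (false ∷ S) = trans (trans (cong sumL (sym (ListP.map-∘ (members S)))) (sumL-members (f ∘ suc) S)) (sym (+-identityˡ _))

  -- Recursion along the characteristic vector, instead of a sum over the list `allSubsets`, lets
  -- statements about the support be proved by induction on a single subset.
  ∑ₛ : ∀ {N} → (Subset N → Carrier) → Carrier
  ∑ₛ {zero}  f = f []
  ∑ₛ {suc N} f = ∑ₛ (f ∘ (true ∷_)) + ∑ₛ (f ∘ (false ∷_))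

  ∑ₛ-cong : ∀ {N} {f g : Subset N → Carrier} → (∀ C → f C ≡ g C) → ∑ₛ f ≡ ∑ₛ g
  ∑ₛ-cong {zero}  e = e []
  ∑ₛ-cong {suc N} e = cong₂ _+_ (∑ₛ-cong (λ C → e (true ∷ C))) (∑ₛ-cong (λ C → e (false ∷ C)))

  ∑ₛ-zero : ∀ {N} {f : Subset N → Carrier} → (∀ C → f C ≡ 0#) → ∑ₛ f ≡ 0#
  ∑ₛ-zero {zero}  z = z []
  ∑ₛ-zero {suc N} z = trans (cong₂ _+_ (∑ₛ-zero (λ C → z (true ∷ C))) (∑ₛ-zero (λ C → z (false ∷ C)))) (+-identityˡ 0#)

  ∑ₛ-+ : ∀ {N} (f g : Subset N → Carrier) → ∑ₛ (λ C → f C + g C) ≡ ∑ₛ f + ∑ₛ g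
  ∑ₛ-+ {zero}  f g = refl
  ∑ₛ-+ {suc N} f g = trans (cong₂ _+_ (∑ₛ-+ (f ∘ (true ∷_)) (g ∘ (true ∷_))) (∑ₛ-+ (f ∘ (false ∷_)) (g ∘ (false ∷_))))
    (solve 4 (λ a b c d → (a :+ b) :+ (c :+ d) := (a :+ c) :+ (b :+ d)) refl _ _ _ _)

  ∑ₛ-single : ∀ {N} (A : Subset N) {f : Subset N → Carrier} → (∀ C → f C ≡ 0# ⊎ C ≡ A) → ∑ₛ f ≡ f A
  ∑ₛ-single [] h = refl
  ∑ₛ-single (true ∷ A) {f} h = trans (cong₂ _+_ (∑ₛ-single A h₁) (∑ₛ-zero h₀)) (+-identityʳ _)
    where
    h₁ : ∀ C → f (true ∷ C) ≡ 0# ⊎ C ≡ A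
    h₁ C with h (true ∷ C)
    ... | inj₁ z    = inj₁ z
    ... | inj₂ refl = inj₂ refl
    h₀ : ∀ C → f (false ∷ C) ≡ 0#
    h₀ C with h (false ∷ C)
    ... | inj₁ z = z
  ∑ₛ-single (false ∷ A) {f} h = trans (cong₂ _+_ (∑ₛ-zero h₁) (∑ₛ-single A h₀)) (+-identityˡ _)
    where
    h₀ : ∀ C → f (false ∷ C) ≡ 0# ⊎ C ≡ A
    h₀ C with h (false ∷ C)
    ... | inj₁ z    = inj₁ z
    ... | inj₂ refl = inj₂ refl
    h₁ : ∀ C → f (true ∷ C) ≡ 0#
    h₁ C with h (true ∷ C)
    ... | inj₁ z = z

  Covers : ∀ {N} → Subset N → Subset N → Set
  Covers A C = ∃ λ e → lookup A e ≡ false × C ≡ insert A e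

  ∑ₛ-covers : ∀ {N} (A : Subset N) {f : Subset N → Carrier} → (∀ C → f C ≡ 0# ⊎ Covers A C) →
    ∑ₛ f ≡ ∑ (λ e → if lookup A e then 0# else f (insert A e))
  ∑ₛ-covers [] {f} h with h []
  ... | inj₁ z = z
  ∑ₛ-covers (true ∷ A) {f} h = trans (cong₂ _+_ (∑ₛ-covers A h₁) (∑ₛ-zero h₀)) (+-comm _ _)
    where
    h₁ : ∀ C → f (true ∷ C) ≡ 0# ⊎ Covers A C
    h₁ C with h (true ∷ C)
    ... | inj₁ z                   = inj₁ z
    ... | inj₂ (suc e , l , refl)  = inj₂ (e , l , refl)
    h₀ : ∀ C → f (false ∷ C) ≡ 0#
    h₀ C with h (false ∷ C)
    ... | inj₁ z                = z
    ... | inj₂ (suc e , l , ())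
  ∑ₛ-covers (false ∷ A) {f} h = cong₂ _+_ (∑ₛ-single A h₁) (∑ₛ-covers A h₀)
    where
    h₁ : ∀ C → f (true ∷ C) ≡ 0# ⊎ C ≡ A
    h₁ C with h (true ∷ C)
    ... | inj₁ z                = inj₁ z
    ... | inj₂ (zero , l , refl) = inj₂ refl
    ... | inj₂ (suc e , l , ())
    h₀ : ∀ C → f (false ∷ C) ≡ 0# ⊎ Covers A C
    h₀ C with h (false ∷ C)
    ... | inj₁ z                  = inj₁ z
    ... | inj₂ (zero , l , ())
    ... | inj₂ (suc e , l , refl) = inj₂ (e , l , refl)

  ⊆⇒covers : ∀ {N} (A C : Subset N) → (∀ i → lookup A i ≡ true → lookup C i ≡ true) → ∣ C ∣ ≡ suc ∣ A ∣ → Covers A C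
  ⊆⇒covers (true ∷ A) (true ∷ C) s e with ⊆⇒covers A C (λ i → s (suc i)) (ℕP.suc-injective e)
  ... | i , l , refl = suc i , l , refl
  ⊆⇒covers (true ∷ A) (false ∷ C) s e = contradiction (sym (s zero refl)) true≢false
  ⊆⇒covers (false ∷ A) (true ∷ C) s e = zero , refl , cong (true ∷_) (sym (⊆∧∣∣≡⇒≡ A C (λ i → s (suc i)) (sym (ℕP.suc-injective e))))
  ⊆⇒covers (false ∷ A) (false ∷ C) s e with ⊆⇒covers A C (λ i → s (suc i)) e
  ... | i , l , refl = suc i , l , refl

  infixl 6 _▹_
  _▹_ : ∀ {N} → Subset N → ∀ m → Subset (N ℕ.+ m)
  A ▹ m = A Vec.++ replicate m false

  lookup-▹ˡ : ∀ {N} (A : Subset N) m i → lookup (A ▹ m) (i ↑ˡ m) ≡ lookup A i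
  lookup-▹ˡ A m i = VecP.lookup-++ˡ A (replicate m false) i

  lookup-▹ʳ : ∀ {N} (A : Subset N) m j → lookup (A ▹ m) (N ↑ʳ j) ≡ false
  lookup-▹ʳ A m j = trans (VecP.lookup-++ʳ A (replicate m false) j) (VecP.lookup-replicate j false)

  members-▹ : ∀ {N} (A : Subset N) m → members (A ▹ m) ≡ List.map (_↑ˡ m) (members A)
  members-▹ [] m = members-∅ m
  members-▹ (true ∷ A) m = cong (zero ∷_) (trans (cong (List.map suc) (members-▹ A m)) (trans (sym (ListP.map-∘ (members A))) (ListP.map-∘ (members A))))
  members-▹ (false ∷ A) m = trans (cong (List.map suc) (members-▹ A m)) (trans (sym (ListP.map-∘ (members A))) (ListP.map-∘ (members A)))

  ∣▹∣ : ∀ {N} (A : Subset N) m → ∣ A ▹ m ∣ ≡ ∣ A ∣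
  ∣▹∣ []          m = ∣∅∣ m
  ∣▹∣ (true ∷ A)  m = cong suc (∣▹∣ A m)
  ∣▹∣ (false ∷ A) m = ∣▹∣ A m

  sub-▹ : ∀ {k N} m (G : Family k (N ℕ.+ m)) (A : Subset N) → sub G (A ▹ m) ≡ sub (G ∘ (_↑ˡ m)) A
  sub-▹ m G A = trans (cong (List.map G) (members-▹ A m)) (sym (ListP.map-∘ (members A)))

  det₁≢0 : ∀ {k N} (G : Family (suc k) N) → Spanning G → ∀ S → ∣ S ∣ ≡ k → ∀ g → lookup S g ≡ false → det (G g ∷ sub G S) ≢ 0#
  det₁≢0 G sp S size g g∉ z with insert-det S g g∉
  ... | s , ss , e = det-sub≢0 G sp (insert S g) (trans (∣insert∣ S g g∉) (cong suc size)) (trans (e G []) (trans (cong (s *_) z) (zeroʳ s)))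

  det₂≢0 : ∀ {k N} (G : Family (suc (suc k)) N) → Spanning G → ∀ S → ∣ S ∣ ≡ k → ∀ {g h} → g ≢ h → lookup S g ≡ false → lookup S h ≡ false →
    det (G g ∷ G h ∷ sub G S) ≢ 0#
  det₂≢0 G sp S size {g} {h} g≢h g∉ h∉ z with insert-det S h h∉
  ... | s , ss , e = det₁≢0 G sp (insert S h) (trans (∣insert∣ S h h∉) (cong suc size)) g (trans (VecP.lookup∘update′ g≢h S true) g∉)
    (trans (e G (G g ∷ [])) (trans (cong (s *_) z) (zeroʳ s)))

  pow-+ : ∀ x a b → pow x (a ℕ.+ b) ≡ pow x a * pow x b
  pow-+ x zero    b = sym (*-identityˡ _)
  pow-+ x (suc a) b = trans (cong (x *_) (pow-+ x a b)) (sym (*-assoc _ _ _))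

  ∏-const : ∀ n x → ∏ {n} (λ _ → x) ≡ pow x n
  ∏-const zero    x = refl
  ∏-const (suc n) x = cong (x *_) (∏-const n x)

  -- Rescaling by inv c permutes F and multiplies each inverse by c, except at 0, where `inv` stays
  -- `1#`; the product of `t` supplies the missing factor c. Applied to a sign s, this gives s^q = s
  -- without a case distinction on the parity of q.
  fermat : ∀ {c} → c ≢ 0# → pow c q ≡ c
  fermat {c} c≢0 = sym (*-cancelˡ (∏-≢0 (inv ∘ to) (λ i → inv≢0 (to i))) (begin
    ∏F inv * c                                        ≡⟨ cong₂ _*_ (sym (∏F-reindex inv (λ i → inv c * to i) scale-inj)) (sym ∏t) ⟩
    ∏ (λ i → inv (inv c * to i)) * ∏ t                ≡⟨ sym (∏-* (λ i → inv (inv c * to i)) t) ⟩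
    ∏ (λ i → inv (inv c * to i) * t i)                ≡⟨ ∏-cong pointwise ⟩
    ∏ (λ i → inv (to i) * c)                          ≡⟨ ∏-* (inv ∘ to) (λ _ → c) ⟩
    ∏F inv * ∏ {q} (λ _ → c)                          ≡⟨ cong (∏F inv *_) (∏-const q c) ⟩
    ∏F inv * pow c q                                  ∎))
    where
    open Inverse enum using (to; from; strictlyInverseˡ; strictlyInverseʳ)
    t : Fin q → Carrier
    t i = if does (to i ≟ 0#) then c else 1#
    scale-inj : Inj (λ i → inv c * to i)
    scale-inj e = to-injective (*-cancelˡ (inv≢0 c) e)
    ∏t : ∏ t ≡ c
    ∏t = trans (∏-single (from 0#) {t} off) on
      where
      on : t (from 0#) ≡ c
      on rewrite dec-true (to (from 0#) ≟ 0#) (strictlyInverseˡ 0#) = refl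
      off : ∀ j → j ≢ from 0# → t j ≡ 1#
      off j ne rewrite dec-false (to j ≟ 0#) (λ e → ne (trans (sym (strictlyInverseʳ j)) (cong from e))) = refl
    pointwise : ∀ i → inv (inv c * to i) * t i ≡ inv (to i) * c
    pointwise i with to i ≟ 0#
    ... | yes z = cong (_* c) (trans (inv-0 (trans (cong (inv c *_) z) (zeroʳ _))) (sym (inv-0 z)))
    ... | no nz = trans (*-identityʳ _) (trans (inv-distrib-* (inv≢0 c) nz) (trans (*-comm _ _) (cong (inv (to i) *_) (inv-involutive c≢0))))

  pow-square : ∀ {s} → s * s ≡ 1# → ∀ j → pow s (j ℕ.+ j) ≡ 1#
  pow-square {s} ss zero    = refl
  pow-square {s} ss (suc j) = begin
    s * pow s (j ℕ.+ suc j)       ≡⟨ cong (λ w → s * pow s w) (ℕP.+-suc j j) ⟩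
    s * (s * pow s (j ℕ.+ j))     ≡⟨ sym (*-assoc _ _ _) ⟩
    s * s * pow s (j ℕ.+ j)       ≡⟨ cong₂ _*_ ss (pow-square ss j) ⟩
    1# * 1#                       ≡⟨ *-identityˡ 1# ⟩
    1#                            ∎

-- The left kernel vector of M

module KernelVector {q : ℕ} (F : FiniteField q) where

  open FieldArithmetic F
  open ProjectiveLine F
  open Determinants F
  open SpanningFamilies F
  open SubsetSums F

  fill′ : ∀ {M} → M ≡ suc q → (xs : List (Fin M)) (p : Fin M → V2) →
    (∀ i → i ∉ xs → p i ≢ 0₂) → (∀ i j → i ≢ j → i ∉ xs → j ∉ xs → br (p i) (p j) ≢ 0#) →
    ∃ λ (p′ : Fin M → V2) → PairwiseIndependent p′ × (∀ i → i ∉ xs → p′ i ≡ p i)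
  fill′ refl = fill

  ∏-inv-br-const′ : ∀ {M} → M ≡ suc q → (p : Fin M → V2) → PairwiseIndependent p → ∀ e e′ →
    ∏ (λ g → inv (br (p g) (p e))) ≡ ∏ (λ g → inv (br (p g) (p e′)))
  ∏-inv-br-const′ refl = ∏-inv-br-const

  abstract
    two-members : ∀ {N d} (S : Subset N) → ∣ S ∣ ≡ 2 ℕ.+ d →
      ∃ λ a → ∃ λ b → a ≢ b × lookup S a ≡ true × lookup S b ≡ true
    two-members S size with members S in e | trans (length-members S) size | members-unique S
    ... | a ∷ b ∷ _ | _ | (a≢b ∷ _) ∷ _ = a , b , a≢b ,
      ∈-members⁻ S a (subst (a ∈_) (sym e) (here refl)) , ∈-members⁻ S b (subst (b ∈_) (sym e) (there (here refl)))

  prodL-const : ∀ {A : Set} (c : Carrier) (xs : List A) → prodL (List.map (λ _ → c) xs) ≡ pow c (length xs)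
  prodL-const c []       = refl
  prodL-const c (x ∷ xs) = cong (c *_) (prodL-const c xs)

  ∣complement∣ : ∀ {N} (A U : Subset N) → (∀ i → lookup A i ≡ true → lookup U i ≡ false) →
    ∣ A ∣ ℕ.+ ∣ U ∣ ℕ.+ ∣ zipWith (λ a u → not (a ∨ u)) A U ∣ ≡ N
  ∣complement∣ [] [] dis = refl
  ∣complement∣ (true  ∷ A) (true  ∷ U) dis = contradiction (dis zero refl) true≢false
  ∣complement∣ (true  ∷ A) (false ∷ U) dis = cong suc (∣complement∣ A U (λ i → dis (suc i)))
  ∣complement∣ (false ∷ A) (true  ∷ U) dis = trans (cong (ℕ._+ ∣ zipWith (λ a u → not (a ∨ u)) A U ∣) (ℕP.+-suc ∣ A ∣ ∣ U ∣)) (cong suc (∣complement∣ A U (λ i → dis (suc i))))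
  ∣complement∣ (false ∷ A) (false ∷ U) dis = trans (ℕP.+-suc (∣ A ∣ ℕ.+ ∣ U ∣) _) (cong suc (∣complement∣ A U (λ i → dis (suc i))))

  if-yes : ∀ {A P : Set} (p? : Dec P) {x y : A} → P → (if does p? then x else y) ≡ x
  if-yes p? p rewrite dec-true p? p = refl

  if-no : ∀ {A P : Set} (p? : Dec P) {x y : A} → ¬ P → (if does p? then x else y) ≡ y
  if-no p? ¬p rewrite dec-false p? ¬p = refl

  if-* : ∀ b {x y z : Carrier} → x ≡ y * z → (if b then x else 1#) ≡ (if b then y else 1#) * (if b then z else 1#)
  if-* true  e = e
  if-* false e = sym (*-identityˡ 1#)

  module _ {k N : ℕ} (G : Family k N) (n : ℕ) (C U A : Subset N) where

    Mentry-in : A ⊆ C → C ⊆ ∁ U → Mentry G n C U A ≡ prodL (List.map (λ u → det (G u ∷ sub G C)) (members U))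
    Mentry-in A⊆C C⊆∁U with A ⊆? C | C ⊆? ∁ U
    ... | yes _ | yes _ = refl
    ... | no ¬s | _     = contradiction (λ {x} → A⊆C {x}) ¬s
    ... | yes _ | no ¬s = contradiction (λ {x} → C⊆∁U {x}) ¬s

    Mentry-⊈ˡ : ¬ (A ⊆ C) → Mentry G n C U A ≡ 0#
    Mentry-⊈ˡ ¬s with A ⊆? C | C ⊆? ∁ U
    ... | yes s | _ = contradiction (λ {x} → s {x}) ¬s
    ... | no _  | _ = refl

    Mentry-⊈ʳ : ¬ (C ⊆ ∁ U) → Mentry G n C U A ≡ 0#
    Mentry-⊈ʳ ¬s with A ⊆? C | C ⊆? ∁ U
    ... | yes _ | yes s = contradiction (λ {x} → s {x}) ¬s
    ... | yes _ | no _  = refl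
    ... | no _  | _     = refl

  -- The weights w_C of a left kernel vector of M_G^{↑n}.  The first N members of
  -- the family of all N + m = q + 1 points play the role of the subarc.
  weight : ∀ {k N} m → Family k (N ℕ.+ m) → Subset N → Carrier
  weight m G C = ∏ (λ g → inv (det (G g ∷ sub (G ∘ (_↑ˡ m)) C))) * ∏ (λ u → inv (det (G (u ↑ˡ m) ∷ sub (G ∘ (_↑ˡ m)) C)))

  module Column {d n N m : ℕ} (G : Family (2 ℕ.+ d) (N ℕ.+ m)) (sp : Spanning G)
    (full : N ℕ.+ m ≡ suc q) (size : N ≡ (2 ℕ.+ d) ℕ.+ (d ℕ.+ n))
    (A U : Subset N) (∣A∣≡d : ∣ A ∣ ≡ d) (∣U∣≡n : ∣ U ∣ ≡ n) (disjoint : ∀ i → lookup A i ≡ true → lookup U i ≡ false) where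

    G′ : Family (2 ℕ.+ d) N
    G′ = G ∘ (_↑ˡ m)

    Â : Subset (N ℕ.+ m)
    Â = A ▹ m

    -- The elements e for which row A ∪ e has a nonzero entry in column (U , A). The size of the
    -- subarc is such that there are exactly k of them.
    E : Subset N
    E = zipWith (λ a u → not (a ∨ u)) A U

    lookup-E : ∀ i → lookup E i ≡ not (lookup A i ∨ lookup U i)
    lookup-E i = VecP.lookup-zipWith (λ a u → not (a ∨ u)) i A U

    E⇒∉A : ∀ {i} → lookup E i ≡ true → lookup A i ≡ false
    E⇒∉A {i} h with lookup A i | trans (sym (lookup-E i)) h
    ... | false | _ = refl
    ... | true  | ()

    E⇒∉Â : ∀ {i} → lookup E i ≡ true → lookup Â (i ↑ˡ m) ≡ false
    E⇒∉Â {i} h = trans (lookup-▹ˡ A m i) (E⇒∉A h)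

    ∣E∣ : ∣ E ∣ ≡ 2 ℕ.+ d
    ∣E∣ = ℕP.+-cancelˡ-≡ (d ℕ.+ n) _ _ (begin
      d ℕ.+ n ℕ.+ ∣ E ∣              ≡⟨ cong₂ (λ x y → x ℕ.+ y ℕ.+ ∣ E ∣) (sym ∣A∣≡d) (sym ∣U∣≡n) ⟩
      ∣ A ∣ ℕ.+ ∣ U ∣ ℕ.+ ∣ E ∣      ≡⟨ ∣complement∣ A U disjoint ⟩
      N                              ≡⟨ size ⟩
      (2 ℕ.+ d) ℕ.+ (d ℕ.+ n)        ≡⟨ ℕP.+-comm (2 ℕ.+ d) (d ℕ.+ n) ⟩
      (d ℕ.+ n) ℕ.+ (2 ℕ.+ d)        ∎)

    ∉Â : ∀ {g} → g ∉ members Â → lookup Â g ≡ false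
    ∉Â {g} nin with lookup Â g in e
    ... | false = refl
    ... | true  = contradiction (∈-members⁺ Â g e) nin

    abstract
      -- An area form on the two-dimensional quotient by the span of A.
      B : Vect (2 ℕ.+ d) → Vect (2 ℕ.+ d) → Carrier
      B x y = det (x ∷ y ∷ sub G′ A)

      B≡det : ∀ x y → B x y ≡ det (x ∷ y ∷ sub G′ A)
      B≡det x y = refl

      B-linear : ∀ y → Linear (λ x → B x y)
      B-linear y = det-linear (y ∷ sub G′ A)

      B-self : ∀ x → B x x ≡ 0#
      B-self x = det-equal-top x (sub G′ A)

      B-anti : ∀ x y → B x y ≡ - B y x
      B-anti x y = det-swap-top x y (sub G′ A)

      B-A : ∀ {g} y → lookup Â g ≡ true → B (G g) y ≡ 0#
      B-A {g} y h = det-∈ (G g) (y ∷ []) (sub G′ A) (subst (G g ∈_) (sub-▹ m G A) (∈P.∈-map⁺ G (∈-members⁺ Â g h)))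

      B≢0 : ∀ {g h} → g ≢ h → lookup Â g ≡ false → lookup Â h ≡ false → B (G g) (G h) ≢ 0#
      B≢0 {g} {h} ne g∉ h∉ = subst (λ w → det (G g ∷ G h ∷ w) ≢ 0#) (sub-▹ m G A)
        (det₂≢0 G sp Â (trans (∣▹∣ A m) ∣A∣≡d) ne g∉ h∉)

    β : Fin (N ℕ.+ m) → Fin (N ℕ.+ m) → Carrier
    β g h = B (G g) (G h)

    β-self : ∀ g → β g g ≡ 0#
    β-self g = B-self (G g)

    β-anti : ∀ g h → β g h ≡ - β h g
    β-anti g h = B-anti (G g) (G h)

    pair : ∃ λ a → ∃ λ b → a ≢ b × lookup E a ≡ true × lookup E b ≡ true
    pair = two-members E ∣E∣

    a b : Fin (N ℕ.+ m)
    a = proj₁ pair ↑ˡ m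
    b = proj₁ (proj₂ pair) ↑ˡ m

    a≢b : a ≢ b
    a≢b e = proj₁ (proj₂ (proj₂ pair)) (FinP.↑ˡ-injective m _ _ e)

    a∉ : lookup Â a ≡ false
    a∉ = E⇒∉Â (proj₁ (proj₂ (proj₂ (proj₂ pair))))

    b∉ : lookup Â b ≡ false
    b∉ = E⇒∉Â (proj₂ (proj₂ (proj₂ (proj₂ pair))))

    βab≢0 : β a b ≢ 0#
    βab≢0 = B≢0 a≢b a∉ b∉

    -- The difference of the two sides is a linear form in G g. It vanishes at a, at b and on A, and
    -- these k points span.
    plücker : ∀ g h → β a b * β g h ≡ β g b * β a h + - (β g a * β b h)
    plücker g h = x-y≡0⇒x≡y (trans
      (solve 6 (λ ab gh gb ah ga bh → ab :* gh :+ :- (gb :* ah :+ :- (ga :* bh)) := (ab :* gh :+ (:- ah) :* gb) :+ bh :* ga) refl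
        (β a b) (β g h) (β g b) (β a h) (β g a) (β b h))
      (sp (a ∷ b ∷ members Â) unique length≡ {Λ} linear vanish (G g)))
      where
      Λ : Vect (2 ℕ.+ d) → Carrier
      Λ x = (β a b * B x (G h) + (- β a h) * B x (G b)) + β b h * B x (G a)
      linear : Linear Λ
      linear = Linear-+ (Linear-+ (Linear-* (β a b) (B-linear (G h))) (Linear-* (- β a h) (B-linear (G b))))
        (Linear-* (β b h) (B-linear (G a)))
      new : ∀ {c} → lookup Â c ≡ false → ∀ {x} → x ∈ members Â → c ≢ x
      new {c} c∉ {x} m refl = true≢false (trans (sym (∈-members⁻ Â x m)) c∉)
      unique : Unique (a ∷ b ∷ members Â)
      unique = (a≢b ∷ All.tabulate (new a∉)) ∷ (All.tabulate (new b∉) ∷ members-unique Â)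
      length≡ : length (a ∷ b ∷ members Â) ≡ 2 ℕ.+ d
      length≡ = cong (2 ℕ.+_) (trans (length-members Â) (trans (∣▹∣ A m) ∣A∣≡d))
      vanish : ∀ x → x ∈ a ∷ b ∷ members Â → Λ (G x) ≡ 0#
      vanish x (here refl) = trans (cong (λ w → (β a b * β a h + (- β a h) * β a b) + β b h * w) (β-self a))
        (solve 3 (λ u v w → (u :* v :+ (:- v) :* u) :+ w :* :0 := :0) refl (β a b) (β a h) (β b h))
      vanish x (there (here refl)) = trans (cong₂ (λ v w → (β a b * β b h + (- β a h) * v) + β b h * w) (β-self b) (β-anti b a))
        (solve 3 (λ u v w → (u :* w :+ (:- v) :* :0) :+ w :* (:- u) := :0) refl (β a b) (β a h) (β b h))
      vanish x (there (there m)) = trans (cong₂ _+_ (cong₂ (λ v w → β a b * v + (- β a h) * w) (B-A (G h) x∈) (B-A (G b) x∈)) (cong (β b h *_) (B-A (G a) x∈)))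
        (solve 3 (λ u v w → (u :* :0 :+ (:- v) :* :0) :+ w :* :0 := :0) refl (β a b) (β a h) (β b h))
        where x∈ = ∈-members⁻ Â x m

    -- Coordinates on the quotient of F^k by the span of A.
    p : Fin (N ℕ.+ m) → V2
    p g = β g b * inv (β a b) , β a g

    br-p : ∀ g h → br (p g) (p h) ≡ β g h
    br-p g h = begin
      β g b * inv (β a b) * β a h + - (β a g * (β h b * inv (β a b)))
        ≡⟨ cong₂ (λ x y → β g b * inv (β a b) * β a h + - (x * (y * inv (β a b)))) (β-anti a g) (β-anti h b) ⟩
      β g b * inv (β a b) * β a h + - ((- β g a) * ((- β b h) * inv (β a b)))
        ≡⟨ solve 5 (λ gb i ah ga bh → gb :* i :* ah :+ :- ((:- ga) :* ((:- bh) :* i)) := i :* (gb :* ah :+ :- (ga :* bh))) refl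
             (β g b) (inv (β a b)) (β a h) (β g a) (β b h) ⟩
      inv (β a b) * (β g b * β a h + - (β g a * β b h))
        ≡⟨ cong (inv (β a b) *_) (sym (plücker g h)) ⟩
      inv (β a b) * (β a b * β g h)
        ≡⟨ sym (*-assoc _ _ _) ⟩
      inv (β a b) * β a b * β g h
        ≡⟨ cong (_* β g h) (inv-* βab≢0) ⟩
      1# * β g h
        ≡⟨ *-identityˡ _ ⟩
      β g h ∎

    p≢0₂ : ∀ i → i ∉ members Â → p i ≢ 0₂
    p≢0₂ i nin z with i FinP.≟ a
    ... | no ne    = B≢0 ne (∉Â nin) a∉ (trans (sym (br-p i a)) (trans (cong (λ w → br w (p a)) z) (br-0₂ (p a))))
    ... | yes refl = βab≢0 (trans (sym (br-p a b)) (trans (cong (λ w → br w (p b)) z) (br-0₂ (p b))))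

    abstract
      filled : ∃ λ (p′ : Fin (N ℕ.+ m) → V2) → PairwiseIndependent p′ × (∀ i → i ∉ members Â → p′ i ≡ p i)
      -- Members of A project to `0₂`. Filling assigns to them the d points of the line that the
      -- other points of G leave uncovered.
      filled = fill′ full (members Â) p p≢0₂ (λ i j ne i∉ j∉ e → B≢0 ne (∉Â i∉) (∉Â j∉) (trans (sym (br-p i j)) e))

    p′ : Fin (N ℕ.+ m) → V2
    p′ = proj₁ filled

    p′-independent : PairwiseIndependent p′
    p′-independent = proj₁ (proj₂ filled)

    br-p′ : ∀ g h → lookup Â g ≡ false → lookup Â h ≡ false → br (p′ g) (p′ h) ≡ β g h
    br-p′ g h g∉ h∉ = trans (cong₂ br (agree g g∉) (agree h h∉)) (br-p g h)
      where
      agree : ∀ i → lookup Â i ≡ false → p′ i ≡ p i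
      agree i i∉ = proj₂ (proj₂ filled) i (λ m → true≢false (trans (sym (∈-members⁻ Â i m)) i∉))

    -- In the quotient, `tangents` represent the hyperplanes through A that contain no further point
    -- of G, as in Segre's lemma. Their number is d = k - 2.
    tangents points : List V2
    tangents = List.map p′ (members Â)
    points   = List.map (λ u → p′ (u ↑ˡ m)) (members E)

    κ : Carrier
    κ = ∏ (λ g → inv (br (p′ g) (p′ a)))

    value : Fin N → Carrier
    value e = weight m G (insert A e) * prodL (List.map (λ u → det (G′ u ∷ sub G′ (insert A e))) (members U))

    -- The sign s of moving e into its place in A ∪ e enters with exponent
    -- ≡ m + n ≡ q + 1 (mod 2), and s^(q+1) = s² = 1.
    module AtPoint (e : Fin N) (e∈E : lookup E e ≡ true) where

      ê : Fin (N ℕ.+ m)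
      ê = e ↑ˡ m

      ê∉ : lookup Â ê ≡ false
      ê∉ = E⇒∉Â e∈E

      abstract
        sign-data : ∃ λ s → s * s ≡ 1# × (∀ x → det (x ∷ sub G′ (insert A e)) ≡ s * B x (G ê))
        sign-data with insert-det A e (E⇒∉A e∈E)
        ... | s , ss , eq = s , ss , λ x → trans (eq G′ (x ∷ [])) (cong (s *_) (sym (B≡det x (G ê))))

      s : Carrier
      s = proj₁ sign-data

      ss : s * s ≡ 1#
      ss = proj₁ (proj₂ sign-data)

      s≢0 : s ≢ 0#
      s≢0 = x*y≡1⇒x≢0 ss

      det≡ : ∀ x → det (x ∷ sub G′ (insert A e)) ≡ s * B x (G ê)
      det≡ = proj₂ (proj₂ sign-data)

      c χ : Fin (N ℕ.+ m) → Carrier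
      c g = β g ê
      -- Where c g vanishes both inverses are `1#`, so no sign appears. Over the subarc the signs
      -- multiply to X, once in each product of `weight`, and X * X = 1. What remains is one s for
      -- each of the m points outside the subarc and one for each member of U.
      χ g = if does (c g ≟ 0#) then 1# else s

      inv-sc : ∀ g → inv (s * c g) ≡ χ g * inv (c g)
      inv-sc g with c g ≟ 0#
      ... | yes z = trans (inv-0 (trans (cong (s *_) z) (zeroʳ s))) (sym (trans (*-identityˡ _) (inv-0 z)))
      ... | no nz = trans (inv-distrib-* s≢0 nz) (cong (_* inv (c g)) (inv-unique ss))

      P Q R X : Carrier
      P = ∏ (λ g → inv (c g))
      Q = ∏ (λ u → inv (c (u ↑ˡ m)))
      R = ∏ (λ u → if lookup U u then c (u ↑ˡ m) else 1#)
      X = ∏ (λ u → χ (u ↑ˡ m))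

      XX : X * X ≡ 1#
      XX = trans (sym (∏-* (λ u → χ (u ↑ˡ m)) (λ u → χ (u ↑ˡ m)))) (∏-one (λ u → χχ (u ↑ˡ m)))
        where
        χχ : ∀ g → χ g * χ g ≡ 1#
        χχ g with c g ≟ 0#
        ... | yes _ = *-identityˡ 1#
        ... | no _  = ss

      ↑ʳ≢↑ˡ : ∀ j → N ↑ʳ j ≢ ê
      ↑ʳ≢↑ˡ j eq with trans (sym (FinP.splitAt-↑ʳ N m j)) (trans (cong (Fin.splitAt N) eq) (FinP.splitAt-↑ˡ N e m))
      ... | ()

      ∏χ : ∏ χ ≡ X * pow s m
      ∏χ = trans (∏-++ N χ) (cong (X *_) (trans (∏-cong tail) (∏-const m s)))
        where
        tail : ∀ j → χ (N ↑ʳ j) ≡ s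
        tail j rewrite dec-false (c (N ↑ʳ j) ≟ 0#) (B≢0 (↑ʳ≢↑ˡ j) (lookup-▹ʳ A m j) ê∉) = refl

      first : ∏ (λ g → inv (det (G g ∷ sub G′ (insert A e)))) ≡ (X * pow s m) * P
      first = trans (∏-cong (λ g → trans (cong inv (det≡ (G g))) (inv-sc g))) (trans (∏-* χ (λ g → inv (c g))) (cong (_* P) ∏χ))

      second : ∏ (λ u → inv (det (G′ u ∷ sub G′ (insert A e)))) ≡ X * Q
      second = trans (∏-cong (λ u → trans (cong inv (det≡ (G′ u))) (inv-sc (u ↑ˡ m)))) (∏-* (λ u → χ (u ↑ˡ m)) (λ u → inv (c (u ↑ˡ m))))

      third : prodL (List.map (λ u → det (G′ u ∷ sub G′ (insert A e))) (members U)) ≡ pow s n * R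
      third = begin
        prodL (List.map (λ u → det (G′ u ∷ sub G′ (insert A e))) (members U))
          ≡⟨ prodL-members (λ u → det (G′ u ∷ sub G′ (insert A e))) U ⟩
        ∏ (λ u → if lookup U u then det (G′ u ∷ sub G′ (insert A e)) else 1#)
          ≡⟨ ∏-cong (λ u → if-* (lookup U u) (det≡ (G′ u))) ⟩
        ∏ (λ u → (if lookup U u then s else 1#) * (if lookup U u then c (u ↑ˡ m) else 1#))
          ≡⟨ ∏-* (λ u → if lookup U u then s else 1#) (λ u → if lookup U u then c (u ↑ˡ m) else 1#) ⟩
        ∏ (λ u → if lookup U u then s else 1#) * R
          ≡⟨ cong (_* R) (trans (sym (prodL-members (λ _ → s) U)) (trans (prodL-const s (members U)) (cong (pow s) (trans (length-members U) ∣U∣≡n)))) ⟩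
        pow s n * R ∎

      sign : pow s m * pow s n ≡ 1#
      sign = begin
        pow s m * pow s n                                       ≡⟨ sym (pow-+ s m n) ⟩
        pow s (m ℕ.+ n)                                         ≡⟨ sym (*-identityʳ _) ⟩
        pow s (m ℕ.+ n) * 1#                                    ≡⟨ cong (pow s (m ℕ.+ n) *_) (sym (pow-square ss (suc d))) ⟩
        pow s (m ℕ.+ n) * pow s (suc d ℕ.+ suc d)               ≡⟨ sym (pow-+ s (m ℕ.+ n) (suc d ℕ.+ suc d)) ⟩
        pow s (m ℕ.+ n ℕ.+ (suc d ℕ.+ suc d))                   ≡⟨ cong (pow s) (trans exponent full) ⟩
        s * pow s q                                             ≡⟨ cong (s *_) (fermat s≢0) ⟩
        s * s                                                   ≡⟨ ss ⟩
        1#                                                      ∎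
        where
        exponent : m ℕ.+ n ℕ.+ (suc d ℕ.+ suc d) ≡ N ℕ.+ m
        exponent = trans (ℕS.solve 3 (λ m n d → m ℕS.:+ n ℕS.:+ ((ℕS.con 1 ℕS.:+ d) ℕS.:+ (ℕS.con 1 ℕS.:+ d)) ℕS.:= ((ℕS.con 2 ℕS.:+ d) ℕS.:+ (d ℕS.:+ n)) ℕS.:+ m) refl m n d)
          (cong (ℕ._+ m) (sym size))
          where module ℕS = +-*-Solver

      -- Among the inverses over the subarc, those at A are `inv 0#`, and those at U are cancelled
      -- by the entry of M. The inverses at E survive.
      QR : Q * R ≡ invbrs points (p′ ê)
      QR = begin
        Q * R
          ≡⟨ sym (∏-* (λ u → inv (c (u ↑ˡ m))) (λ u → if lookup U u then c (u ↑ˡ m) else 1#)) ⟩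
        ∏ (λ u → inv (c (u ↑ˡ m)) * (if lookup U u then c (u ↑ˡ m) else 1#))
          ≡⟨ ∏-cong pointwise ⟩
        ∏ (λ u → if lookup E u then inv (br (p′ (u ↑ˡ m)) (p′ ê)) else 1#)
          ≡⟨ sym (prodL-members (λ u → inv (br (p′ (u ↑ˡ m)) (p′ ê))) E) ⟩
        prodL (List.map (λ u → inv (br (p′ (u ↑ˡ m)) (p′ ê))) (members E))
          ≡⟨ cong prodL (ListP.map-∘ (members E)) ⟩
        invbrs points (p′ ê) ∎
        where
        pointwise : ∀ u → inv (c (u ↑ˡ m)) * (if lookup U u then c (u ↑ˡ m) else 1#) ≡ (if lookup E u then inv (br (p′ (u ↑ˡ m)) (p′ ê)) else 1#)
        pointwise u with lookup A u in eA | lookup U u in eU | lookup E u in eE | lookup-E u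
        ... | true  | true  | _    | _    = contradiction (trans (sym eU) (disjoint u eA)) true≢false
        ... | true  | false | false | _    = trans (*-identityʳ _) (inv-0 (B-A (G ê) (trans (lookup-▹ˡ A m u) eA)))
        ... | false | true  | false | _    = inv-* (B≢0 u≢e (trans (lookup-▹ˡ A m u) eA) ê∉)
          where
          u≢e : u ↑ˡ m ≢ ê
          u≢e eq with FinP.↑ˡ-injective m u e eq
          ... | refl = true≢false (trans (sym e∈E) eE)
        ... | false | false | true  | _    = trans (*-identityʳ _) (cong inv (sym (br-p′ (u ↑ˡ m) ê (trans (lookup-▹ˡ A m u) eA) ê∉)))

      -- Over the filled line the product of inverses is the constant κ by Segre's lemma. The points
      -- of G differ from the filled ones only at A, where their factor is `inv 0#`; there the
      -- tangent forms undo the inverses contained in κ.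
      P≡ : P ≡ κ * brs tangents (p′ ê)
      P≡ = begin
        P
          ≡⟨ ∏-cong pointwise ⟩
        ∏ (λ g → inv (br (p′ g) (p′ ê)) * (if lookup Â g then br (p′ g) (p′ ê) else 1#))
          ≡⟨ ∏-* (λ g → inv (br (p′ g) (p′ ê))) (λ g → if lookup Â g then br (p′ g) (p′ ê) else 1#) ⟩
        ∏ (λ g → inv (br (p′ g) (p′ ê))) * ∏ (λ g → if lookup Â g then br (p′ g) (p′ ê) else 1#)
          ≡⟨ cong₂ _*_ (∏-inv-br-const′ full p′ p′-independent ê a) (sym (prodL-members (λ g → br (p′ g) (p′ ê)) Â)) ⟩
        κ * prodL (List.map (λ g → br (p′ g) (p′ ê)) (members Â))
          ≡⟨ cong (λ w → κ * prodL w) (ListP.map-∘ (members Â)) ⟩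
        κ * brs tangents (p′ ê) ∎
        where
        pointwise : ∀ g → inv (c g) ≡ inv (br (p′ g) (p′ ê)) * (if lookup Â g then br (p′ g) (p′ ê) else 1#)
        pointwise g with lookup Â g in eÂ
        ... | false = trans (cong inv (sym (br-p′ g ê eÂ ê∉))) (sym (*-identityʳ _))
        ... | true  = trans (inv-0 (B-A (G ê) eÂ)) (sym (inv-* (p′-independent g≢ê)))
          where
          g≢ê : g ≢ ê
          g≢ê refl = true≢false (trans (sym eÂ) ê∉)

      value≡ : value e ≡ κ * (brs tangents (p′ ê) * invbrs points (p′ ê))
      value≡ = begin
        value e
          ≡⟨ cong₂ _*_ (cong₂ _*_ first second) third ⟩
        ((X * pow s m) * P) * (X * Q) * (pow s n * R)
          ≡⟨ solve 6 (λ X sm P Q sn R → ((X :* sm) :* P) :* (X :* Q) :* (sn :* R) := (X :* X) :* (sm :* sn) :* (P :* (Q :* R))) refl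
               X (pow s m) P Q (pow s n) R ⟩
        (X * X) * (pow s m * pow s n) * (P * (Q * R))
          ≡⟨ cong₂ (λ u v → u * v * (P * (Q * R))) XX sign ⟩
        1# * 1# * (P * (Q * R))
          ≡⟨ solve 1 (λ w → :1 :* :1 :* w := w) refl _ ⟩
        P * (Q * R)
          ≡⟨ cong₂ _*_ P≡ QR ⟩
        κ * brs tangents (p′ ê) * invbrs points (p′ ê)
          ≡⟨ *-assoc _ _ _ ⟩
        κ * (brs tangents (p′ ê) * invbrs points (p′ ê)) ∎

    -- With k points in E and k - 2 tangents, the degree condition of the interpolation identity is
    -- met exactly.
    ∑-value : sumL (List.map value (members E)) ≡ 0#
    ∑-value = begin
      sumL (List.map value (members E))
        ≡⟨ sumL-cong (All.tabulate (λ {e} m → AtPoint.value≡ e (∈-members⁻ E e m))) ⟩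
      sumL (List.map (λ e → κ * (brs tangents (p′ (e ↑ˡ m)) * invbrs points (p′ (e ↑ˡ m)))) (members E))
        ≡⟨ sym (*-sumL κ (λ e → brs tangents (p′ (e ↑ˡ m)) * invbrs points (p′ (e ↑ˡ m))) (members E)) ⟩
      κ * sumL (List.map (λ e → brs tangents (p′ (e ↑ˡ m)) * invbrs points (p′ (e ↑ˡ m))) (members E))
        ≡⟨ cong (λ w → κ * sumL w) (ListP.map-∘ (members E)) ⟩
      κ * sumL (List.map (λ v → brs tangents v * invbrs points v) points)
        ≡⟨ cong (κ *_) (interpolation points tangents independent lengths) ⟩
      κ * 0#
        ≡⟨ zeroʳ κ ⟩
      0# ∎
      where
      independent : Independent points
      independent = AllPairsP.map⁺ (AllPairs.map (λ ne → p′-independent (λ eq → ne (FinP.↑ˡ-injective m _ _ eq))) (members-unique E))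
      lengths : length points ≡ 2 ℕ.+ length tangents
      lengths = trans (ListP.length-map _ (members E)) (trans (length-members E) (trans ∣E∣
        (cong (2 ℕ.+_) (sym (trans (ListP.length-map p′ (members Â)) (trans (length-members Â) (trans (∣▹∣ A m) ∣A∣≡d)))))))

    entry : Subset N → Carrier
    entry C = if does (∣ C ∣ ℕ.≟ suc d) then weight m G C * Mentry G′ n C U A else 0#

    column-vanishes : ∑ₛ entry ≡ 0#
    column-vanishes = begin
      ∑ₛ entry                                                    ≡⟨ ∑ₛ-covers A support ⟩
      ∑ (λ e → if lookup A e then 0# else entry (insert A e))     ≡⟨ ∑-cong pointwise ⟩
      ∑ (λ e → if lookup E e then value e else 0#)                ≡⟨ sym (sumL-members value E) ⟩
      sumL (List.map value (members E))                           ≡⟨ ∑-value ⟩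
      0#                                                          ∎
      where
      support : ∀ C → entry C ≡ 0# ⊎ Covers A C
      support C = go (∣ C ∣ ℕ.≟ suc d) (A ⊆? C)
        where
        go : Dec (∣ C ∣ ≡ suc d) → Dec (A ⊆ C) → entry C ≡ 0# ⊎ Covers A C
        go (no ¬size) _         = inj₁ (if-no (∣ C ∣ ℕ.≟ suc d) ¬size)
        go (yes sz) (no ¬s)     = inj₁ (trans (if-yes (∣ C ∣ ℕ.≟ suc d) sz) (trans (cong (weight m G C *_) (Mentry-⊈ˡ G′ n C U A ¬s)) (zeroʳ (weight m G C))))
        go (yes sz) (yes A⊆C)   = inj₂ (⊆⇒covers A C (λ i h → VecP.[]=⇒lookup (A⊆C (VecP.lookup⇒[]= i A h))) (trans sz (cong suc (sym ∣A∣≡d))))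

      at : ∀ e x y → lookup A e ≡ x → lookup U e ≡ y →
        (if x then 0# else entry (insert A e)) ≡ (if not (x ∨ y) then value e else 0#)
      at e true  y     eA eU = refl
      at e false y     eA eU = trans (if-yes (∣ insert A e ∣ ℕ.≟ suc d) (trans (∣insert∣ A e eA) (cong suc ∣A∣≡d))) (inner y eU)
        where
        inner : ∀ y → lookup U e ≡ y → weight m G (insert A e) * Mentry G′ n (insert A e) U A ≡ (if not y then value e else 0#)
        inner true eU = trans (cong (weight m G (insert A e) *_) (Mentry-⊈ʳ G′ n (insert A e) U A
          (λ c → true≢false (trans (sym (VecP.[]=⇒lookup (c {e} (VecP.lookup⇒[]= e _ (VecP.lookup∘update e A true))))) (trans (VecP.lookup-map e not U) (cong not eU))))))
          (zeroʳ (weight m G (insert A e)))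
        inner false eU = cong (weight m G (insert A e) *_) (Mentry-in G′ n (insert A e) U A
          (λ {i} h → VecP.lookup⇒[]= i _ (lookup-insert A e i (VecP.[]=⇒lookup h)))
          (λ {i} h → VecP.lookup⇒[]= i _ (trans (VecP.lookup-map i not U) (cong not (out i (VecP.[]=⇒lookup h))))))
          where
          out : ∀ i → lookup (insert A e) i ≡ true → lookup U i ≡ false
          out i h with i FinP.≟ e
          ... | yes refl = eU
          ... | no ne    = disjoint i (lookup-insert⁻ A e i ne h)

      pointwise : ∀ e → (if lookup A e then 0# else entry (insert A e)) ≡ (if lookup E e then value e else 0#)
      pointwise e = trans (at e (lookup A e) (lookup U e) refl refl) (cong (λ b → if b then value e else 0#) (sym (lookup-E e)))

-- The colexicographic order

module ColexOrder {q : ℕ} (F : FiniteField q) where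

  open FieldArithmetic F
  open SpanningFamilies F
  open SubsetSums F

  infix 4 _≟ₛ_
  _≟ₛ_ : ∀ {N} (A B : Subset N) → Dec (A ≡ B)
  _≟ₛ_ = VecP.≡-dec Bool._≟_

  colexLt-≡ : ∀ {N} a b {A B : Subset N} → A ≡ B → colexLt (a ∷ A) (b ∷ B) ≡ not a ∧ b
  colexLt-≡ a b {A} {B} e rewrite dec-true (A ≟ₛ B) e = refl

  colexLt-≢ : ∀ {N} a b {A B : Subset N} → A ≢ B → colexLt (a ∷ A) (b ∷ B) ≡ colexLt A B
  colexLt-≢ a b {A} {B} ne rewrite dec-false (A ≟ₛ B) ne = refl

  colexLt-irrefl : ∀ {N} (A : Subset N) → colexLt A A ≡ false
  colexLt-irrefl []          = refl
  colexLt-irrefl (true ∷ A)  = colexLt-≡ true true {A} refl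
  colexLt-irrefl (false ∷ A) = colexLt-≡ false false {A} refl

  colexLt-asym : ∀ {N} (A B : Subset N) → colexLt A B ≡ true → colexLt B A ≡ false
  colexLt-asym [] [] ()
  colexLt-asym (a ∷ A) (b ∷ B) h with A ≟ₛ B
  ... | no ne = trans (colexLt-≢ b a (ne ∘ sym)) (colexLt-asym A B h)
  colexLt-asym (false ∷ A) (true  ∷ B) h | yes e = colexLt-≡ true false (sym e)
  colexLt-asym (false ∷ A) (false ∷ B) () | yes e
  colexLt-asym (true  ∷ A) (b ∷ B) () | yes e

  countₛ : ∀ {N} → (Subset N → Bool) → ℕ
  countₛ {zero}  f = if f [] then 1 else 0
  countₛ {suc N} f = countₛ (f ∘ (true ∷_)) ℕ.+ countₛ (f ∘ (false ∷_))

  countₛ-mono : ∀ {N} (f g : Subset N → Bool) → (∀ C → f C ≡ true → g C ≡ true) → countₛ f ≤ countₛ g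
  countₛ-mono {zero} f g h with f [] | h []
  ... | false | _ = z≤n
  ... | true  | e rewrite e refl = ℕP.≤-refl
  countₛ-mono {suc N} f g h = ℕP.+-mono-≤ (countₛ-mono (f ∘ (true ∷_)) (g ∘ (true ∷_)) (λ C → h (true ∷ C)))
    (countₛ-mono (f ∘ (false ∷_)) (g ∘ (false ∷_)) (λ C → h (false ∷ C)))

  countₛ-none : ∀ {N} (f : Subset N → Bool) → (∀ C → f C ≡ false) → countₛ f ≡ 0
  countₛ-none {zero}  f h rewrite h [] = refl
  countₛ-none {suc N} f h = cong₂ ℕ._+_ (countₛ-none (f ∘ (true ∷_)) (λ C → h (true ∷ C))) (countₛ-none (f ∘ (false ∷_)) (λ C → h (false ∷ C)))

  countₛ-some : ∀ {N} (f : Subset N → Bool) C → f C ≡ true → 1 ≤ countₛ f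
  countₛ-some f []          h rewrite h = ℕP.≤-refl
  countₛ-some f (true ∷ C)  h = ℕP.≤-trans (countₛ-some (f ∘ (true ∷_)) C h) (ℕP.m≤m+n _ _)
  countₛ-some f (false ∷ C) h = ℕP.≤-trans (countₛ-some (f ∘ (false ∷_)) C h) (ℕP.m≤n+m _ (countₛ (f ∘ (true ∷_))))

  countₛ-≤1+ : ∀ {N} (f g : Subset N → Bool) D → (∀ C → C ≢ D → f C ≡ true → g C ≡ true) → countₛ f ≤ suc (countₛ g)
  countₛ-≤1+ f g [] h with f [] | g []
  ... | false | _     = z≤n
  ... | true  | true  = s≤s z≤n
  ... | true  | false = ℕP.≤-refl
  countₛ-≤1+ f g (true ∷ D) h = ℕP.+-mono-≤ (countₛ-≤1+ (f ∘ (true ∷_)) (g ∘ (true ∷_)) D (λ C ne → h (true ∷ C) (ne ∘ VecP.∷-injectiveʳ)))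
    (countₛ-mono (f ∘ (false ∷_)) (g ∘ (false ∷_)) (λ C → h (false ∷ C) (λ ())))
  countₛ-≤1+ f g (false ∷ D) h = ℕP.≤-trans (ℕP.+-mono-≤ (countₛ-mono (f ∘ (true ∷_)) (g ∘ (true ∷_)) (λ C → h (true ∷ C) (λ ())))
    (countₛ-≤1+ (f ∘ (false ∷_)) (g ∘ (false ∷_)) D (λ C ne → h (false ∷ C) (ne ∘ VecP.∷-injectiveʳ))))
    (ℕP.≤-reflexive (ℕP.+-suc _ _))

  precedes : ∀ {N} → ℕ → Subset N → Subset N → Bool
  precedes m C D = does (∣ D ∣ ℕ.≟ m) ∧ colexLt D C

  rank : ∀ {N} → ℕ → Subset N → ℕ
  rank m C = countₛ (precedes m C)

  private
    countL : ∀ {A : Set} → (A → Bool) → List A → ℕ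
    countL f []       = 0
    countL f (x ∷ xs) = (if f x then 1 else 0) ℕ.+ countL f xs

    countL-++ : ∀ {A : Set} (f : A → Bool) xs ys → countL f (xs List.++ ys) ≡ countL f xs ℕ.+ countL f ys
    countL-++ f []       ys = refl
    countL-++ f (x ∷ xs) ys = trans (cong ((if f x then 1 else 0) ℕ.+_) (countL-++ f xs ys)) (sym (ℕP.+-assoc (if f x then 1 else 0) _ _))

    countL-map : ∀ {A B : Set} (f : B → Bool) (g : A → B) xs → countL f (List.map g xs) ≡ countL (f ∘ g) xs
    countL-map f g []       = refl
    countL-map f g (x ∷ xs) = cong ((if f (g x) then 1 else 0) ℕ.+_) (countL-map f g xs)

    countL-allSubsets : ∀ N (f : Subset N → Bool) → countL f (allSubsets N) ≡ countₛ f
    countL-allSubsets zero    f = ℕP.+-identityʳ _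
    countL-allSubsets (suc N) f = trans (countL-++ f (List.map (true ∷_) (allSubsets N)) _)
      (cong₂ ℕ._+_ (trans (countL-map f (true ∷_) (allSubsets N)) (countL-allSubsets N (f ∘ (true ∷_))))
                   (trans (countL-map f (false ∷_) (allSubsets N)) (countL-allSubsets N (f ∘ (false ∷_)))))

    length-filter² : ∀ {A : Set} {P Q : A → Set} (P? : ∀ x → Dec (P x)) (Q? : ∀ x → Dec (Q x)) xs →
      length (filter P? (filter Q? xs)) ≡ countL (λ x → does (Q? x) ∧ does (P? x)) xs
    length-filter² P? Q? [] = refl
    length-filter² P? Q? (x ∷ xs) with does (Q? x)
    ... | false = length-filter² P? Q? xs
    ... | true with does (P? x)
    ...   | true  = cong suc (length-filter² P? Q? xs)
    ...   | false = length-filter² P? Q? xs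

  colexRank≡rank : ∀ {N} m (C : Subset N) → colexRank m C ≡ rank m C
  colexRank≡rank {N} m C = trans (length-filter² (λ C′ → T? (colexLt C′ C)) (λ s → ∣ s ∣ ℕ.≟ m) (allSubsets N))
    (countL-allSubsets N (precedes m C))

  ∧-mono : ∀ a {b c} → (b ≡ true → c ≡ true) → a ∧ b ≡ true → a ∧ c ≡ true
  ∧-mono true  h e = h e
  ∧-mono false h ()

  colexLt-tail⁺ : ∀ {N} c′ c (A B : Subset N) → colexLt A B ≡ true → colexLt (c′ ∷ A) (c ∷ B) ≡ true
  colexLt-tail⁺ c′ c A B h with A ≟ₛ B
  ... | yes refl = contradiction (trans (sym h) (colexLt-irrefl A)) true≢false
  ... | no ne    = h

  colexLt-tail⁻ : ∀ {N} c′ c (A B : Subset N) → (A ≡ B → not c′ ∧ c ≡ false) → colexLt (c′ ∷ A) (c ∷ B) ≡ true → colexLt A B ≡ true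
  colexLt-tail⁻ c′ c A B f h with A ≟ₛ B
  ... | yes e = contradiction (trans (sym h) (f e)) true≢false
  ... | no ne = h

  does-sound : ∀ {P : Set} (p? : Dec P) {b} → does p? ∧ b ≡ true → P
  does-sound (yes p) _ = p
  does-sound (no _) ()

  -- Sets D are split by whether they contain the smallest index, as in Pascal's rule. If the tail
  -- of D strictly precedes C, the smallest index has no influence on the comparison.
  rank-lower : ∀ {N} m c (C : Subset N) → rank m C ℕ.+ rank (suc m) C ≤ rank (suc m) (c ∷ C)
  rank-lower m c C = ℕP.+-mono-≤
    (countₛ-mono (precedes m C) (precedes (suc m) (c ∷ C) ∘ (true ∷_)) (λ D → ∧-mono (does (∣ D ∣ ℕ.≟ m)) (colexLt-tail⁺ true c D C)))
    (countₛ-mono (precedes (suc m) C) (precedes (suc m) (c ∷ C) ∘ (false ∷_)) (λ D → ∧-mono (does (∣ D ∣ ℕ.≟ suc m)) (colexLt-tail⁺ false c D C)))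

  rank-lower₀ : ∀ {N} m c (C : Subset N) → rank m C ≤ rank m (c ∷ C)
  rank-lower₀ m c C = ℕP.≤-trans (countₛ-mono (precedes m C) (precedes m (c ∷ C) ∘ (false ∷_)) (λ D → ∧-mono (does (∣ D ∣ ℕ.≟ m)) (colexLt-tail⁺ false c D C)))
    (ℕP.m≤n+m _ (countₛ (precedes m (c ∷ C) ∘ (true ∷_))))

  true-part : ∀ {N} m c (C : Subset N) → countₛ (precedes (suc m) (c ∷ C) ∘ (true ∷_)) ≤ rank m C
  true-part m c C = countₛ-mono (precedes (suc m) (c ∷ C) ∘ (true ∷_)) (precedes m C)
    (λ D → ∧-mono (does (∣ D ∣ ℕ.≟ m)) (colexLt-tail⁻ true c D C (λ _ → refl)))

  true-part₀ : ∀ {N} c (C : Subset N) → countₛ (precedes 0 (c ∷ C) ∘ (true ∷_)) ≤ 0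
  true-part₀ c C = ℕP.≤-reflexive (countₛ-none (precedes 0 (c ∷ C) ∘ (true ∷_)) (λ D → refl))

  false-part : ∀ {N} m c (C : Subset N) → c ≡ false ⊎ ∣ C ∣ ≢ m → countₛ (precedes m (c ∷ C) ∘ (false ∷_)) ≤ rank m C
  false-part m c C h = countₛ-mono (precedes m (c ∷ C) ∘ (false ∷_)) (precedes m C) step
    where
    step : ∀ D → precedes m (c ∷ C) (false ∷ D) ≡ true → precedes m C D ≡ true
    step D e = ∧-mono (does (∣ D ∣ ℕ.≟ m)) (colexLt-tail⁻ false c D C (λ { refl → ok h })) e
      where
      ok : c ≡ false ⊎ ∣ D ∣ ≢ m → c ≡ false
      ok (inj₁ f)  = f
      ok (inj₂ ne) = contradiction (does-sound (∣ D ∣ ℕ.≟ m) e) ne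

  false-part-1+ : ∀ {N} m c (C : Subset N) → countₛ (precedes m (c ∷ C) ∘ (false ∷_)) ≤ suc (rank m C)
  false-part-1+ m c C = countₛ-≤1+ (precedes m (c ∷ C) ∘ (false ∷_)) (precedes m C) C
    (λ D ne → ∧-mono (does (∣ D ∣ ℕ.≟ m)) (colexLt-tail⁻ false c D C (λ e → contradiction e ne)))

  ∣∣≤ : ∀ {N} (C : Subset N) → ∣ C ∣ ≤ N
  ∣∣≤ []          = z≤n
  ∣∣≤ (true ∷ C)  = s≤s (∣∣≤ C)
  ∣∣≤ (false ∷ C) = ℕP.m≤n⇒m≤1+n (∣∣≤ C)

  colexLt-∅ : ∀ {N} (C : Subset N) → colexLt C (replicate N false) ≡ false
  colexLt-∅ []      = refl
  colexLt-∅ {suc N} (c ∷ C) with C ≟ₛ replicate N false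
  ... | yes _ = BoolP.∧-zeroʳ (not c)
  ... | no _  = colexLt-∅ C

  -- A set that precedes `P ▹ M` lies within the first j indices. With m ≥ j elements it could only
  -- consist of all of them, and then it would not be smaller.
  rank-▹≡0 : ∀ {j} (P : Subset j) M m → j ≤ m → rank m (P ▹ M) ≤ 0
  rank-▹≡0 [] M m _ = ℕP.≤-reflexive (countₛ-none (precedes m (replicate M false)) (λ D → trans (cong (does (∣ D ∣ ℕ.≟ m) ∧_) (colexLt-∅ D)) (BoolP.∧-zeroʳ _)))
  rank-▹≡0 {suc j} (c ∷ P) M (suc m) (s≤s j≤m) = ℕP.+-mono-≤
    (ℕP.≤-trans (true-part m c (P ▹ M)) (rank-▹≡0 P M m j≤m))
    (ℕP.≤-trans (false-part (suc m) c (P ▹ M) (inj₂ (λ e → ℕP.<-irrefl refl (ℕP.≤-trans (s≤s j≤m) (subst (_≤ j) (trans (sym (∣▹∣ P M)) e) (∣∣≤ P))))))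
      (rank-▹≡0 P M (suc m) (ℕP.m≤n⇒m≤1+n j≤m)))

  rank-▹-≤ : ∀ {j} (P : Subset (suc j)) M → rank j (P ▹ M) ≤ suc j
  rank-▹-≤ {zero} (c ∷ []) M = ℕP.+-mono-≤ (true-part₀ c (replicate M false))
    (ℕP.≤-trans (false-part-1+ 0 c (replicate M false)) (s≤s (rank-▹≡0 [] M 0 z≤n)))
  rank-▹-≤ {suc j} (c ∷ P) M = ℕP.≤-trans (ℕP.+-mono-≤ (ℕP.≤-trans (true-part j c (P ▹ M)) (rank-▹-≤ P M))
    (ℕP.≤-trans (false-part-1+ (suc j) c (P ▹ M)) (s≤s (rank-▹≡0 P M (suc j) ℕP.≤-refl)))) (ℕP.≤-reflexive (ℕP.+-comm (suc j) 1))

  -- The first j + 1 indices have j + 1 subsets of size j, and P is one of them, so at most j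
  -- precede it. When the size of P is not known, `rank-▹-≤` gives a bound larger by one.
  rank-▹ : ∀ {j} (P : Subset (suc j)) M → ∣ P ∣ ≡ j → rank j (P ▹ M) ≤ j
  rank-▹ {zero} (false ∷ []) M _ = ℕP.+-mono-≤ (true-part₀ false (replicate M false))
    (ℕP.≤-trans (false-part 0 false (replicate M false) (inj₁ refl)) (rank-▹≡0 [] M 0 z≤n))
  rank-▹ {suc j} (true ∷ P) M e = ℕP.≤-trans (ℕP.+-mono-≤ (ℕP.≤-trans (true-part j true (P ▹ M)) (rank-▹ P M (ℕP.suc-injective e)))
    (ℕP.≤-trans (false-part (suc j) true (P ▹ M) (inj₂ (λ e′ → ℕP.1+n≢n (sym (trans (sym (ℕP.suc-injective e)) (trans (sym (∣▹∣ P M)) e′))))))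
      (rank-▹≡0 P M (suc j) ℕP.≤-refl))) (ℕP.≤-trans (ℕP.≤-reflexive (ℕP.+-identityʳ j)) (ℕP.n≤1+n j))
  rank-▹ {suc j} (false ∷ P) M e = ℕP.≤-trans (ℕP.+-mono-≤ (ℕP.≤-trans (true-part j false (P ▹ M)) (rank-▹-≤ P M))
    (ℕP.≤-trans (false-part (suc j) false (P ▹ M) (inj₁ refl)) (rank-▹≡0 P M (suc j) ℕP.≤-refl))) (ℕP.≤-reflexive (ℕP.+-identityʳ (suc j)))

  rank-0 : ∀ {N} (C : Subset N) → C ≢ replicate N false → 1 ≤ rank 0 C
  rank-0 {N} C ne = countₛ-some (precedes 0 C) (replicate N false) (trans (cong (λ x → does (x ℕ.≟ 0) ∧ colexLt (replicate N false) C) (∣∅∣ N)) (∅< C ne))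
    where
    ∅< : ∀ {N} (C : Subset N) → C ≢ replicate N false → colexLt (replicate N false) C ≡ true
    ∅< [] ne = contradiction refl ne
    ∅< {suc N} (c ∷ C) ne with replicate N false ≟ₛ C
    ∅< (true ∷ C)  ne | yes e = refl
    ∅< (false ∷ C) ne | yes e = contradiction (cong (false ∷_) (sym e)) ne
    ... | no ne′ = ∅< C (ne′ ∘ sym)

  rank-++-≥1 : ∀ {j M} (P : Subset j) (Q : Subset M) → Q ≢ replicate M false → 1 ≤ rank j (P Vec.++ Q)
  rank-++-≥1 []      Q ne = rank-0 Q ne
  rank-++-≥1 (c ∷ P) Q ne = ℕP.≤-trans (ℕP.≤-trans (rank-++-≥1 P Q ne) (ℕP.m≤m+n _ _)) (rank-lower _ c (P Vec.++ Q))

  -- All j + 1 subsets of size j of the initial segment precede a set that reaches beyond it. They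
  -- are counted along Pascal's rule rather than listed; `rank-++-≥1` accounts for those without the
  -- smallest index.
  rank-++ : ∀ {j M} (P : Subset (suc j)) (Q : Subset M) → Q ≢ replicate M false → suc j ≤ rank j (P Vec.++ Q)
  rank-++ {zero}  (c ∷ []) Q ne = ℕP.≤-trans (rank-0 Q ne) (rank-lower₀ 0 c Q)
  rank-++ {suc j} (c ∷ P)  Q ne = ℕP.≤-trans (ℕP.≤-reflexive (ℕP.+-comm 1 (suc j)))
    (ℕP.≤-trans (ℕP.+-mono-≤ (rank-++ P Q ne) (rank-++-≥1 P Q ne)) (rank-lower j c (P Vec.++ Q)))

  private
    T⇒≡ : ∀ b → Bool.T b → b ≡ true
    T⇒≡ true _ = refl

    ¬T⇒≡ : ∀ b → ¬ Bool.T b → b ≡ false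
    ¬T⇒≡ false _ = refl
    ¬T⇒≡ true  n = contradiction _ n

  -- The first k of the (k-1)-subsets in colex order are the (k-1)-subsets of the first k elements.
  vTarget-▹ : ∀ {j M} (G : Family (suc j) (suc j ℕ.+ M)) n (P : Subset (suc j)) → ∣ P ∣ ≡ j → vTarget G n (P ▹ M) ≡ 1#
  vTarget-▹ {j} {M} G n P e rewrite colexRank≡rank j (P ▹ M) | T⇒≡ (rank j (P ▹ M) ℕ.<ᵇ suc j) (ℕP.<⇒<ᵇ (s≤s (rank-▹ P M e))) = refl

  vTarget-support : ∀ {j M} (G : Family (suc j) (suc j ℕ.+ M)) n (C : Subset (suc j ℕ.+ M)) →
    vTarget G n C ≡ 0# ⊎ ∃ λ P → C ≡ P ▹ M
  vTarget-support {j} {M} G n C with Vec.splitAt (suc j) C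
  ... | P , Q , refl with Q ≟ₛ replicate M false
  ...   | yes refl = inj₂ (P , refl)
  ...   | no ne    = inj₁ zero-value
    where
    zero-value : vTarget G n (P Vec.++ Q) ≡ 0#
    zero-value rewrite colexRank≡rank j (P Vec.++ Q)
      | ¬T⇒≡ (rank j (P Vec.++ Q) ℕ.<ᵇ suc j) (λ t → ℕP.<⇒≱ (ℕP.<ᵇ⇒< (rank j (P Vec.++ Q)) (suc j) t) (rank-++ P Q ne)) = refl

  ∈-allSubsets : ∀ {N} (C : Subset N) → C ∈ allSubsets N
  ∈-allSubsets []          = here refl
  ∈-allSubsets (true ∷ C)  = ∈P.∈-++⁺ˡ (∈P.∈-map⁺ (true ∷_) (∈-allSubsets C))
  ∈-allSubsets (false ∷ C) = ∈P.∈-++⁺ʳ (List.map (true ∷_) (allSubsets _)) (∈P.∈-map⁺ (false ∷_) (∈-allSubsets C))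

  ∈-subsetsOfSize : ∀ {N} (C : Subset N) {m} → ∣ C ∣ ≡ m → C ∈ subsetsOfSize N m
  ∈-subsetsOfSize {N} C {m} e = ∈P.∈-filter⁺ (λ s → ∣ s ∣ ℕ.≟ m) (∈-allSubsets C) e

  ∈-subsetsOfSize⁻ : ∀ {N} (C : Subset N) {m} → C ∈ subsetsOfSize N m → ∣ C ∣ ≡ m
  ∈-subsetsOfSize⁻ {N} C {m} h = proj₂ (∈P.∈-filter⁻ (λ s → ∣ s ∣ ℕ.≟ m) {xs = allSubsets N} h)

  colexLast-∈ : ∀ {N} (d : Subset N) {x} xs → x ∈ xs → colexLast d xs ∈ xs
  colexLast-∈ d (s ∷ []) _ with colexLt s s
  ... | true  = here refl
  ... | false = here refl
  colexLast-∈ d (s ∷ ss@(s′ ∷ _)) _ = choose (colexLt s (colexLast s ss)) (colexLast-∈ s ss (here refl))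
    where
    choose : ∀ b {t} → t ∈ ss → (if b then t else s) ∈ s ∷ ss
    choose true  t∈ = there t∈
    choose false t∈ = here refl

  colexLast-max : ∀ {N} (d X : Subset N) xs → X ∈ xs → (∀ U → U ∈ xs → U ≢ X → colexLt U X ≡ true) → colexLast d xs ≡ X
  colexLast-max d X (s ∷ []) (here refl) max with colexLt s s
  ... | true  = refl
  ... | false = refl
  colexLast-max d X (s ∷ ss@(s′ ∷ _)) X∈ max = go (s ≟ₛ X) (λ X∈ss → colexLast-max s X ss X∈ss (λ U m → max U (there m)))
    (colexLast s ss) refl
    where
    go : Dec (s ≡ X) → (X ∈ ss → colexLast s ss ≡ X) → ∀ t → colexLast s ss ≡ t → (if colexLt s t then t else s) ≡ X
    go (no ne) ih t e rewrite trans (sym e) (ih (Any.tail (ne ∘ sym) X∈)) | max s (here refl) ne = refl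
    go (yes refl) ih t refl with t ≟ₛ s
    ... | yes e rewrite e | colexLt-irrefl s = refl
    ... | no ne rewrite colexLt-asym t s (max t (there (colexLast-∈ s ss (here refl))) ne) = refl

  -- Maximality is required against all sets of at most n elements, not only those of exactly n:
  -- when the smallest index is split off, the size of U may drop.
  ColexMax : ∀ {N} → ℕ → Subset N → Set
  ColexMax n X = ∣ X ∣ ≡ n × (∀ U → ∣ U ∣ ≤ n → U ≢ X → colexLt U X ≡ true)

  ColexMax-full : ∀ n → ColexMax n (replicate n true)
  ColexMax-full n = ∣full∣ n , λ U _ → below n U
    where
    below : ∀ n (U : Subset n) → U ≢ replicate n true → colexLt U (replicate n true) ≡ true
    below zero [] ne = contradiction refl ne
    below (suc n) (u ∷ U) ne with U ≟ₛ replicate n true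
    below (suc n) (true ∷ U)  ne | yes e = contradiction (cong (true ∷_) e) ne
    below (suc n) (false ∷ U) ne | yes e = refl
    ... | no ne′ = below n U ne′

  ColexMax-shift : ∀ {N n} j (X : Subset N) → ColexMax n X → ColexMax n (replicate j false Vec.++ X)
  ColexMax-shift zero    X mx = mx
  ColexMax-shift {n = n} (suc j) X mx with ColexMax-shift j X mx
  ... | size , below = size , step
    where
    step : ∀ U → ∣ U ∣ ≤ n → U ≢ false ∷ (replicate j false Vec.++ X) → colexLt U (false ∷ (replicate j false Vec.++ X)) ≡ true
    step (u ∷ U) le ne with U ≟ₛ (replicate j false Vec.++ X)
    step (false ∷ U) le ne | yes e = contradiction (cong (false ∷_) e) ne
    step (true  ∷ U) le ne | yes refl = contradiction (subst (suc ∣ U ∣ ≤_) (sym size) le) (ℕP.<-irrefl refl)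
    step (false ∷ U) le ne | no ne′ = below U le ne′
    step (true  ∷ U) le ne | no ne′ = below U (ℕP.≤-trans (ℕP.n≤1+n _) le) ne′

  disjoint-of-size : ∀ {N} n (C : Subset N) → n ℕ.+ ∣ C ∣ ≤ N → ∃ λ U → ∣ U ∣ ≡ n × (∀ i → lookup U i ≡ true → lookup C i ≡ false)
  disjoint-of-size zero [] _ = [] , refl , λ ()
  disjoint-of-size (suc n) [] ()
  disjoint-of-size {suc N} n (true ∷ C) le with disjoint-of-size n C (ℕP.≤-pred (subst (_≤ suc N) (ℕP.+-suc n ∣ C ∣) le))
  ... | U , e , dis = false ∷ U , e , λ { (suc i) → dis i }
  disjoint-of-size zero (false ∷ C) le with disjoint-of-size 0 C (∣∣≤ C)
  ... | U , e , dis = false ∷ U , e , λ { (suc i) → dis i }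
  disjoint-of-size (suc n) (false ∷ C) le with disjoint-of-size n C (ℕP.≤-pred le)
  ... | U , e , dis = true ∷ U , cong suc e , λ { zero _ → refl ; (suc i) → dis i }

-- Pairing the kernel vector with the column space hypothesis

module ColumnSpace {q : ℕ} (F : FiniteField q) where

  open FieldArithmetic F
  open ProjectiveLine F
  open Determinants F
  open SpanningFamilies F
  open SubsetSums F
  open KernelVector F
  open ColexOrder F

  ⊆∁⇒disjoint : ∀ {N} (A C : Subset N) → A ⊆ ∁ C → ∀ i → lookup A i ≡ true → lookup C i ≡ false
  ⊆∁⇒disjoint A C s i h = trans (sym (BoolP.not-involutive _)) (cong not (trans (sym (VecP.lookup-map i not C)) (VecP.[]=⇒lookup (s (VecP.lookup⇒[]= i A h)))))

  disjoint⇒⊆∁ : ∀ {N} (A C : Subset N) → (∀ i → lookup A i ≡ true → lookup C i ≡ false) → A ⊆ ∁ C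
  disjoint⇒⊆∁ A C d {i} h = VecP.lookup⇒[]= i (∁ C) (trans (VecP.lookup-map i not C) (cong not (d i (VecP.[]=⇒lookup h))))

  module _ {k N : ℕ} (G : Family k N) (n : ℕ) (C : Subset N) where

    private
      candidates : List (Subset N)
      candidates = filter (λ U → U ⊆? ∁ C) (subsetsOfSize N n)

      ∈-candidates : ∀ U → ∣ U ∣ ≡ n → (∀ i → lookup U i ≡ true → lookup C i ≡ false) → U ∈ candidates
      ∈-candidates U size dis = ∈P.∈-filter⁺ (λ U → U ⊆? ∁ C) (∈-subsetsOfSize U size) (disjoint⇒⊆∁ U C dis)

      ∈-candidates⁻ : ∀ {U} → U ∈ candidates → ∣ U ∣ ≡ n × (∀ i → lookup U i ≡ true → lookup C i ≡ false)
      ∈-candidates⁻ {U} h with ∈P.∈-filter⁻ (λ U → U ⊆? ∁ C) {xs = subsetsOfSize N n} h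
      ... | U∈ , s = ∈-subsetsOfSize⁻ U U∈ , ⊆∁⇒disjoint U C s

    L-disjoint : n ℕ.+ ∣ C ∣ ≤ N → ∀ i → lookup (L G n C) i ≡ true → lookup C i ≡ false
    L-disjoint le with disjoint-of-size n C le
    ... | U , size , dis = proj₂ (∈-candidates⁻ (colexLast-∈ C candidates (∈-candidates U size dis)))

    L-max : ∀ X → ColexMax n X → (∀ i → lookup X i ≡ true → lookup C i ≡ false) → L G n C ≡ X
    L-max X (size , below) dis = colexLast-max C X candidates (∈-candidates X size dis)
      (λ U m → below U (ℕP.≤-reflexive (proj₁ (∈-candidates⁻ m))))

    Jentry⁻¹ : Carrier
    Jentry⁻¹ = prodL (List.map (λ y → det (G y ∷ sub G C)) (members (L G n C)))

  prodL-inverse : ∀ {A : Set} (f : A → Carrier) xs → (∀ x → x ∈ xs → f x ≢ 0#) →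
    prodL (List.map f xs) * prodL (List.map (λ x → f x ⁻¹) xs) ≡ 1#
  prodL-inverse f []       ne = *-identityˡ 1#
  prodL-inverse f (x ∷ xs) ne = begin
    (f x * prodL (List.map f xs)) * (f x ⁻¹ * prodL (List.map (λ x → f x ⁻¹) xs))
      ≡⟨ solve 4 (λ a b c d → (a :* b) :* (c :* d) := (a :* c) :* (b :* d)) refl (f x) _ (f x ⁻¹) _ ⟩
    (f x * f x ⁻¹) * (prodL (List.map f xs) * prodL (List.map (λ x → f x ⁻¹) xs))
      ≡⟨ cong₂ _*_ (inverse (f x) (ne x (here refl))) (prodL-inverse f xs (λ y m → ne y (there m))) ⟩
    1# * 1#
      ≡⟨ *-identityˡ 1# ⟩
    1# ∎

  J⁻¹*J : ∀ {k N} (G : Family (suc k) N) n (C : Subset N) → Spanning G → ∣ C ∣ ≡ k → n ℕ.+ ∣ C ∣ ≤ N →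
    Jentry⁻¹ G n C * Jentry G n C ≡ 1#
  J⁻¹*J G n C sp size le = prodL-inverse (λ y → det (G y ∷ sub G C)) (members (L G n C))
    (λ y m → det₁≢0 G sp C size y (L-disjoint G n C le y (∈-members⁻ (L G n C) y m)))

  ∈-columns : ∀ {k N} (G : Family k N) n {U A} → (U , A) ∈ columns G n →
    ∣ U ∣ ≡ n × ∣ A ∣ ≡ k ℕ.∸ 2 × (∀ i → lookup A i ≡ true → lookup U i ≡ false)
  ∈-columns {k} {N} G n {U} {A} h with find (∈P.∈-concatMap⁻ (λ U → List.map (U ,_) (filter (λ A → A ⊆? ∁ U) (subsetsOfSize N (k ℕ.∸ 2)))) {xs = subsetsOfSize N n} h)
  ... | U′ , U∈ , h′ with ∈P.∈-map⁻ (U′ ,_) h′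
  ... | A′ , A∈ , refl with ∈P.∈-filter⁻ (λ A → A ⊆? ∁ U′) {xs = subsetsOfSize N (k ℕ.∸ 2)} A∈
  ... | A∈′ , s = ∈-subsetsOfSize⁻ U′ U∈ , ∈-subsetsOfSize⁻ A′ A∈′ , ⊆∁⇒disjoint A′ U′ s

  ∑ₛ-sumL : ∀ {N} {B : Set} (f : Subset N → B → Carrier) xs →
    ∑ₛ (λ C → sumL (List.map (f C) xs)) ≡ sumL (List.map (λ b → ∑ₛ (λ C → f C b)) xs)
  ∑ₛ-sumL {N} f []   = ∑ₛ-zero {N} (λ C → refl)
  ∑ₛ-sumL f (b ∷ xs) = trans (∑ₛ-+ (λ C → f C b) (λ C → sumL (List.map (f C) xs))) (cong (∑ₛ (λ C → f C b) +_) (∑ₛ-sumL f xs))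

  ∑ₛ-* : ∀ {N} (f : Subset N → Carrier) c → ∑ₛ f * c ≡ ∑ₛ (λ C → f C * c)
  ∑ₛ-* {zero}  f c = refl
  ∑ₛ-* {suc N} f c = trans (distribʳ _ _ _) (cong₂ _+_ (∑ₛ-* (f ∘ (true ∷_)) c) (∑ₛ-* (f ∘ (false ∷_)) c))

  sumL-zero : ∀ {A : Set} (f : A → Carrier) xs → (∀ x → x ∈ xs → f x ≡ 0#) → sumL (List.map f xs) ≡ 0#
  sumL-zero f []       z = refl
  sumL-zero f (x ∷ xs) z = trans (cong₂ _+_ (z x (here refl)) (sumL-zero f xs (λ y m → z y (there m)))) (+-identityˡ 0#)

  -- The facet opposite to c of the simplex on the first indices. These facets are the rows on which
  -- v takes the value 1.
  skip : ∀ {k} → Fin (suc k) → Subset (suc k)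
  skip {k}     zero    = false ∷ replicate k true
  skip {suc k} (suc c) = true ∷ skip c

  ∣skip∣ : ∀ {k} (c : Fin (suc k)) → ∣ skip c ∣ ≡ k
  ∣skip∣ {k}     zero    = ∣full∣ k
  ∣skip∣ {suc k} (suc c) = cong suc (∣skip∣ c)

  lookup-skip : ∀ {k} (c : Fin (suc k)) → lookup (skip c) c ≡ false
  lookup-skip         zero    = refl
  lookup-skip {suc k} (suc c) = lookup-skip c

  lookup-skip-≢ : ∀ {k} (c i : Fin (suc k)) → i ≢ c → lookup (skip c) i ≡ true
  lookup-skip-≢         zero    zero    ne = contradiction refl ne
  lookup-skip-≢         zero    (suc i) ne = VecP.lookup-replicate i true
  lookup-skip-≢ {suc k} (suc c) zero    ne = refl
  lookup-skip-≢ {suc k} (suc c) (suc i) ne = lookup-skip-≢ c i (ne ∘ cong suc)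

  ∣∣≡⇒full : ∀ {k} (P : Subset k) → ∣ P ∣ ≡ k → P ≡ replicate k true
  ∣∣≡⇒full []          e = refl
  ∣∣≡⇒full (true ∷ P)  e = cong (true ∷_) (∣∣≡⇒full P (ℕP.suc-injective e))
  ∣∣≡⇒full {suc k} (false ∷ P) e = contradiction (subst (_≤ k) e (∣∣≤ P)) (ℕP.<-irrefl refl)

  ∣∣≡⇒skip : ∀ {k} (P : Subset (suc k)) → ∣ P ∣ ≡ k → ∃ λ c → P ≡ skip c
  ∣∣≡⇒skip {k}     (false ∷ P) e = zero , cong (false ∷_) (∣∣≡⇒full P e)
  ∣∣≡⇒skip {suc k} (true ∷ P)  e with ∣∣≡⇒skip P (ℕP.suc-injective e)
  ... | c , refl = suc c , refl

  ∑ₛ-skip : ∀ {k} (h : Subset (suc k) → Carrier) → (∀ P → h P ≡ 0# ⊎ ∃ λ c → P ≡ skip c) → ∑ₛ h ≡ ∑ (h ∘ skip)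
  ∑ₛ-skip {k} h supp = trans (cong₂ _+_ (true-sum h supp) (∑ₛ-single (replicate k true) single)) (+-comm _ _)
    where
    single : ∀ P → h (false ∷ P) ≡ 0# ⊎ P ≡ replicate k true
    single P with supp (false ∷ P)
    ... | inj₁ z             = inj₁ z
    ... | inj₂ (zero , refl) = inj₂ refl
    ... | inj₂ (suc c , e)   = absurd c e
      where
      absurd : ∀ {k} (c : Fin k) {P : Subset k} {X : Set} → false ∷ P ≡ skip (suc c) → X
      absurd {suc k} c ()
    true-sum : ∀ {k} (h : Subset (suc k) → Carrier) → (∀ P → h P ≡ 0# ⊎ ∃ λ c → P ≡ skip c) →
      ∑ₛ (h ∘ (true ∷_)) ≡ ∑ (λ c → h (skip (suc c)))
    true-sum {zero} h supp with supp (true ∷ [])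
    ... | inj₁ z = z
    ... | inj₂ (zero , ())
    true-sum {suc k} h supp = ∑ₛ-skip (h ∘ (true ∷_)) supp′
      where
      supp′ : ∀ P → h (true ∷ P) ≡ 0# ⊎ ∃ λ c → P ≡ skip c
      supp′ P with supp (true ∷ P)
      ... | inj₁ z             = inj₁ z
      ... | inj₂ (suc c , refl) = inj₂ (c , refl)

  ∑ₛ-▹ : ∀ k {M} (f : Subset (k ℕ.+ M) → Carrier) → (∀ C → f C ≡ 0# ⊎ ∃ λ P → C ≡ P ▹ M) → ∑ₛ f ≡ ∑ₛ (λ (P : Subset k) → f (P ▹ M))
  ∑ₛ-▹ zero {M} f supp = ∑ₛ-single (replicate M false) only
    where
    only : ∀ C → f C ≡ 0# ⊎ C ≡ replicate M false
    only C with supp C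
    ... | inj₁ z         = inj₁ z
    ... | inj₂ ([] , e)  = inj₂ e
  ∑ₛ-▹ (suc k) {M} f supp = cong₂ _+_ (∑ₛ-▹ k (f ∘ (true ∷_)) (tails true)) (∑ₛ-▹ k (f ∘ (false ∷_)) (tails false))
    where
    tails : ∀ b C → f (b ∷ C) ≡ 0# ⊎ ∃ λ P → C ≡ P ▹ M
    tails b C with supp (b ∷ C)
    ... | inj₁ z              = inj₁ z
    ... | inj₂ (_ ∷ P , refl) = inj₂ (P , refl)

  ∑ₛ-▹-skip : ∀ {k M} (f : Subset (suc k ℕ.+ M) → Carrier) → (∀ C → f C ≡ 0# ⊎ ∃ λ P → C ≡ P ▹ M) →
    (∀ P → f (P ▹ M) ≡ 0# ⊎ ∃ λ c → P ≡ skip c) → ∑ₛ f ≡ ∑ (λ c → f (skip c ▹ M))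
  ∑ₛ-▹-skip {k} {M} f supp supp-skip = trans (∑ₛ-▹ (suc k) f supp) (∑ₛ-skip (λ P → f (P ▹ M)) supp-skip)

  -- The last n indices, after K basis points and d further points. For every C contained in the
  -- first K indices this is the set L_C.
  final : ∀ K d n → Subset (K ℕ.+ (d ℕ.+ n))
  final K d n = replicate K false Vec.++ (replicate d false Vec.++ replicate n true)

  lookup-final-head : ∀ K d n (i : Fin K) → lookup (final K d n) (i ↑ˡ (d ℕ.+ n)) ≡ false
  lookup-final-head K d n i = trans (VecP.lookup-++ˡ (replicate K false) (replicate d false Vec.++ replicate n true) i) (VecP.lookup-replicate i false)

  -- The determinants in J⁻¹ cancel the inverses at the last n points of the subarc. In this way the
  -- n filler points leave no trace in the relation.
  ∏-inv-final : ∀ K {d n} (D : Fin (K ℕ.+ (d ℕ.+ n)) → Carrier) → (∀ i → D (K ↑ʳ (d ↑ʳ i)) ≢ 0#) →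
    ∏ (λ u → inv (D u)) * prodL (List.map D (members (final K d n))) ≡
    ∏ (λ (i : Fin K) → inv (D (i ↑ˡ (d ℕ.+ n)))) * ∏ (λ (i : Fin d) → inv (D (K ↑ʳ (i ↑ˡ n))))
  ∏-inv-final K {d} {n} D ne = begin
    ∏ (λ u → inv (D u)) * prodL (List.map D (members (final K d n)))
      ≡⟨ cong (∏ (λ u → inv (D u)) *_) (prodL-members D (final K d n)) ⟩
    ∏ (λ u → inv (D u)) * ∏ (λ u → if lookup (final K d n) u then D u else 1#)
      ≡⟨ sym (∏-* (λ u → inv (D u)) (λ u → if lookup (final K d n) u then D u else 1#)) ⟩
    ∏ h
      ≡⟨ ∏-++ K h ⟩
    ∏ (λ (i : Fin K) → h (i ↑ˡ (d ℕ.+ n))) * ∏ (λ i → h (K ↑ʳ i))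
      ≡⟨ cong₂ _*_ (∏-cong (λ (i : Fin K) → h-false (i ↑ˡ (d ℕ.+ n)) (lookup-final-head K d n i))) (∏-++ d (λ i → h (K ↑ʳ i))) ⟩
    ∏ (λ (i : Fin K) → inv (D (i ↑ˡ (d ℕ.+ n)))) * (∏ (λ (i : Fin d) → h (K ↑ʳ (i ↑ˡ n))) * ∏ (λ i → h (K ↑ʳ (d ↑ʳ i))))
      ≡⟨ cong (∏ (λ (i : Fin K) → inv (D (i ↑ˡ (d ℕ.+ n)))) *_) (trans (cong₂ _*_ (∏-cong middle) (∏-one end)) (*-identityʳ (∏ (λ (i : Fin d) → inv (D (K ↑ʳ (i ↑ˡ n))))))) ⟩
    ∏ (λ (i : Fin K) → inv (D (i ↑ˡ (d ℕ.+ n)))) * ∏ (λ (i : Fin d) → inv (D (K ↑ʳ (i ↑ˡ n)))) ∎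
    where
    h : Fin (K ℕ.+ (d ℕ.+ n)) → Carrier
    h u = inv (D u) * (if lookup (final K d n) u then D u else 1#)
    h-false : ∀ u → lookup (final K d n) u ≡ false → h u ≡ inv (D u)
    h-false u e = trans (cong (λ b → inv (D u) * (if b then D u else 1#)) e) (*-identityʳ (inv (D u)))
    tail : ∀ i → lookup (final K d n) (K ↑ʳ i) ≡ lookup (replicate d false Vec.++ replicate n true) i
    tail i = VecP.lookup-++ʳ (replicate K false) (replicate d false Vec.++ replicate n true) i
    middle : ∀ (i : Fin d) → h (K ↑ʳ (i ↑ˡ n)) ≡ inv (D (K ↑ʳ (i ↑ˡ n)))
    middle i = h-false (K ↑ʳ (i ↑ˡ n)) (trans (tail (i ↑ˡ n)) (trans (VecP.lookup-++ˡ (replicate d false) (replicate n true) i) (VecP.lookup-replicate i false)))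
    end : ∀ i → h (K ↑ʳ (d ↑ʳ i)) ≡ 1#
    end i = trans (cong (λ b → inv (D u) * (if b then D u else 1#)) (trans (tail (d ↑ʳ i)) (trans (VecP.lookup-++ʳ (replicate d false) (replicate n true) i) (VecP.lookup-replicate i true))))
      (inv-* (ne i))
      where
      u : Fin (K ℕ.+ (d ℕ.+ n))
      u = K ↑ʳ (d ↑ʳ i)

  if-sumL : ∀ {P : Set} (p? : Dec P) {B : Set} {u : Carrier} (g f : B → Carrier) (xs : List B) →
    (P → u ≡ sumL (List.map (λ b → g b * f b) xs)) →
    (if does p? then u else 0#) ≡ sumL (List.map (λ b → (if does p? then g b else 0#) * f b) xs)
  if-sumL (yes p) g f xs e = e p
  if-sumL (no _)  g f xs e = sym (sumL-zero (λ b → 0# * f b) xs (λ b _ → zeroˡ (f b)))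

  module Relation {d n m : ℕ}
    (hyp : ∀ (G : Family (2 ℕ.+ d) ((2 ℕ.+ d) ℕ.+ (d ℕ.+ n))) → IsArc G → vInColSpaceH G n)
    (G : Family (2 ℕ.+ d) ((2 ℕ.+ d) ℕ.+ (d ℕ.+ n) ℕ.+ m)) (sp : Spanning G)
    (full : (2 ℕ.+ d) ℕ.+ (d ℕ.+ n) ℕ.+ m ≡ suc q) where

    N M : ℕ
    N = (2 ℕ.+ d) ℕ.+ (d ℕ.+ n)
    M = d ℕ.+ n

    G′ : Family (2 ℕ.+ d) N
    G′ = G ∘ (_↑ˡ m)

    sp′ : Spanning G′
    sp′ = spanning-∘ G (_↑ˡ m) (λ {i} {j} → FinP.↑ˡ-injective m i j) sp

    room : ∀ (C : Subset N) → ∣ C ∣ ≡ suc d → n ℕ.+ ∣ C ∣ ≤ N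
    room C e = ℕP.≤-trans (ℕP.≤-reflexive (trans (cong (n ℕ.+_) e) (ℕP.+-comm n (suc d))))
      (ℕP.+-mono-≤ (ℕP.n≤1+n (suc d)) (ℕP.m≤n+m n d))

    solution : vInColSpaceH G′ n
    solution = hyp G′ (spanning⇒arc G′ (ℕP.m≤m+n (2 ℕ.+ d) M) sp′)

    x : Subset N → Subset N → Carrier
    x = proj₁ solution

    entry : Subset N → Subset N × Subset N → Carrier
    entry C (U , A) = if does (∣ C ∣ ℕ.≟ suc d) then weight m G C * Mentry G′ n C U A else 0#

    rhs : Subset N → Carrier
    rhs C = weight m G C * (Jentry⁻¹ G′ n C * vTarget G′ n C)

    row : ∀ (C : Subset N) → ∣ C ∣ ≡ suc d → rhs C ≡ sumL (List.map (λ col → (weight m G C * Mentry G′ n C (proj₁ col) (proj₂ col)) * x (proj₁ col) (proj₂ col)) (columns G′ n))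
    row C e = begin
      w * (J′ * vTarget G′ n C)
        ≡⟨ cong (λ v → w * (J′ * v)) (sym (proj₂ solution C e)) ⟩
      w * (J′ * sumL (List.map f (columns G′ n)))
        ≡⟨ sym (*-assoc w J′ _) ⟩
      (w * J′) * sumL (List.map f (columns G′ n))
        ≡⟨ *-sumL (w * J′) f (columns G′ n) ⟩
      sumL (List.map (λ col → (w * J′) * f col) (columns G′ n))
        ≡⟨ sumL-cong (All.universal (λ { (U , A) → cancel (Mentry G′ n C U A) (x U A) }) (columns G′ n)) ⟩
      sumL (List.map (λ col → (w * Mentry G′ n C (proj₁ col) (proj₂ col)) * x (proj₁ col) (proj₂ col)) (columns G′ n)) ∎
      where
      w J′ J : Carrier
      w  = weight m G C
      J′ = Jentry⁻¹ G′ n C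
      J  = Jentry G′ n C
      f : Subset N × Subset N → Carrier
      f (U , A) = Hentry G′ n C U A * x U A
      cancel : ∀ M x → (w * J′) * (J * M * x) ≡ (w * M) * x
      cancel M x = begin
        (w * J′) * (J * M * x)     ≡⟨ solve 5 (λ w j i m x → (w :* j) :* (i :* m :* x) := (j :* i) :* ((w :* m) :* x)) refl w J′ J M x ⟩
        (J′ * J) * ((w * M) * x)   ≡⟨ cong (_* ((w * M) * x)) (J⁻¹*J G′ n C sp′ e (room C e)) ⟩
        1# * ((w * M) * x)         ≡⟨ *-identityˡ _ ⟩
        (w * M) * x                ∎

    -- Since v = H x, the pairing w J⁻¹ v equals (w M) x after exchanging the sums, and w M vanishes
    -- in each column.
    relation-subsets : ∑ₛ (λ C → if does (∣ C ∣ ℕ.≟ suc d) then rhs C else 0#) ≡ 0#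
    relation-subsets = begin
      ∑ₛ (λ C → if does (∣ C ∣ ℕ.≟ suc d) then rhs C else 0#)
        ≡⟨ ∑ₛ-cong (λ C → if-sumL (∣ C ∣ ℕ.≟ suc d) (λ col → weight m G C * Mentry G′ n C (proj₁ col) (proj₂ col)) (λ col → x (proj₁ col) (proj₂ col)) (columns G′ n) (row C)) ⟩
      ∑ₛ (λ C → sumL (List.map (λ col → entry C col * x (proj₁ col) (proj₂ col)) (columns G′ n)))
        ≡⟨ ∑ₛ-sumL (λ C col → entry C col * x (proj₁ col) (proj₂ col)) (columns G′ n) ⟩
      sumL (List.map (λ col → ∑ₛ (λ C → entry C col * x (proj₁ col) (proj₂ col))) (columns G′ n))
        ≡⟨ sumL-zero (λ col → ∑ₛ (λ C → entry C col * x (proj₁ col) (proj₂ col))) (columns G′ n) vanish ⟩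
      0# ∎
      where
      vanish : ∀ col → col ∈ columns G′ n → ∑ₛ (λ C → entry C col * x (proj₁ col) (proj₂ col)) ≡ 0#
      vanish (U , A) h = trans (sym (∑ₛ-* (λ C → entry C (U , A)) (x U A))) (trans (cong (_* x U A)
        (Column.column-vanishes G sp full refl A U (proj₁ (proj₂ facts)) (proj₁ facts) (proj₂ (proj₂ facts)))) (zeroˡ (x U A)))
        where facts = ∈-columns G′ n h

    relation-skip : ∑ (λ (c : Fin (2 ℕ.+ d)) → weight m G (skip c ▹ M) * Jentry⁻¹ G′ n (skip c ▹ M)) ≡ 0#
    relation-skip = trans (∑-cong {2 ℕ.+ d} {λ (c : Fin (2 ℕ.+ d)) → weight m G (skip c ▹ M) * Jentry⁻¹ G′ n (skip c ▹ M)} {λ (c : Fin (2 ℕ.+ d)) → f (skip c ▹ M)} at-skip)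
      (trans (sym (∑ₛ-▹-skip f supp supp-skip)) relation-subsets)
      where
      f : Subset N → Carrier
      f C = if does (∣ C ∣ ℕ.≟ suc d) then rhs C else 0#
      at-skip : ∀ (c : Fin (2 ℕ.+ d)) → weight m G (skip c ▹ M) * Jentry⁻¹ G′ n (skip c ▹ M) ≡ f (skip c ▹ M)
      at-skip c = sym (trans (if-yes (∣ skip c ▹ M ∣ ℕ.≟ suc d) (trans (∣▹∣ (skip c) M) (∣skip∣ c)))
        (cong (weight m G (skip c ▹ M) *_) (trans (cong (Jentry⁻¹ G′ n (skip c ▹ M) *_) (vTarget-▹ G′ n (skip c) (∣skip∣ c))) (*-identityʳ (Jentry⁻¹ G′ n (skip c ▹ M))))))
      supp-skip : ∀ P → f (P ▹ M) ≡ 0# ⊎ ∃ λ c → P ≡ skip c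
      supp-skip P = go (∣ P ∣ ℕ.≟ suc d)
        where
        go : Dec (∣ P ∣ ≡ suc d) → f (P ▹ M) ≡ 0# ⊎ ∃ λ c → P ≡ skip c
        go (yes e) = inj₂ (∣∣≡⇒skip P e)
        go (no ne) = inj₁ (if-no (∣ P ▹ M ∣ ℕ.≟ suc d) (λ e → ne (trans (sym (∣▹∣ P M)) e)))
      supp : ∀ C → f C ≡ 0# ⊎ ∃ λ P → C ≡ P ▹ M
      supp C = go (∣ C ∣ ℕ.≟ suc d) (vTarget-support G′ n C)
        where
        go : Dec (∣ C ∣ ≡ suc d) → vTarget G′ n C ≡ 0# ⊎ (∃ λ P → C ≡ P ▹ M) → f C ≡ 0# ⊎ ∃ λ P → C ≡ P ▹ M
        go _ (inj₂ h) = inj₂ h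
        go (no ne) (inj₁ _) = inj₁ (if-no (∣ C ∣ ℕ.≟ suc d) ne)
        go (yes e) (inj₁ z) = inj₁ (trans (if-yes (∣ C ∣ ℕ.≟ suc d) e)
          (trans (cong (weight m G C *_) (trans (cong (Jentry⁻¹ G′ n C *_) z) (zeroʳ (Jentry⁻¹ G′ n C)))) (zeroʳ (weight m G C))))

    L-skip : ∀ (c : Fin (2 ℕ.+ d)) → L G′ n (skip c ▹ M) ≡ final (2 ℕ.+ d) d n
    L-skip c = L-max G′ n (skip c ▹ M) (final (2 ℕ.+ d) d n)
      (ColexMax-shift (2 ℕ.+ d) (replicate d false Vec.++ replicate n true) (ColexMax-shift d (replicate n true) (ColexMax-full n)))
      (++-elim {2 ℕ.+ d} (λ i → lookup (final (2 ℕ.+ d) d n) i ≡ true → lookup (skip c ▹ M) i ≡ false)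
        (λ i h → contradiction (trans (sym h) (lookup-final-head (2 ℕ.+ d) d n i)) true≢false)
        (λ i _ → lookup-▹ʳ (skip c) M i))

    abstract
      minor : Fin (2 ℕ.+ d) → Vect (2 ℕ.+ d) → Carrier
      minor c v = det (v ∷ sub G′ (skip c ▹ M))

      minor≡det : ∀ c v → minor c v ≡ det (v ∷ sub G′ (skip c ▹ M))
      minor≡det c v = refl

      relation : ∑ (λ c → ∏ (λ g → inv (minor c (G g))) *
        (∏ (λ (i : Fin (2 ℕ.+ d)) → inv (minor c (G′ (i ↑ˡ M)))) * ∏ (λ (i : Fin d) → inv (minor c (G′ ((2 ℕ.+ d) ↑ʳ (i ↑ˡ n))))))) ≡ 0#
      relation = trans (∑-cong {2 ℕ.+ d} {λ c → ∏ (λ g → inv (minor c (G g))) * (∏ (λ (i : Fin (2 ℕ.+ d)) → inv (minor c (G′ (i ↑ˡ M)))) * ∏ (λ (i : Fin d) → inv (minor c (G′ ((2 ℕ.+ d) ↑ʳ (i ↑ˡ n))))))} {λ (c : Fin (2 ℕ.+ d)) → weight m G (skip c ▹ M) * Jentry⁻¹ G′ n (skip c ▹ M)} summand) relation-skip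
        where
        summand : ∀ (c : Fin (2 ℕ.+ d)) → ∏ (λ g → inv (minor c (G g))) *
          (∏ (λ (i : Fin (2 ℕ.+ d)) → inv (minor c (G′ (i ↑ˡ M)))) * ∏ (λ (i : Fin d) → inv (minor c (G′ ((2 ℕ.+ d) ↑ʳ (i ↑ˡ n)))))) ≡ weight m G (skip c ▹ M) * Jentry⁻¹ G′ n (skip c ▹ M)
        summand c = trans (cong (X *_) (sym (trans (cong (λ S → Y * prodL (List.map D (members S))) (L-skip c)) (∏-inv-final (2 ℕ.+ d) D end))))
          (sym (*-assoc X Y (Jentry⁻¹ G′ n (skip c ▹ M))))
          where
          D : Fin N → Carrier
          D u = minor c (G′ u)
          X Y : Carrier
          X = ∏ (λ g → inv (minor c (G g)))
          Y = ∏ (λ u → inv (D u))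
          end : ∀ i → D ((2 ℕ.+ d) ↑ʳ (d ↑ʳ i)) ≢ 0#
          end i = det₁≢0 G′ sp′ (skip c ▹ M) (trans (∣▹∣ (skip c) M) (∣skip∣ c)) ((2 ℕ.+ d) ↑ʳ (d ↑ʳ i)) (lookup-▹ʳ (skip c) M (d ↑ʳ i))

-- Coordinates with respect to a basis contained in the arc

module ArcCoordinates {q : ℕ} (F : FiniteField q) where

  open FieldArithmetic F
  open ProjectiveLine F
  open Determinants F
  open SpanningFamilies F
  open SubsetSums F
  open KernelVector F
  open ColexOrder F
  open ColumnSpace F

  spanning-tuple : ∀ {k N} (G : Family k N) → Spanning G → (f : Fin k → Fin N) → Inj f →
    ∀ {Λ : Vect k → Carrier} → Linear Λ → (∀ i → Λ (G (f i)) ≡ 0#) → ∀ v → Λ v ≡ 0#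
  spanning-tuple G sp f inj lin zeros = sp (List.tabulate f) (UniqueP.tabulate⁺ inj) (ListP.length-tabulate f) lin zeros′
    where
    zeros′ : ∀ x → x ∈ List.tabulate f → _
    zeros′ x m with ∈P.∈-tabulate⁻ m
    ... | i , refl = zeros i

  members-full : ∀ k → members (replicate k true) ≡ List.allFin k
  members-full zero    = refl
  members-full (suc k) = cong (zero ∷_) (trans (cong (List.map suc) (members-full k)) (ListP.map-tabulate id suc))

  lookup-injective : ∀ {A : Set} {xs : List A} → Unique xs → Inj (List.lookup xs)
  lookup-injective {xs = x ∷ xs} (x∉ ∷ u) {zero}  {zero}  e = refl
  lookup-injective {xs = x ∷ xs} (x∉ ∷ u) {zero}  {suc j} e = contradiction e (All.lookup x∉ (∈P.∈-lookup j))
  lookup-injective {xs = x ∷ xs} (x∉ ∷ u) {suc i} {zero}  e = contradiction (sym e) (All.lookup x∉ (∈P.∈-lookup i))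
  lookup-injective {xs = x ∷ xs} (x∉ ∷ u) {suc i} {suc j} e = cong suc (lookup-injective u e)

  -- Reindexing the family by xs turns an arbitrary order of the rows into the inherited one.
  det-unique≢0 : ∀ {k N} (G : Family k N) → Spanning G → ∀ xs → Unique xs → length xs ≡ k → det (List.map G xs) ≢ 0#
  det-unique≢0 G sp xs u refl = subst (λ w → det w ≢ 0#) whole
    (det-sub≢0 (G ∘ List.lookup xs) (spanning-∘ G (List.lookup xs) (lookup-injective u) sp) (replicate (length xs) true) (∣full∣ (length xs)))
    where
    whole : sub (G ∘ List.lookup xs) (replicate (length xs) true) ≡ List.map G xs
    whole = begin
      List.map (G ∘ List.lookup xs) (members (replicate (length xs) true)) ≡⟨ cong (List.map _) (members-full (length xs)) ⟩
      List.map (G ∘ List.lookup xs) (List.allFin (length xs))             ≡⟨ ListP.map-∘ (List.allFin (length xs)) ⟩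
      List.map G (List.map (List.lookup xs) (List.allFin (length xs)))    ≡⟨ cong (List.map G) (trans (ListP.map-tabulate id (List.lookup xs)) (ListP.tabulate-lookup xs)) ⟩
      List.map G xs ∎

  module Coordinates {k N : ℕ} (G : Family (suc k) N) (sp : Spanning G) (κ : Fin (suc k) → Fin N) (κ-inj : Inj κ) where

    Off : Fin N → Set
    Off g = ∀ i → κ i ≢ g

    abstract
      -- The coordinate at c in the basis `G ∘ κ`, multiplied by ℓ c (G (κ c)). It is left
      -- unnormalised so that it agrees with the determinants occurring in H.
      ℓ : Fin (suc k) → Vect (suc k) → Carrier
      ℓ c v = det (v ∷ List.map (G ∘ κ) (members (skip c)))

      ℓ≡det : ∀ c v → ℓ c v ≡ det (v ∷ List.map (G ∘ κ) (members (skip c)))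
      ℓ≡det c v = refl

      ℓ-linear : ∀ c → Linear (ℓ c)
      ℓ-linear c = det-linear (List.map (G ∘ κ) (members (skip c)))

      ℓ-κ≢ : ∀ {c i} → i ≢ c → ℓ c (G (κ i)) ≡ 0#
      ℓ-κ≢ {c} {i} ne = det-∈ (G (κ i)) [] (List.map (G ∘ κ) (members (skip c))) (∈P.∈-map⁺ (G ∘ κ) (∈-members⁺ (skip c) i (lookup-skip-≢ c i ne)))

      ℓ≢0 : ∀ c g → (∀ i → i ≢ c → κ i ≢ g) → ℓ c (G g) ≢ 0#
      ℓ≢0 c g new = subst (λ w → det (G g ∷ w) ≢ 0#) (sym (ListP.map-∘ (members (skip c))))
        (det-unique≢0 G sp (g ∷ List.map κ (members (skip c))) (All.tabulate fresh-g ∷ UniqueP.map⁺ κ-inj (members-unique (skip c)))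
          (cong suc (trans (ListP.length-map κ (members (skip c))) (trans (length-members (skip c)) (∣skip∣ c)))))
        where
        fresh-g : ∀ {x} → x ∈ List.map κ (members (skip c)) → g ≢ x
        fresh-g m e with ∈P.∈-map⁻ κ m
        ... | i , i∈ , refl = new i (λ { refl → true≢false (trans (sym (∈-members⁻ (skip c) i i∈)) (lookup-skip c)) }) (sym e)

    ℓ-off : ∀ c {g} → Off g → ℓ c (G g) ≢ 0#
    ℓ-off c {g} off = ℓ≢0 c g (λ i _ → off i)

    ℓ-κ : ∀ c → ℓ c (G (κ c)) ≢ 0#
    ℓ-κ c = ℓ≢0 c (κ c) (λ i ne e → ne (κ-inj e))

    ζ : Fin (suc k) → Fin N → Carrier
    ζ c g = inv (ℓ c (G g))

    -- The constant a_c of the relation. The basis points contribute twice: once among all q + 1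
    -- points and once in the part of the subarc that J⁻¹ does not cancel.
    coefficient : Fin (suc k) → Carrier
    coefficient c = ∏ (λ g → ζ c g) * ∏ (λ i → ζ c (κ i))

    coefficient≢0 : ∀ c → coefficient c ≢ 0#
    coefficient≢0 c = *-≢0 (∏-≢0 (λ g → ζ c g) (λ g → inv≢0 (ℓ c (G g)))) (∏-≢0 (λ i → ζ c (κ i)) (λ i → inv≢0 (ℓ c (G (κ i)))))

    independent : LinearlyIndependent (G ∘ κ)
    independent = spanning⇒independent (G ∘ κ) (λ lin zeros → spanning-tuple G sp κ κ-inj lin zeros)

    expansion : ∀ v j → ∑ (λ c → (ℓ c v * inv (ℓ c (G (κ c)))) * G (κ c) j) ≡ v j
    expansion v j = trans (∑-cong (λ c → cong (_* G (κ c) j) (coordinate c))) (a≈v j)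
      where
      basis : UniqueCoordinates (G ∘ κ) v
      basis = independent⇒basis (G ∘ κ) independent v
      a : Fin (suc k) → Carrier
      a = proj₁ basis
      a≈v : ∀ j → ∑ (λ i → a i * G (κ i) j) ≡ v j
      a≈v = proj₁ (proj₂ basis)
      coordinate : ∀ c → ℓ c v * inv (ℓ c (G (κ c))) ≡ a c
      coordinate c = begin
        ℓ c v * inv (ℓ c (G (κ c)))
          ≡⟨ cong (_* inv (ℓ c (G (κ c)))) (trans (Linear-cong (ℓ-linear c) (λ j → sym (a≈v j))) (Linear-comb (ℓ-linear c) a (G ∘ κ))) ⟩
        ∑ (λ i → a i * ℓ c (G (κ i))) * inv (ℓ c (G (κ c)))
          ≡⟨ cong (_* inv (ℓ c (G (κ c)))) (∑-single c {λ i → a i * ℓ c (G (κ i))} (λ i ne → trans (cong (a i *_) (ℓ-κ≢ ne)) (zeroʳ (a i)))) ⟩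
        a c * ℓ c (G (κ c)) * inv (ℓ c (G (κ c)))
          ≡⟨ *-assoc (a c) (ℓ c (G (κ c))) (inv (ℓ c (G (κ c)))) ⟩
        a c * (ℓ c (G (κ c)) * inv (ℓ c (G (κ c))))
          ≡⟨ cong (a c *_) (*-inv (ℓ-κ c)) ⟩
        a c * 1#
          ≡⟨ *-identityʳ (a c) ⟩
        a c ∎

  module Minors {d N : ℕ} (G : Family (2 ℕ.+ d) N) (sp : Spanning G) (κ : Fin (2 ℕ.+ d) → Fin N) (κ-inj : Inj κ) where
    open Coordinates G sp κ κ-inj

    -- If the products agreed, the form ℓ c′ (G z) * ℓ c - ℓ c (G z) * ℓ c′ would vanish at z, at z′
    -- and at the k - 2 basis points other than κ c and κ c′. These k points span, yet the form does
    -- not vanish at κ c.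
    ℓ-minor≢0 : ∀ {z z′} → Off z → Off z′ → z ≢ z′ → ∀ {c c′} → c ≢ c′ → ℓ c (G z) * ℓ c′ (G z′) ≢ ℓ c′ (G z) * ℓ c (G z′)
    ℓ-minor≢0 {z} {z′} off off′ z≢z′ {c} {c′} c≢c′ eq = *-≢0 (ℓ-off c′ off) (ℓ-κ c)
      (trans (sym (trans (cong (λ w → ℓ c′ (G z) * ℓ c (G (κ c)) + (- ℓ c (G z)) * w) (ℓ-κ≢ c≢c′))
          (solve 2 (λ a b → a :+ (:- b) :* :0 := a) refl (ℓ c′ (G z) * ℓ c (G (κ c))) (ℓ c (G z)))))
        (spanning-tuple G sp f f-inj {Λ} linear vanish (G (κ c))))
      where
      Λ : Vect (2 ℕ.+ d) → Carrier
      Λ v = ℓ c′ (G z) * ℓ c v + (- ℓ c (G z)) * ℓ c′ v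
      linear : Linear Λ
      linear = Linear-+ (Linear-* (ℓ c′ (G z)) (ℓ-linear c)) (Linear-* (- ℓ c (G z)) (ℓ-linear c′))
      c″ : Fin (suc d)
      c″ = punchOut c≢c′
      rest : Fin d → Fin (2 ℕ.+ d)
      rest j = punchIn c (punchIn c″ j)
      rest≢c : ∀ j → rest j ≢ c
      rest≢c j = FinP.punchInᵢ≢i c (punchIn c″ j)
      rest≢c′ : ∀ j → rest j ≢ c′
      rest≢c′ j e = FinP.punchInᵢ≢i c″ j (FinP.punchIn-injective c (punchIn c″ j) c″ (trans e (sym (FinP.punchIn-punchOut c≢c′))))
      f : Fin (2 ℕ.+ d) → Fin N
      f = z VF.∷ z′ VF.∷ (κ ∘ rest)
      f-inj : Inj f
      f-inj = ∷-injective (∷-injective (λ e → FinP.punchIn-injective c″ _ _ (FinP.punchIn-injective c _ _ (κ-inj e))) (λ j → off′ (rest j)))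
        (λ { zero e → z≢z′ (sym e) ; (suc j) e → off (rest j) e })
      vanish : ∀ i → Λ (G (f i)) ≡ 0#
      vanish zero       = solve 2 (λ a b → a :* b :+ (:- b) :* a := :0) refl (ℓ c′ (G z)) (ℓ c (G z))
      vanish (suc zero) = trans (cong (_+ (- ℓ c (G z)) * ℓ c′ (G z′)) (sym eq))
        (solve 2 (λ a b → a :* b :+ (:- a) :* b := :0) refl (ℓ c (G z)) (ℓ c′ (G z′)))
      vanish (suc (suc j)) = trans (cong₂ (λ a b → ℓ c′ (G z) * a + (- ℓ c (G z)) * b) (ℓ-κ≢ (rest≢c j)) (ℓ-κ≢ (rest≢c′ j)))
        (solve 2 (λ a b → a :* :0 :+ (:- b) :* :0 := :0) refl (ℓ c′ (G z)) (ℓ c (G z)))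

    ζ-minor≢0 : ∀ {z z′} → Off z → Off z′ → z ≢ z′ → ∀ {c c′} → c ≢ c′ → ζ c z * ζ c′ z′ + - (ζ c′ z * ζ c z′) ≢ 0#
    ζ-minor≢0 {z} {z′} off off′ z≢z′ {c} {c′} c≢c′ e = ℓ-minor≢0 off off′ z≢z′ c≢c′ (begin
      a * b′                ≡⟨ sym (inv-involutive (*-≢0 a≢0 b′≢0)) ⟩
      inv (inv (a * b′))    ≡⟨ cong inv (trans (inv-distrib-* a≢0 b′≢0) (trans (x-y≡0⇒x≡y e) (sym (inv-distrib-* b≢0 a′≢0)))) ⟩
      inv (inv (b * a′))    ≡⟨ inv-involutive (*-≢0 b≢0 a′≢0) ⟩
      b * a′                ∎)
      where
      a a′ b b′ : Carrier
      a  = ℓ c (G z)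
      b  = ℓ c′ (G z)
      a′ = ℓ c (G z′)
      b′ = ℓ c′ (G z′)
      a≢0 : a ≢ 0#
      a≢0 = ℓ-off c off
      b≢0 : b ≢ 0#
      b≢0 = ℓ-off c′ off
      a′≢0 : a′ ≢ 0#
      a′≢0 = ℓ-off c off′
      b′≢0 : b′ ≢ 0#
      b′≢0 = ℓ-off c′ off′

  -- The hypothesis of the theorem, read as a relation between the coordinates of
  -- d points outside the chosen basis; it must be reindexed since the subarc
  -- has to list the basis first, then the d points, then n others.
  module CoordinateRelation {d n : ℕ}
    (hyp : ∀ (G : Family (2 ℕ.+ d) ((2 ℕ.+ d) ℕ.+ (d ℕ.+ n))) → IsArc G → vInColSpaceH G n)
    (room : (2 ℕ.+ d) ℕ.+ (d ℕ.+ n) ≤ suc q)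
    (G : Family (2 ℕ.+ d) (suc q)) (sp : Spanning G) (κ : Fin (2 ℕ.+ d) → Fin (suc q)) (κ-inj : Inj κ) where
    open Coordinates G sp κ κ-inj

    coordinate-relation : (y : Fin d → Fin (suc q)) → Inj y → Disjoint κ y → ∑ (λ c → coefficient c * ∏ (λ i → ζ c (y i))) ≡ 0#
    coordinate-relation y y-inj κ#y = trans (∑-cong {2 ℕ.+ d} {λ c → coefficient c * ∏ (λ i → ζ c (y i))} {summand} summand≡) R.relation
      where
      M m : ℕ
      M = d ℕ.+ n
      m = suc q ℕ.∸ ((2 ℕ.+ d) ℕ.+ M)
      full : (2 ℕ.+ d) ℕ.+ M ℕ.+ m ≡ suc q
      full = ℕP.m+[n∸m]≡n room

      κy-inj : Inj (κ VF.++ y)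
      κy-inj = ++-injective κ-inj y-inj κ#y
      -- The n points r may be chosen freely outside κ and y, because their factors have already
      -- cancelled in `R.relation`.
      ext₁ = extend n (κ VF.++ y) κy-inj (ℕP.≤-trans (ℕP.≤-reflexive (ℕP.+-assoc (2 ℕ.+ d) d n)) room)
      r : Fin n → Fin (suc q)
      r = proj₁ ext₁
      κ#r : Disjoint κ r
      κ#r i j e = proj₂ (proj₂ ext₁) (i ↑ˡ d) j (trans (VFP.lookup-++ˡ κ y i) e)
      y#r : Disjoint y r
      y#r i j e = proj₂ (proj₂ ext₁) ((2 ℕ.+ d) ↑ʳ i) j (trans (VFP.lookup-++ʳ κ y i) e)
      first : Fin ((2 ℕ.+ d) ℕ.+ M) → Fin (suc q)
      first = κ VF.++ (y VF.++ r)
      first-inj : Inj first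
      first-inj = ++-injective κ-inj (++-injective y-inj (proj₁ (proj₂ ext₁)) y#r) (Disjoint-++ʳ κ#y κ#r)
      ext₂ = extend m first first-inj (ℕP.≤-reflexive full)
      ι : Fin ((2 ℕ.+ d) ℕ.+ M ℕ.+ m) → Fin (suc q)
      ι = first VF.++ proj₁ ext₂
      ι-inj : Inj ι
      ι-inj = ++-injective first-inj (proj₁ (proj₂ ext₂)) (proj₂ (proj₂ ext₂))

      module R = Relation hyp (G ∘ ι) (spanning-∘ G ι ι-inj sp) full

      ι-κ : ∀ (i : Fin (2 ℕ.+ d)) → ι ((i ↑ˡ M) ↑ˡ m) ≡ κ i
      ι-κ i = trans (VFP.lookup-++ˡ first (proj₁ ext₂) (i ↑ˡ M)) (VFP.lookup-++ˡ κ (y VF.++ r) i)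
      ι-y : ∀ (i : Fin d) → ι (((2 ℕ.+ d) ↑ʳ (i ↑ˡ n)) ↑ˡ m) ≡ y i
      ι-y i = trans (VFP.lookup-++ˡ first (proj₁ ext₂) ((2 ℕ.+ d) ↑ʳ (i ↑ˡ n))) (trans (VFP.lookup-++ʳ κ (y VF.++ r) (i ↑ˡ n)) (VFP.lookup-++ˡ y r i))

      minor≡ℓ : ∀ c v → R.minor c v ≡ ℓ c v
      minor≡ℓ c v = trans (R.minor≡det c v) (trans (cong (λ w → det (v ∷ w)) (trans (sub-▹ M (G ∘ ι ∘ (_↑ˡ m)) (skip c)) (ListP.map-cong (λ i → cong G (ι-κ i)) (members (skip c)))))
        (sym (ℓ≡det c v)))

      summand : Fin (2 ℕ.+ d) → Carrier
      summand c = ∏ (λ g → inv (R.minor c (G (ι g)))) *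
        (∏ (λ (i : Fin (2 ℕ.+ d)) → inv (R.minor c (G (ι ((i ↑ˡ M) ↑ˡ m))))) * ∏ (λ (i : Fin d) → inv (R.minor c (G (ι (((2 ℕ.+ d) ↑ʳ (i ↑ˡ n)) ↑ˡ m))))))

      summand≡ : ∀ c → coefficient c * ∏ (λ i → ζ c (y i)) ≡ summand c
      summand≡ c = trans (*-assoc (∏ (ζ c)) (∏ (λ i → ζ c (κ i))) (∏ (λ i → ζ c (y i)))) (cong₂ _*_ all (cong₂ _*_
        (∏-cong {2 ℕ.+ d} (λ i → cong inv (trans (cong (λ g → ℓ c (G g)) (sym (ι-κ i))) (sym (minor≡ℓ c (G (ι ((i ↑ˡ M) ↑ˡ m))))))))
        (∏-cong {d} (λ i → cong inv (trans (cong (λ g → ℓ c (G g)) (sym (ι-y i))) (sym (minor≡ℓ c (G (ι (((2 ℕ.+ d) ↑ʳ (i ↑ˡ n)) ↑ˡ m))))))))))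
        where
        perm : Σ (Permutation ((2 ℕ.+ d) ℕ.+ M ℕ.+ m) (suc q)) λ π → ∀ i → π ⟨$⟩ʳ i ≡ ι i
        perm = injective⇒permutation full ι ι-inj
        all : ∏ (ζ c) ≡ ∏ (λ g → inv (R.minor c (G (ι g))))
        all = trans (∏-permute (ζ c) (proj₁ perm)) (∏-cong (λ g → cong inv (trans (cong (λ g → ℓ c (G g)) (proj₂ perm g)) (sym (minor≡ℓ c (G (ι g)))))))

-- The inverted coordinates lie in a plane

module InvertedCoordinates {q : ℕ} (F : FiniteField q) where

  open FieldArithmetic F
  open ProjectiveLine F
  open Determinants F
  open SpanningFamilies F
  open SubsetSums F
  open KernelVector F
  open ColexOrder F
  open ColumnSpace F
  open ArcCoordinates F

  module Collinearity {d n : ℕ}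
    (hyp : ∀ (G : Family (2 ℕ.+ d) ((2 ℕ.+ d) ℕ.+ (d ℕ.+ n))) → IsArc G → vInColSpaceH G n)
    (room : (2 ℕ.+ d) ℕ.+ (d ℕ.+ n) ≤ suc q) (room₃ : (2 ℕ.+ d) ℕ.+ 3 ℕ.+ d ≤ suc q)
    (G : Family (2 ℕ.+ d) (suc q)) (sp : Spanning G) (κ : Fin (2 ℕ.+ d) → Fin (suc q)) (κ-inj : Inj κ) where
    open Coordinates G sp κ κ-inj
    open CoordinateRelation hyp room G sp κ κ-inj

    ζ₀₁ : Fin (suc q) → Fin (suc q) → Carrier
    ζ₀₁ z z′ = ζ zero z * ζ (suc zero) z′ + - (ζ (suc zero) z * ζ zero z′)

    module Triple (z₁ z₂ z₃ : Fin (suc q)) (off₁ : Off z₁) (off₂ : Off z₂) (off₃ : Off z₃)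
      (z₁≢z₂ : z₁ ≢ z₂) (z₁≢z₃ : z₁ ≢ z₃) (z₂≢z₃ : z₂ ≢ z₃) where

      zs : Fin 3 → Fin (suc q)
      zs = z₁ VF.∷ z₂ VF.∷ z₃ VF.∷ VF.[]

      off : ∀ t → Off (zs t)
      off zero             = off₁
      off (suc zero)       = off₂
      off (suc (suc zero)) = off₃

      zs-inj : Inj zs
      zs-inj = ∷-injective {2} (∷-injective {1} (∷-injective {0} (λ { {()} }) (λ ())) (λ { zero e → z₂≢z₃ (sym e) }))
        (λ { zero e → z₁≢z₂ (sym e) ; (suc zero) e → z₁≢z₃ (sym e) })

      aux : Σ (Fin d → Fin (suc q)) λ W → Inj W × Disjoint (κ VF.++ zs) W
      -- The room for d + 2 basis points, the three points z and d auxiliary points: 2k + 1 in all.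
      aux = extend d (κ VF.++ zs) (++-injective κ-inj zs-inj (λ i t → off t i)) room₃

      W : Fin d → Fin (suc q)
      W = proj₁ aux

      W-inj : Inj W
      W-inj = proj₁ (proj₂ aux)

      κ#W : Disjoint κ W
      κ#W i j e = proj₂ (proj₂ aux) (i ↑ˡ 3) j (trans (VFP.lookup-++ˡ κ zs i) e)

      zs#W : Disjoint zs W
      zs#W t j e = proj₂ (proj₂ aux) ((2 ℕ.+ d) ↑ʳ t) j (trans (VFP.lookup-++ʳ κ zs t) e)

      b : Fin (2 ℕ.+ d) → Carrier
      b c = coefficient c * ∏ (λ i → ζ c (W i))

      b≢0 : ∀ c → b c ≢ 0#
      b≢0 c = *-≢0 (coefficient≢0 c) (∏-≢0 (λ i → ζ c (W i)) (λ i → inv≢0 (ℓ c (G (W i)))))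

      -- The relation with W x exchanged for z is a linear equation for the
      -- inverted coordinates of z, whose coefficients are those of W x.
      exchanged : ∀ x t → ∑ (λ c → (b c * ζ c (zs t)) * ℓ c (G (W x))) ≡ 0#
      exchanged x t = trans (∑-cong {2 ℕ.+ d} {λ c → (b c * ζ c (zs t)) * ℓ c (G (W x))} {λ c → coefficient c * ∏ (λ i → ζ c (y i))} summand)
        (coordinate-relation y y-inj κ#y)
        where
        z : Fin (suc q)
        z = zs t
        y : Fin d → Fin (suc q)
        y i = if does (i FinP.≟ x) then z else W i
        y-inj : Inj y
        y-inj {i} {j} e with i FinP.≟ x | j FinP.≟ x
        ... | yes a | yes b = trans a (sym b)
        ... | yes _ | no _  = contradiction e (zs#W t j)
        ... | no _  | yes _ = contradiction (sym e) (zs#W t i)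
        ... | no _  | no _  = W-inj e
        κ#y : Disjoint κ y
        κ#y i j with j FinP.≟ x
        ... | yes _ = off t i
        ... | no _  = κ#W i j
        summand : ∀ c → (b c * ζ c z) * ℓ c (G (W x)) ≡ coefficient c * ∏ (λ i → ζ c (y i))
        summand c = begin
          (b c * ζ c z) * l                                    ≡⟨ solve 4 (λ k p z l → ((k :* p) :* z) :* l := k :* (p :* (l :* z))) refl (coefficient c) (∏ (λ i → ζ c (W i))) (ζ c z) l ⟩
          coefficient c * (∏ (λ i → ζ c (W i)) * (l * ζ c z))  ≡⟨ cong (λ w → coefficient c * (∏ (λ i → ζ c (W i)) * w)) (sym ∏s) ⟩
          coefficient c * (∏ (λ i → ζ c (W i)) * ∏ s)          ≡⟨ cong (coefficient c *_) (sym (∏-* (λ i → ζ c (W i)) s)) ⟩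
          coefficient c * ∏ (λ i → ζ c (W i) * s i)            ≡⟨ cong (coefficient c *_) (∏-cong pointwise) ⟩
          coefficient c * ∏ (λ i → ζ c (y i))                  ∎
          where
          l : Carrier
          l = ℓ c (G (W x))
          s : Fin d → Carrier
          -- The factor l * ζ c z trades ζ c (W x), whose inverse is l, for ζ c z.
          s i = if does (i FinP.≟ x) then l * ζ c z else 1#
          ∏s : ∏ s ≡ l * ζ c z
          ∏s = trans (∏-single x {s} (λ j ne → if-no (j FinP.≟ x) ne)) (if-yes (x FinP.≟ x) refl)
          pointwise : ∀ i → ζ c (W i) * s i ≡ ζ c (y i)
          pointwise i with i FinP.≟ x
          ... | no _     = *-identityʳ _
          ... | yes refl = trans (sym (*-assoc (ζ c (W i)) l (ζ c z))) (trans (cong (_* ζ c z) (inv-* (ℓ-off c (λ j → κ#W j x)))) (*-identityˡ _))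

      -- Cofactors: `η c` is the 3×3 minor on the rows zero, suc zero and c of the matrix of
      -- inverted coordinates of z₁, z₂ and z₃. Hence η vanishes identically at zero and at suc
      -- zero, and its vanishing everywhere puts the three vectors in a plane.
      λ₁ λ₂ λ₃ : Carrier
      λ₁ = ζ₀₁ z₂ z₃
      λ₂ = - ζ₀₁ z₁ z₃
      λ₃ = ζ₀₁ z₁ z₂

      η : Fin (2 ℕ.+ d) → Carrier
      η c = (λ₁ * ζ c z₁ + λ₂ * ζ c z₂) + λ₃ * ζ c z₃

      η-zero : η zero ≡ 0#
      η-zero = solve 6 (λ a₁ a₂ a₃ b₁ b₂ b₃ →
        ((a₂ :* b₃ :+ :- (b₂ :* a₃)) :* a₁ :+ (:- (a₁ :* b₃ :+ :- (b₁ :* a₃))) :* a₂) :+ (a₁ :* b₂ :+ :- (b₁ :* a₂)) :* a₃ := :0) refl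
        (ζ zero z₁) (ζ zero z₂) (ζ zero z₃) (ζ (suc zero) z₁) (ζ (suc zero) z₂) (ζ (suc zero) z₃)

      η-one : η (suc zero) ≡ 0#
      η-one = solve 6 (λ a₁ a₂ a₃ b₁ b₂ b₃ →
        ((a₂ :* b₃ :+ :- (b₂ :* a₃)) :* b₁ :+ (:- (a₁ :* b₃ :+ :- (b₁ :* a₃))) :* b₂) :+ (a₁ :* b₂ :+ :- (b₁ :* a₂)) :* b₃ := :0) refl
        (ζ zero z₁) (ζ zero z₂) (ζ zero z₃) (ζ (suc zero) z₁) (ζ (suc zero) z₂) (ζ (suc zero) z₃)

      Λ : Vect (2 ℕ.+ d) → Carrier
      Λ v = ∑ (λ c → (b c * η c) * ℓ c v)

      Λ-κ : ∀ c → Λ (G (κ c)) ≡ (b c * η c) * ℓ c (G (κ c))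
      Λ-κ c = ∑-single c {λ c′ → (b c′ * η c′) * ℓ c′ (G (κ c))} (λ c′ ne → trans (cong ((b c′ * η c′) *_) (ℓ-κ≢ (ne ∘ sym))) (zeroʳ (b c′ * η c′)))

      Λ-W : ∀ x → Λ (G (W x)) ≡ 0#
      Λ-W x = begin
        ∑ (λ c → (b c * η c) * ℓ c (G (W x)))
          ≡⟨ ∑-cong {2 ℕ.+ d} {λ c → (b c * η c) * ℓ c (G (W x))} {λ c → (λ₁ * S zero c + λ₂ * S (suc zero) c) + λ₃ * S (suc (suc zero)) c}
               (λ c → solve 8 (λ b l p q r x y z → (b :* ((p :* x :+ q :* y) :+ r :* z)) :* l := (p :* ((b :* x) :* l) :+ q :* ((b :* y) :* l)) :+ r :* ((b :* z) :* l)) refl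
                 (b c) (ℓ c (G (W x))) λ₁ λ₂ λ₃ (ζ c z₁) (ζ c z₂) (ζ c z₃)) ⟩
        ∑ (λ c → (λ₁ * S zero c + λ₂ * S (suc zero) c) + λ₃ * S (suc (suc zero)) c)
          ≡⟨ ∑-+ (λ c → λ₁ * S zero c + λ₂ * S (suc zero) c) (λ c → λ₃ * S (suc (suc zero)) c) ⟩
        ∑ (λ c → λ₁ * S zero c + λ₂ * S (suc zero) c) + ∑ (λ c → λ₃ * S (suc (suc zero)) c)
          ≡⟨ cong (_+ ∑ (λ c → λ₃ * S (suc (suc zero)) c)) (∑-+ (λ c → λ₁ * S zero c) (λ c → λ₂ * S (suc zero) c)) ⟩
        (∑ (λ c → λ₁ * S zero c) + ∑ (λ c → λ₂ * S (suc zero) c)) + ∑ (λ c → λ₃ * S (suc (suc zero)) c)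
          ≡⟨ cong₂ _+_ (cong₂ _+_ (scaled λ₁ zero) (scaled λ₂ (suc zero))) (scaled λ₃ (suc (suc zero))) ⟩
        (0# + 0#) + 0#
          ≡⟨ trans (+-identityʳ (0# + 0#)) (+-identityʳ 0#) ⟩
        0# ∎
        where
        S : Fin 3 → Fin (2 ℕ.+ d) → Carrier
        S t c = (b c * ζ c (zs t)) * ℓ c (G (W x))
        scaled : ∀ l t → ∑ (λ c → l * S t c) ≡ 0#
        scaled l t = trans (sym (*-∑ l (S t))) (trans (cong (l *_) (exchanged x t)) (zeroʳ l))

      -- Λ vanishes on W by the exchanged relations and at κ zero and κ (suc zero) by the choice of
      -- the λ's. These k points span, so Λ vanishes at κ c too, where only the summand of c
      -- survives and its other factors are nonzero.
      η≡0 : ∀ c → η c ≡ 0#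
      η≡0 c = x*y≡0⇒y≡0 (b≢0 c) (x*y≡0⇒y≡0 (ℓ-κ c) (trans (*-comm (ℓ c (G (κ c))) (b c * η c)) (trans (sym (Λ-κ c))
        (spanning-tuple G sp f f-inj {Λ} (Linear-∑ (λ c → Linear-* (b c * η c) (ℓ-linear c))) vanish (G (κ c))))))
        where
        f : Fin (2 ℕ.+ d) → Fin (suc q)
        f = κ zero VF.∷ κ (suc zero) VF.∷ W
        f-inj : Inj f
        f-inj = ∷-injective (∷-injective W-inj (λ j e → κ#W (suc zero) j (sym e)))
          (λ { zero e → contradiction (κ-inj e) (λ ()) ; (suc j) e → κ#W zero j (sym e) })
        null : ∀ c → η c ≡ 0# → Λ (G (κ c)) ≡ 0#
        null c e = trans (Λ-κ c) (trans (cong (λ w → (b c * w) * ℓ c (G (κ c))) e)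
          (solve 2 (λ b l → (b :* :0) :* l := :0) refl (b c) (ℓ c (G (κ c)))))
        vanish : ∀ i → Λ (G (f i)) ≡ 0#
        vanish zero          = null zero η-zero
        vanish (suc zero)    = null (suc zero) η-one
        vanish (suc (suc j)) = Λ-W j

-- The normal rational curve, and reduction of matrices by row operations

module RationalCurve {q : ℕ} (F : FiniteField q) where

  open FieldArithmetic F
  open ProjectiveLine F
  open Determinants F
  open SpanningFamilies F
  open SubsetSums F
  open KernelVector F
  open ColexOrder F
  open ColumnSpace F
  open ArcCoordinates F

  pow-1 : ∀ n → pow 1# n ≡ 1#
  pow-1 zero    = refl
  pow-1 (suc n) = trans (*-identityˡ _) (pow-1 n)

  pow-* : ∀ x y n → pow (x * y) n ≡ pow x n * pow y n
  pow-* x y zero    = sym (*-identityˡ 1#)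
  pow-* x y (suc n) = trans (cong (x * y *_) (pow-* x y n)) (solve 4 (λ a b c d → a :* b :* (c :* d) := a :* c :* (b :* d)) refl x y (pow x n) (pow y n))

  mono : ℕ → ℕ → V2 → Carrier
  mono K j (s , t) = pow s (K ℕ.∸ j) * pow t j

  -- s = [ (0,-1) , (s,t) ] and t = [ (1,0) , (s,t) ]
  monoForms : ℕ → ℕ → List V2
  monoForms K j = List.replicate (K ℕ.∸ j) (0# , - 1#) List.++ List.replicate j (1# , 0#)

  length-monoForms : ∀ {K j} → j ≤ K → length (monoForms K j) ≡ K
  length-monoForms {K} {j} le = trans (ListP.length-++ (List.replicate (K ℕ.∸ j) (0# , - 1#)))
    (trans (cong₂ ℕ._+_ (ListP.length-replicate (K ℕ.∸ j)) (ListP.length-replicate j)) (ℕP.m∸n+n≡m le))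

  brs-monoForms : ∀ K j p → brs (monoForms K j) p ≡ mono K j p
  brs-monoForms K j (s , t) = go (K ℕ.∸ j)
    where
    ts : ∀ j → brs (List.replicate j (1# , 0#)) (s , t) ≡ pow t j
    ts zero    = refl
    ts (suc j) = cong₂ _*_ (solve 2 (λ s t → :1 :* t :+ :- (:0 :* s) := t) refl s t) (ts j)
    go : ∀ m → brs (List.replicate m (0# , - 1#) List.++ List.replicate j (1# , 0#)) (s , t) ≡ pow s m * pow t j
    go zero    = trans (ts j) (sym (*-identityˡ _))
    go (suc m) = trans (cong₂ _*_ (solve 2 (λ s t → :0 :* t :+ :- ((:- :1) :* s) := s) refl s t) (go m)) (sym (*-assoc s (pow s m) (pow t j)))

  -- Products of K linear forms are combinations of the monomials of degree K.
  moments : ∀ K {n} (c : Fin n → Carrier) (p : Fin n → V2) → (∀ j → j ≤ K → ∑ (λ i → c i * mono K j (p i)) ≡ 0#) →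
    ∀ T → length T ≡ K → ∑ (λ i → c i * brs T (p i)) ≡ 0#
  moments zero c p h [] refl = trans (∑-cong (λ i → cong (c i *_) (sym (*-identityˡ 1#)))) (h 0 ℕ.z≤n)
  moments (suc K) c p h ((x , y) ∷ T) eq = begin
    ∑ (λ i → c i * ((x * t i + - (y * s i)) * brs T (p i)))
      ≡⟨ ∑-cong (λ i → solve 6 (λ c x y s t b → c :* ((x :* t :+ :- (y :* s)) :* b) := x :* ((c :* t) :* b) :+ (:- y) :* ((c :* s) :* b)) refl
           (c i) x y (s i) (t i) (brs T (p i))) ⟩
    ∑ (λ i → x * ((c i * t i) * brs T (p i)) + (- y) * ((c i * s i) * brs T (p i)))
      ≡⟨ ∑-+ (λ i → x * ((c i * t i) * brs T (p i))) (λ i → (- y) * ((c i * s i) * brs T (p i))) ⟩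
    ∑ (λ i → x * ((c i * t i) * brs T (p i))) + ∑ (λ i → (- y) * ((c i * s i) * brs T (p i)))
      ≡⟨ sym (cong₂ _+_ (*-∑ x (λ i → (c i * t i) * brs T (p i))) (*-∑ (- y) (λ i → (c i * s i) * brs T (p i)))) ⟩
    x * ∑ (λ i → (c i * t i) * brs T (p i)) + (- y) * ∑ (λ i → (c i * s i) * brs T (p i))
      ≡⟨ cong₂ (λ a b → x * a + (- y) * b) (moments K (λ i → c i * t i) p ht T (ℕP.suc-injective eq)) (moments K (λ i → c i * s i) p hs T (ℕP.suc-injective eq)) ⟩
    x * 0# + (- y) * 0#
      ≡⟨ solve 2 (λ x y → x :* :0 :+ (:- y) :* :0 := :0) refl x y ⟩
    0# ∎
    where
    s t : Fin _ → Carrier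
    s i = proj₁ (p i)
    t i = proj₂ (p i)
    ht : ∀ j → j ≤ K → ∑ (λ i → (c i * t i) * mono K j (p i)) ≡ 0#
    ht j le = trans (∑-cong (λ i → solve 4 (λ c t a b → (c :* t) :* (a :* b) := c :* (a :* (t :* b))) refl (c i) (t i) (pow (s i) (K ℕ.∸ j)) (pow (t i) j)))
      (h (suc j) (ℕ.s≤s le))
    hs : ∀ j → j ≤ K → ∑ (λ i → (c i * s i) * mono K j (p i)) ≡ 0#
    hs j le = trans (∑-cong (λ i → trans (solve 4 (λ c s a b → (c :* s) :* (a :* b) := c :* ((s :* a) :* b)) refl (c i) (s i) (pow (s i) (K ℕ.∸ j)) (pow (t i) j))
      (cong (λ e → c i * (pow (s i) e * pow (t i) j)) (sym (ℕP.+-∸-assoc 1 le))))) (h j (ℕP.m≤n⇒m≤1+n le))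

  brs-tabulate : ∀ {n} (p : Fin n → V2) v → brs (List.tabulate p) v ≡ ∏ (λ i → br (p i) v)
  brs-tabulate {zero}  p v = refl
  brs-tabulate {suc n} p v = cong (br (p zero) v *_) (brs-tabulate (p ∘ suc) v)

  ∏-zero : ∀ {n} (f : Fin n → Carrier) i → f i ≡ 0# → ∏ f ≡ 0#
  ∏-zero {suc n} f i z = trans (∏-remove i f) (trans (cong (_* ∏ (f ∘ punchIn i)) z) (zeroˡ _))

  -- A homogeneous Vandermonde argument: pairing with the product of the K linear forms that vanish
  -- at the other points isolates c i.
  moments-independent : ∀ {K} (c : Fin (suc K) → Carrier) (p : Fin (suc K) → V2) → PairwiseIndependent p →
    (∀ j → j ≤ K → ∑ (λ i → c i * mono K j (p i)) ≡ 0#) → ∀ i → c i ≡ 0#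
  moments-independent {K} c p ind h i = x*y≡0⇒y≡0 (subst (_≢ 0#) (sym (brs-tabulate (p ∘ punchIn i) (p i))) (∏-≢0 _ (λ m → ind (FinP.punchInᵢ≢i i m))))
    (trans (*-comm _ _) (trans (sym (∑-single i {λ l → c l * brs T (p l)} off)) (moments K c p h T (ListP.length-tabulate (p ∘ punchIn i)))))
    where
    T : List V2
    T = List.tabulate (p ∘ punchIn i)
    off : ∀ l → l ≢ i → c l * brs T (p l) ≡ 0#
    off l ne = trans (cong (c l *_) (trans (brs-tabulate (p ∘ punchIn i) (p l)) (∏-zero (λ m → br (p (punchIn i m)) (p l)) (punchOut (ne ∘ sym))
      (trans (cong (λ w → br (p w) (p l)) (FinP.punchIn-punchOut (ne ∘ sym))) (br-self (p l)))))) (zeroʳ (c l))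

  NRC≡mono : ∀ K i (j : Fin (suc K)) → NRC (suc K) i j ≡ mono K (toℕ j) (point i)
  NRC≡mono K i j with toℕ i ℕ.<? q
  ... | yes i<q = sym (trans (cong (_* pow _ (toℕ j)) (pow-1 (K ℕ.∸ toℕ j))) (*-identityˡ _))
  ... | no _    = trans (last K (toℕ j) (ℕP.≤-pred (FinP.toℕ<n j))) (sym (trans (cong (pow 0# (K ℕ.∸ toℕ j) *_) (pow-1 (toℕ j))) (*-identityʳ _)))
    where
    -- `pow 0# 0` is `1#`, so at the point (0 , 1) only the monomial with j = K is nonzero, as in
    -- the last vector of `NRC`.
    last : ∀ K j → j ≤ K → (if j ℕ.≡ᵇ K then 1# else 0#) ≡ pow 0# (K ℕ.∸ j)
    last zero    zero    _          = refl
    last (suc K) zero    _          = sym (zeroˡ _)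
    last (suc K) (suc j) (ℕ.s≤s le) = last K j le

  scaled-independent : ∀ {K N} (G : Family (suc K) N) (ν : Fin N → Carrier) (p : Fin N → V2) → (∀ g → ν g ≢ 0#) → PairwiseIndependent p →
    (∀ g j → G g j ≡ ν g * mono K (toℕ j) (p g)) → (f : Fin (suc K) → Fin N) → Inj f → LinearlyIndependent (G ∘ f)
  scaled-independent {K} G ν p ν≢0 ind form f inj c zeros i = x*y≡0⇒y≡0 (ν≢0 (f i)) (trans (*-comm _ _)
    (moments-independent (λ i → c i * ν (f i)) (p ∘ f) (λ ne → ind (ne ∘ inj)) h i))
    where
    h : ∀ j → j ≤ K → ∑ (λ i → (c i * ν (f i)) * mono K j (p (f i))) ≡ 0#
    h j le = trans (∑-cong (λ i → trans (*-assoc (c i) (ν (f i)) _) (cong (c i *_) (sym (trans (form (f i) j′) (cong (λ e → ν (f i) * mono K e (p (f i))) (FinP.toℕ-fromℕ< (ℕ.s≤s le)))))))) (zeros j′)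
      where
      j′ : Fin (suc K)
      j′ = Fin.fromℕ< (ℕ.s≤s le)

  NRC-spanning : ∀ K → Spanning (NRC (suc K))
  NRC-spanning K xs u len {Λ} lin zeros v = go (List.lookup xs) len (lookup-injective u) (λ i → zeros _ (∈P.∈-lookup i))
    where
    form : ∀ i (j : Fin (suc K)) → NRC (suc K) i j ≡ 1# * mono K (toℕ j) (point i)
    form i j = trans (NRC≡mono K i j) (sym (*-identityˡ _))
    go : ∀ {n} (f : Fin n → Fin (suc q)) → n ≡ suc K → Inj f → (∀ i → Λ (NRC (suc K) (f i)) ≡ 0#) → Λ v ≡ 0#
    go f refl inj z = trans (Linear-cong lin (λ j → sym (proj₁ (proj₂ basis) j))) (trans (Linear-comb lin (proj₁ basis) (NRC (suc K) ∘ f))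
      (∑-zero (λ i → trans (cong (proj₁ basis i *_) (z i)) (zeroʳ _))))
      where
      basis : UniqueCoordinates (NRC (suc K) ∘ f) v
      basis = independent⇒basis (NRC (suc K) ∘ f) (scaled-independent (NRC (suc K)) (λ _ → 1#) point (λ _ → 1≢0) point-independent form f inj) v

  NRC-arc : ∀ K → K ≤ q → IsArc (NRC (suc K))
  NRC-arc K le = spanning⇒arc (NRC (suc K)) (ℕ.s≤s le) (NRC-spanning K)

  -- Row reduction

  Relations⊆ : ∀ {k N} → Mat k N → Mat k N → Set
  Relations⊆ {k} {N} M M′ = ∀ (x : Fin N → Carrier) → (∀ r → ∑ (λ g → x g * M r g) ≡ 0#) → ∀ r → ∑ (λ g → x g * M′ r g) ≡ 0#

  -- The final chain descends from G to the common reduced form and climbs back to the second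
  -- family, so steps are recorded in both directions. The linear relations between columns are the
  -- invariant that identifies the reduced form.
  record RowEquivalent {k N} (M M′ : Mat k N) : Set where
    constructor rowEquivalent
    field
      forward  : Star Step M M′
      backward : Star Step M′ M
      relations  : Relations⊆ M M′
      relations⁻ : Relations⊆ M′ M

  open RowEquivalent

  infixr 5 _▸_
  _▸_ : ∀ {k N} {M M′ M″ : Mat k N} → RowEquivalent M M′ → RowEquivalent M′ M″ → RowEquivalent M M″
  e ▸ e′ = rowEquivalent (forward e ◅◅ forward e′) (backward e′ ◅◅ backward e)
    (λ x h → relations e′ x (relations e x h)) (λ x h → relations⁻ e x (relations⁻ e′ x h))

  ∑-combine : ∀ {N} (x m m′ : Fin N → Carrier) a b → ∑ (λ g → x g * m g) ≡ 0# → ∑ (λ g → x g * m′ g) ≡ 0# → ∑ (λ g → x g * (a * m g + b * m′ g)) ≡ 0#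
  ∑-combine x m m′ a b e e′ = begin
    ∑ (λ g → x g * (a * m g + b * m′ g))                         ≡⟨ ∑-cong (λ g → solve 5 (λ x m n a b → x :* (a :* m :+ b :* n) := a :* (x :* m) :+ b :* (x :* n)) refl (x g) (m g) (m′ g) a b) ⟩
    ∑ (λ g → a * (x g * m g) + b * (x g * m′ g))                 ≡⟨ ∑-+ (λ g → a * (x g * m g)) (λ g → b * (x g * m′ g)) ⟩
    ∑ (λ g → a * (x g * m g)) + ∑ (λ g → b * (x g * m′ g))       ≡⟨ sym (cong₂ _+_ (*-∑ a (λ g → x g * m g)) (*-∑ b (λ g → x g * m′ g))) ⟩
    a * ∑ (λ g → x g * m g) + b * ∑ (λ g → x g * m′ g)           ≡⟨ cong₂ (λ u v → a * u + b * v) e e′ ⟩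
    a * 0# + b * 0#                                              ≡⟨ solve 2 (λ a b → a :* :0 :+ b :* :0 := :0) refl a b ⟩
    0#                                                           ∎

  RowCombination : ∀ {k N} → Mat k N → (Fin N → Carrier) → Set
  RowCombination M m = ∃ λ i → ∃ λ j → ∃ λ a → ∃ λ b → ∀ g → m g ≡ a * M i g + b * M j g

  row-combinations : ∀ {k N} {M M′ : Mat k N} → (∀ r → RowCombination M (M′ r)) → Relations⊆ M M′
  row-combinations {M = M} h x zero-M r with h r
  ... | i , j , a , b , e = trans (∑-cong (λ g → cong (x g *_) (e g))) (∑-combine x (M i) (M j) a b (zero-M i) (zero-M j))

  multiple : ∀ {k N} (M : Mat k N) i c {m : Fin N → Carrier} → (∀ g → m g ≡ c * M i g) → RowCombination M m
  multiple M i c e = i , i , c , 0# , λ g → trans (e g) (solve 2 (λ c x → c :* x := c :* x :+ :0 :* x) refl c (M i g))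

  same : ∀ {k N} (M : Mat k N) i {m : Fin N → Carrier} → (∀ g → m g ≡ M i g) → RowCombination M m
  same M i e = multiple M i 1# (λ g → trans (e g) (sym (*-identityˡ _)))

  -- Matrices are functions, so pointwise equality does not give an equation between them; the
  -- identity column permutation serves as the connecting step.
  ≗⇒RowEquivalent : ∀ {k N} {M M′ : Mat k N} → (∀ r g → M′ r g ≡ M r g) → RowEquivalent M M′
  ≗⇒RowEquivalent {M = M} {M′} e = rowEquivalent (colPerm Perm.id e ◅ ε) (colPerm Perm.id (λ r g → sym (e r g)) ◅ ε)
    (row-combinations (λ r → same M r (e r))) (row-combinations (λ r → same M′ r (λ g → sym (e r g))))

  swapIdx-involutive : ∀ {k} (i j r : Fin k) → swapIdx i j (swapIdx i j r) ≡ r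
  swapIdx-involutive i j r with r FinP.≟ i
  ... | yes refl with j FinP.≟ r
  ...   | yes e = e
  ...   | no _ with j FinP.≟ j
  ...     | yes _ = refl
  ...     | no n  = contradiction refl n
  swapIdx-involutive i j r | no r≢i with r FinP.≟ j
  ... | yes refl with i FinP.≟ i
  ...   | yes _ = refl
  ...   | no n  = contradiction refl n
  swapIdx-involutive i j r | no r≢i | no r≢j with r FinP.≟ i
  ...   | yes e = contradiction e r≢i
  ...   | no _ with r FinP.≟ j
  ...     | yes e = contradiction e r≢j
  ...     | no _ = refl

  swap-rows : ∀ {k N} (M : Mat k N) i j → RowEquivalent M (λ r g → M (swapIdx i j r) g)
  swap-rows {k} {N} M i j = rowEquivalent (rowSwap i j (λ r g → refl) ◅ ε) (rowSwap i j back ◅ ε)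
    (row-combinations {M′ = M′} (λ r → same M (swapIdx i j r) (λ g → refl))) (row-combinations (λ r → same M′ (swapIdx i j r) (back r)))
    where
    M′ : Mat k N
    M′ r g = M (swapIdx i j r) g
    back : ∀ r g → M r g ≡ M′ (swapIdx i j r) g
    back r g = cong (λ r → M r g) (sym (swapIdx-involutive i j r))

  scale-row : ∀ {k N} (M : Mat k N) i a → a ≢ 0# → RowEquivalent M (λ r g → if does (r FinP.≟ i) then a * M r g else M r g)
  scale-row {k} {N} M i a a≢0 = rowEquivalent (rowScale i a a≢0 (λ r g → refl) ◅ ε) (rowScale i (inv a) (inv≢0 a) back ◅ ε)
    (row-combinations to) (row-combinations from)
    where
    M′ : Mat k N
    M′ r g = if does (r FinP.≟ i) then a * M r g else M r g
    undo : ∀ x → x ≡ inv a * (a * x)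
    undo x = sym (trans (sym (*-assoc (inv a) a x)) (trans (cong (_* x) (inv-* a≢0)) (*-identityˡ x)))
    back : ∀ r g → M r g ≡ (if does (r FinP.≟ i) then inv a * M′ r g else M′ r g)
    back r g with r FinP.≟ i
    ... | yes _ = undo (M r g)
    ... | no _  = refl
    to : ∀ r → RowCombination M (M′ r)
    to r with r FinP.≟ i
    ... | yes _ = multiple M r a (λ g → refl)
    ... | no _  = same M r (λ g → refl)
    from : ∀ r → RowCombination M′ (M r)
    from r = go (r FinP.≟ i)
      where
      go : Dec (r ≡ i) → RowCombination M′ (M r)
      go (yes e) = multiple M′ r (inv a) (λ g → trans (undo (M r g)) (cong (inv a *_) (sym (if-yes (r FinP.≟ i) e))))
      go (no ne) = same M′ r (λ g → sym (if-no (r FinP.≟ i) ne))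

  add-row : ∀ {k N} (M : Mat k N) {i j} → i ≢ j → ∀ a → RowEquivalent M (λ r g → if does (r FinP.≟ i) then M r g + a * M j g else M r g)
  add-row {k} {N} M {i} {j} i≢j a = rowEquivalent (rowAdd i j i≢j a (λ r g → refl) ◅ ε) (rowAdd i j i≢j (- a) back ◅ ε)
    (row-combinations to) (row-combinations from)
    where
    M′ : Mat k N
    M′ r g = if does (r FinP.≟ i) then M r g + a * M j g else M r g
    M′j : ∀ g → M′ j g ≡ M j g
    M′j g = if-no (j FinP.≟ i) (i≢j ∘ sym)
    back : ∀ r g → M r g ≡ (if does (r FinP.≟ i) then M′ r g + (- a) * M′ j g else M′ r g)
    back r g with r FinP.≟ i
    ... | yes _ = trans (solve 3 (λ x a y → x := (x :+ a :* y) :+ (:- a) :* y) refl (M r g) a (M j g)) (cong (λ w → (M r g + a * M j g) + (- a) * w) (sym (M′j g)))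
    ... | no _  = refl
    to : ∀ r → RowCombination M (M′ r)
    to r with r FinP.≟ i
    ... | yes _ = r , j , 1# , a , λ g → cong (_+ a * M j g) (sym (*-identityˡ _))
    ... | no _  = same M r (λ g → refl)
    from : ∀ r → RowCombination M′ (M r)
    from r = go (r FinP.≟ i)
      where
      go : Dec (r ≡ i) → RowCombination M′ (M r)
      go (yes e) = r , j , 1# , - a , λ g → trans (back r g) (trans (if-yes (r FinP.≟ i) e) (cong (_+ (- a) * M′ j g) (sym (*-identityˡ (M′ r g)))))
      go (no ne) = same M′ r (λ g → sym (if-no (r FinP.≟ i) ne))

  -- Columns in which the pivot row is zero are left untouched. This protects the unit vectors
  -- already produced in earlier columns.
  clear-column : ∀ {k N} (M : Mat k N) p g₀ → M p g₀ ≡ 1# → ∀ (rs : List (Fin k)) → ∃ λ M′ → RowEquivalent M M′ ×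
    (∀ g → M′ p g ≡ M p g) × (∀ r g → M p g ≡ 0# → M′ r g ≡ M r g) × (∀ r → r ∈ rs → r ≢ p → M′ r g₀ ≡ 0#)
  clear-column M p g₀ one [] = M , ≗⇒RowEquivalent (λ r g → refl) , (λ g → refl) , (λ r g _ → refl) , λ r ()
  clear-column {k} {N} M p g₀ one (i ∷ rs) with clear-column M p g₀ one rs | i FinP.≟ p
  ... | M₁ , eq , keep , other , clear | yes refl = M₁ , eq , keep , other , λ { r (here e) ne → contradiction e ne ; r (there m) ne → clear r m ne }
  ... | M₁ , eq , keep , other , clear | no i≢p = M₂ , eq ▸ add-row M₁ i≢p a , keep₂ , other₂ , clear₂
    where
    a : Carrier
    a = - M₁ i g₀
    M₂ : Mat k N
    M₂ r g = if does (r FinP.≟ i) then M₁ r g + a * M₁ p g else M₁ r g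
    keep₂ : ∀ g → M₂ p g ≡ M p g
    keep₂ g = trans (if-no (p FinP.≟ i) (i≢p ∘ sym)) (keep g)
    other₂ : ∀ r g → M p g ≡ 0# → M₂ r g ≡ M r g
    other₂ r g z with r FinP.≟ i
    ... | yes _ = trans (cong (λ w → M₁ r g + a * w) (trans (keep g) z)) (trans (cong (M₁ r g +_) (zeroʳ a)) (trans (+-identityʳ _) (other r g z)))
    ... | no _  = other r g z
    clear₂ : ∀ r → r ∈ i ∷ rs → r ≢ p → M₂ r g₀ ≡ 0#
    clear₂ r m r≢p with r FinP.≟ i
    ... | yes refl = trans (cong (λ w → M₁ i g₀ + a * w) (trans (keep g₀) one)) (solve 1 (λ x → x :+ (:- x) :* :1 := :0) refl (M₁ i g₀))
    clear₂ r (here e) r≢p  | no r≢i = contradiction e r≢i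
    clear₂ r (there m) r≢p | no r≢i = clear r m r≢p

  IndependentColumns : ∀ {k N} → Mat k N → (Fin k → Fin N) → Set
  IndependentColumns {k} M κ = ∀ (a : Fin k → Carrier) → (∀ r → ∑ (λ c → a c * M r (κ c)) ≡ 0#) → ∀ c → a c ≡ 0#

  -- Coefficients on the chosen columns are extended by zero to all columns, the form in which
  -- `Relations⊆` speaks of them.
  ∑-push : ∀ {k N} (a : Fin k → Carrier) (κ : Fin k → Fin N) (m : Fin N → Carrier) →
    ∑ (λ g → ∑ (λ c → a c * δ (κ c) g) * m g) ≡ ∑ (λ c → a c * m (κ c))
  ∑-push a κ m = begin
    ∑ (λ g → ∑ (λ c → a c * δ (κ c) g) * m g)
      ≡⟨ ∑-cong (λ g → trans (*-comm _ (m g)) (trans (*-∑ (m g) (λ c → a c * δ (κ c) g)) (∑-cong (λ c → solve 3 (λ m a d → m :* (a :* d) := a :* (d :* m)) refl (m g) (a c) (δ (κ c) g))))) ⟩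
    ∑ (λ g → ∑ (λ c → a c * (δ (κ c) g * m g)))
      ≡⟨ ∑-comm (λ g c → a c * (δ (κ c) g * m g)) ⟩
    ∑ (λ c → ∑ (λ g → a c * (δ (κ c) g * m g)))
      ≡⟨ ∑-cong (λ c → trans (sym (*-∑ (a c) (λ g → δ (κ c) g * m g))) (cong (a c *_) (∑-δˡ (κ c) m))) ⟩
    ∑ (λ c → a c * m (κ c)) ∎

  columns-preserved : ∀ {k N} {M M′ : Mat k N} (κ : Fin k → Fin N) → RowEquivalent M M′ → IndependentColumns M κ → IndependentColumns M′ κ
  columns-preserved {M = M} {M′} κ eq ind a h = ind a (λ r → trans (sym (∑-push a κ (M r)))
    (relations⁻ eq (λ g → ∑ (λ c → a c * δ (κ c) g)) (λ r → trans (∑-push a κ (M′ r)) (h r)) r))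

  gauss-jordan : ∀ {k N} (M : Mat k N) (κ : Fin k → Fin N) → IndependentColumns M κ → ∀ cs → Unique cs →
    ∃ λ M′ → RowEquivalent M M′ × (∀ r c → c ∈ cs → M′ r (κ c) ≡ δ r c)
  gauss-jordan M κ ind [] _ = M , ≗⇒RowEquivalent (λ r g → refl) , λ r c ()
  gauss-jordan {k} {N} M κ ind (c ∷ cs) (c∉ ∷ u) with gauss-jordan M κ ind cs u
  ... | M₁ , eq₁ , unit₁ = M₄ , eq₁ ▸ swap-rows M₁ p c ▸ scale-row M₂ c (inv x) (inv≢0 x) ▸ proj₁ (proj₂ cleared) , unit₄
    where
    c∉cs : c ∉ cs
    c∉cs m = All.lookup c∉ m refl

    a b : Fin k → Carrier
    b c′ = if does (c′ ∈? cs) then M₁ c′ (κ c) else 0#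
    a c′ = δ c c′ + - b c′

    abstract
      -- Without a pivot, column κ c would be supported on the rows in cs and therefore be the
      -- combination, with coefficients b, of the unit columns already reached. Then a is a relation
      -- between independent columns although a c = 1.
      pivot : ∃ λ p → p ∉ cs × M₁ p (κ c) ≢ 0#
      pivot with FinP.any? (λ p → ¬? (p ∈? cs) ×-dec ¬? (M₁ p (κ c) ≟ 0#))
      ... | yes found = found
      ... | no none = contradiction (trans (sym a-c) (columns-preserved κ eq₁ ind a relation c)) 1≢0
        where
        zero-below : ∀ r → r ∉ cs → M₁ r (κ c) ≡ 0#
        zero-below r r∉ with M₁ r (κ c) ≟ 0#
        ... | yes z = z
        ... | no n  = contradiction (r , r∉ , n) none
        a-c : a c ≡ 1#
        a-c = trans (cong₂ (λ x y → x + - y) (δ-refl c) (if-no (c ∈? cs) c∉cs)) (solve 0 (:1 :+ :- :0 := :1) refl)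
        b-sum : ∀ r → ∑ (λ c′ → b c′ * M₁ r (κ c′)) ≡ M₁ r (κ c)
        b-sum r = trans (∑-single r {λ c′ → b c′ * M₁ r (κ c′)} off) on
          where
          off : ∀ c′ → c′ ≢ r → b c′ * M₁ r (κ c′) ≡ 0#
          off c′ ne with c′ ∈? cs
          ... | yes m = trans (cong (M₁ c′ (κ c) *_) (trans (unit₁ r c′ m) (δ-≢ (ne ∘ sym)))) (zeroʳ _)
          ... | no _  = zeroˡ _
          on : b r * M₁ r (κ r) ≡ M₁ r (κ c)
          on with r ∈? cs
          ... | yes m = trans (cong (M₁ r (κ c) *_) (trans (unit₁ r r m) (δ-refl r))) (*-identityʳ _)
          ... | no n  = trans (zeroˡ _) (sym (zero-below r n))
        relation : ∀ r → ∑ (λ c′ → a c′ * M₁ r (κ c′)) ≡ 0#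
        relation r = dot-difference (δ c) b (λ c′ → M₁ r (κ c′)) (trans (∑-δˡ c (λ c′ → M₁ r (κ c′))) (sym (b-sum r)))

    p : Fin k
    p = proj₁ pivot
    x : Carrier
    x = M₁ p (κ c)
    x≢0 : x ≢ 0#
    x≢0 = proj₂ (proj₂ pivot)

    M₂ M₃ : Mat k N
    M₂ r g = M₁ (swapIdx p c r) g
    M₃ r g = if does (r FinP.≟ c) then inv x * M₂ r g else M₂ r g

    c≢ : ∀ {c′} → c′ ∈ cs → c ≢ c′
    c≢ m refl = c∉cs m

    unit₂ : ∀ r c′ → c′ ∈ cs → M₂ r (κ c′) ≡ δ r c′
    unit₂ r c′ m = trans (unit₁ (swapIdx p c r) c′ m) (fixes r)
      where
      fixes : ∀ r → δ (swapIdx p c r) c′ ≡ δ r c′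
      fixes r with r FinP.≟ p
      ... | yes refl = trans (δ-≢ (c≢ m)) (sym (δ-≢ {i = p} {c′} (λ e → proj₁ (proj₂ pivot) (subst (_∈ cs) (sym e) m))))
      ... | no _ with r FinP.≟ c
      ...   | yes refl = trans (δ-≢ {i = p} {c′} (λ e → proj₁ (proj₂ pivot) (subst (_∈ cs) (sym e) m))) (sym (δ-≢ (c≢ m)))
      ...   | no _ = refl

    unit₃ : ∀ r c′ → c′ ∈ cs → M₃ r (κ c′) ≡ δ r c′
    unit₃ r c′ m = go (r FinP.≟ c)
      where
      go : Dec (r ≡ c) → M₃ r (κ c′) ≡ δ r c′
      go (yes refl) = trans (if-yes (r FinP.≟ r) refl) (trans (cong (inv x *_) (trans (unit₂ r c′ m) (δ-≢ (c≢ m)))) (trans (zeroʳ (inv x)) (sym (δ-≢ (c≢ m)))))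
      go (no ne)    = trans (if-no (r FinP.≟ c) ne) (unit₂ r c′ m)

    one : M₃ c (κ c) ≡ 1#
    one = trans (if-yes (c FinP.≟ c) refl) (trans (cong (λ r → inv x * M₁ r (κ c)) swapped) (inv-* x≢0))
      where
      swapped : swapIdx p c c ≡ p
      swapped with c FinP.≟ p
      ... | yes e = e
      ... | no _  = if-yes (c FinP.≟ c) refl

    cleared : ∃ λ M′ → RowEquivalent M₃ M′ × (∀ g → M′ c g ≡ M₃ c g) × (∀ r g → M₃ c g ≡ 0# → M′ r g ≡ M₃ r g) × (∀ r → r ∈ List.allFin k → r ≢ c → M′ r (κ c) ≡ 0#)
    cleared = clear-column M₃ c (κ c) one (List.allFin k)

    M₄ : Mat k N
    M₄ = proj₁ cleared

    unit₄ : ∀ r c′ → c′ ∈ c ∷ cs → M₄ r (κ c′) ≡ δ r c′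
    unit₄ r c′ (there m) = trans (proj₁ (proj₂ (proj₂ (proj₂ cleared))) r (κ c′) (trans (unit₃ c c′ m) (δ-≢ (c≢ m)))) (unit₃ r c′ m)
    unit₄ r c′ (here refl) = diagonal (r FinP.≟ c)
      where
      diagonal : Dec (r ≡ c) → M₄ r (κ c) ≡ δ r c
      diagonal (yes refl) = trans (proj₁ (proj₂ (proj₂ cleared)) (κ c)) (trans one (sym (δ-refl c)))
      diagonal (no ne)    = trans (proj₂ (proj₂ (proj₂ (proj₂ cleared))) r (∈P.∈-allFin r) ne) (sym (δ-≢ ne))

  -- Row operations preserve the linear relations between columns, so both
  -- families have the same reduced form, namely their common coordinate matrix.
  same-coordinates⇒equivalent : ∀ {k N} (G H : Family k N) (κ : Fin k → Fin N) →
    LinearlyIndependent (G ∘ κ) → LinearlyIndependent (H ∘ κ) → (x : Fin N → Fin k → Carrier) →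
    (∀ g j → ∑ (λ c → x g c * G (κ c) j) ≡ G g j) → (∀ g j → ∑ (λ c → x g c * H (κ c) j) ≡ H g j) → LinEquiv G H
  same-coordinates⇒equivalent {k} {N} G H κ indG indH x eqG eqH = forward eG ◅◅ forward (≗⇒RowEquivalent MG≗MH) ◅◅ backward eH
    where
    redG : ∃ λ M′ → RowEquivalent (toMat G) M′ × (∀ r c → c ∈ List.allFin k → M′ r (κ c) ≡ δ r c)
    redG = gauss-jordan (toMat G) κ indG (List.allFin k) (UniqueP.allFin⁺ k)
    redH : ∃ λ M′ → RowEquivalent (toMat H) M′ × (∀ r c → c ∈ List.allFin k → M′ r (κ c) ≡ δ r c)
    redH = gauss-jordan (toMat H) κ indH (List.allFin k) (UniqueP.allFin⁺ k)
    eG = proj₁ (proj₂ redG)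
    eH = proj₁ (proj₂ redH)

    canonical : ∀ (G : Family k N) M′ → RowEquivalent (toMat G) M′ → (∀ r c → M′ r (κ c) ≡ δ r c) →
      (∀ g j → ∑ (λ c → x g c * G (κ c) j) ≡ G g j) → ∀ r g → M′ r g ≡ x g r
    canonical G M′ e unit eq r g = sym (x-y≡0⇒x≡y (trans (sym (expand (M′ r) (x g r) (trans (∑-cong (λ c → cong (x g c *_) (trans (unit r c) (δ-sym r c)))) (∑-δʳ r (x g)))))
      (relations e y (λ j → trans (expand (λ g → G g j) (G g j) (eq g j)) (-‿inverseʳ (G g j))) r)))
      where
      δ-sym : ∀ (a b : Fin k) → δ a b ≡ δ b a
      δ-sym a b with a FinP.≟ b
      ... | yes refl = sym (δ-refl a)
      ... | no ne    = sym (δ-≢ (ne ∘ sym))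
      -- The relation between columns that expresses member g through the members κ. Since row
      -- operations preserve it, it determines column g of M′.
      y : Fin N → Carrier
      y g′ = ∑ (λ c → x g c * δ (κ c) g′) + - δ g g′
      expand : ∀ (m : Fin N → Carrier) v → ∑ (λ c → x g c * m (κ c)) ≡ v → ∑ (λ g′ → y g′ * m g′) ≡ v + - m g
      expand m v e = begin
        ∑ (λ g′ → y g′ * m g′)
          ≡⟨ ∑-cong (λ g′ → solve 3 (λ a d m → (a :+ :- d) :* m := a :* m :+ (:- :1) :* (d :* m)) refl (∑ (λ c → x g c * δ (κ c) g′)) (δ g g′) (m g′)) ⟩
        ∑ (λ g′ → ∑ (λ c → x g c * δ (κ c) g′) * m g′ + - 1# * (δ g g′ * m g′))
          ≡⟨ ∑-+ (λ g′ → ∑ (λ c → x g c * δ (κ c) g′) * m g′) (λ g′ → - 1# * (δ g g′ * m g′)) ⟩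
        ∑ (λ g′ → ∑ (λ c → x g c * δ (κ c) g′) * m g′) + ∑ (λ g′ → - 1# * (δ g g′ * m g′))
          ≡⟨ cong₂ _+_ (trans (∑-push (x g) κ m) e) (trans (sym (*-∑ (- 1#) (λ g′ → δ g g′ * m g′))) (cong (- 1# *_) (∑-δˡ g m))) ⟩
        v + - 1# * m g
          ≡⟨ cong (v +_) (solve 1 (λ m → (:- :1) :* m := :- m) refl (m g)) ⟩
        v + - m g ∎

    MG≗MH : ∀ r g → proj₁ redH r g ≡ proj₁ redG r g
    MG≗MH r g = trans (canonical H (proj₁ redH) eH (λ r c → proj₂ (proj₂ redH) r c (∈P.∈-allFin c)) eqH r g)
      (sym (canonical G (proj₁ redG) eG (λ r c → proj₂ (proj₂ redG) r c (∈P.∈-allFin c)) eqG r g))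

-- Identifying the arc with the normal rational curve

module Uniqueness {q : ℕ} (F : FiniteField q) where

  open FieldArithmetic F
  open ProjectiveLine F
  open Determinants F
  open SpanningFamilies F
  open SubsetSums F
  open KernelVector F
  open ColexOrder F
  open ColumnSpace F
  open ArcCoordinates F
  open InvertedCoordinates F
  open RationalCurve F

  invbrs-tabulate : ∀ {n} (p : Fin n → V2) v → invbrs (List.tabulate p) v ≡ ∏ (λ i → inv (br (p i) v))
  invbrs-tabulate {zero}  p v = refl
  invbrs-tabulate {suc n} p v = cong (inv (br (p zero) v) *_) (invbrs-tabulate (p ∘ suc) v)

  sumL-tabulate : ∀ {n} {A : Set} (f : A → Carrier) (p : Fin n → A) → sumL (List.map f (List.tabulate p)) ≡ ∑ (f ∘ p)
  sumL-tabulate {zero}  f p = refl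
  sumL-tabulate {suc n} f p = cong (f (p zero) +_) (sumL-tabulate f (p ∘ suc))

  -- A monomial of degree K is a product of K linear forms, so the interpolation identity applies to
  -- the K + 2 points formed by p and the nodes. The term of p is kept apart, to be solved for.
  interpolation-∑ : ∀ {K} (p : V2) (node : Fin (suc K) → V2) → (∀ c → br p (node c) ≢ 0#) → PairwiseIndependent node → ∀ {j} → j ≤ K →
    mono K j p * ∏ (λ i → inv (br (node i) p)) + ∑ (λ c → mono K j (node c) * (inv (br p (node c)) * ∏ (λ i → inv (br (node i) (node c))))) ≡ 0#
  interpolation-∑ {K} p node ne ind {j} le = trans (cong₂ _+_ (sym head) (sym tail))
    (interpolation E (monoForms K j) (AllP.tabulate⁺ ne ∷ AllPairsP.tabulate⁺ ind)
      (cong suc (trans (ListP.length-tabulate node) (cong suc (sym (length-monoForms le))))))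
    where
    E : List V2
    E = p ∷ List.tabulate node
    head : brs (monoForms K j) p * invbrs E p ≡ mono K j p * ∏ (λ i → inv (br (node i) p))
    head = cong₂ _*_ (brs-monoForms K j p) (trans (cong₂ _*_ (inv-0 (br-self p)) (invbrs-tabulate node p)) (*-identityˡ _))
    tail : sumL (List.map (λ e → brs (monoForms K j) e * invbrs E e) (List.tabulate node)) ≡
      ∑ (λ c → mono K j (node c) * (inv (br p (node c)) * ∏ (λ i → inv (br (node i) (node c)))))
    tail = trans (sumL-tabulate (λ e → brs (monoForms K j) e * invbrs E e) node)
      (∑-cong (λ c → cong₂ _*_ (brs-monoForms K j (node c)) (cong (inv (br p (node c)) *_) (invbrs-tabulate node (node c)))))

  mono-• : ∀ {K j} τ p → j ≤ K → mono K j (τ • p) ≡ pow τ K * mono K j p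
  mono-• {K} {j} τ (s , t) le = begin
    pow (τ * s) (K ℕ.∸ j) * pow (τ * t) j
      ≡⟨ cong₂ _*_ (pow-* τ s (K ℕ.∸ j)) (pow-* τ t j) ⟩
    (pow τ (K ℕ.∸ j) * pow s (K ℕ.∸ j)) * (pow τ j * pow t j)
      ≡⟨ solve 4 (λ a b c d → (a :* b) :* (c :* d) := (a :* c) :* (b :* d)) refl (pow τ (K ℕ.∸ j)) (pow s (K ℕ.∸ j)) (pow τ j) (pow t j) ⟩
    (pow τ (K ℕ.∸ j) * pow τ j) * (pow s (K ℕ.∸ j) * pow t j)
      ≡⟨ cong (_* (pow s (K ℕ.∸ j) * pow t j)) (trans (sym (pow-+ τ (K ℕ.∸ j) j)) (cong (pow τ) (ℕP.m∸n+n≡m le))) ⟩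
    pow τ K * (pow s (K ℕ.∸ j) * pow t j) ∎

  pow-≢0 : ∀ {x} → x ≢ 0# → ∀ n → pow x n ≢ 0#
  pow-≢0 ne zero    = 1≢0
  pow-≢0 ne (suc n) = *-≢0 ne (pow-≢0 ne n)

  -- Since the parameters exhaust the projective line, a scaled monomial family is NRC
  -- up to the order and the scaling of its members.
  monomial⇒NRC : ∀ {K} (H : Family (suc K) (suc q)) (ν : Fin (suc q) → Carrier) (P : Fin (suc q) → V2) → (∀ g → ν g ≢ 0#) →
    PairwiseIndependent P → (∀ g → P g ≢ 0₂) → (∀ g j → H g j ≡ ν g * mono K (toℕ j) (P g)) → LinEquiv H (NRC (suc K))
  monomial⇒NRC {K} H ν P ν≢0 ind P≢0 form = colScale (λ g → inv (μ g)) (λ g → inv≢0 (μ g)) (λ r g → refl)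
    ◅ colPerm (Perm.flip π) permuted ◅ ε
    where
    abstract
      normal : ∀ g → ∃ λ i → ∃ λ τ → τ ≢ 0# × P g ≡ τ • point i
      normal g = normalise (P g) (P≢0 g)
    σ : Fin (suc q) → Fin (suc q)
    σ g = proj₁ (normal g)
    τ μ : Fin (suc q) → Carrier
    τ g = proj₁ (proj₂ (normal g))
    μ g = ν g * pow (τ g) K
    μ≢0 : ∀ g → μ g ≢ 0#
    μ≢0 g = *-≢0 (ν≢0 g) (pow-≢0 (proj₁ (proj₂ (proj₂ (normal g)))) K)
    P≡ : ∀ g → P g ≡ τ g • point (σ g)
    P≡ g = proj₂ (proj₂ (proj₂ (normal g)))
    br-• : ∀ a b p → br (a • p) (b • p) ≡ 0#
    br-• a b (s , t) = solve 4 (λ a b s t → (a :* s) :* (b :* t) :+ :- ((a :* t) :* (b :* s)) := :0) refl a b s t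
    σ-inj : Inj σ
    σ-inj {g} {g′} e = go (g FinP.≟ g′)
      where
      go : Dec (g ≡ g′) → g ≡ g′
      go (yes eq) = eq
      go (no ne)  = contradiction (trans (cong₂ br (P≡ g) (trans (P≡ g′) (cong (λ i → τ g′ • point i) (sym e)))) (br-• (τ g) (τ g′) (point (σ g)))) (ind ne)
    πσ : Σ (Permutation (suc q) (suc q)) λ π → ∀ g → π ⟨$⟩ʳ g ≡ σ g
    πσ = injective⇒permutation refl σ σ-inj
    π : Permutation (suc q) (suc q)
    π = proj₁ πσ
    scaled : ∀ g r → inv (μ g) * H g r ≡ NRC (suc K) (σ g) r
    scaled g r = begin
      inv (μ g) * H g r
        ≡⟨ cong (inv (μ g) *_) (trans (form g r) (cong (ν g *_) (trans (cong (mono K (toℕ r)) (P≡ g)) (mono-• (τ g) (point (σ g)) (ℕP.≤-pred (FinP.toℕ<n r)))))) ⟩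
      inv (μ g) * (ν g * (pow (τ g) K * mono K (toℕ r) (point (σ g))))
        ≡⟨ solve 4 (λ i n p m → i :* (n :* (p :* m)) := (i :* (n :* p)) :* m) refl (inv (μ g)) (ν g) (pow (τ g) K) (mono K (toℕ r) (point (σ g))) ⟩
      (inv (μ g) * μ g) * mono K (toℕ r) (point (σ g))
        ≡⟨ trans (cong (_* mono K (toℕ r) (point (σ g))) (inv-* (μ≢0 g))) (*-identityˡ _) ⟩
      mono K (toℕ r) (point (σ g))
        ≡⟨ sym (NRC≡mono K (σ g) r) ⟩
      NRC (suc K) (σ g) r ∎
    permuted : ∀ r c → NRC (suc K) c r ≡ inv (μ (Perm.flip π ⟨$⟩ʳ c)) * H (Perm.flip π ⟨$⟩ʳ c) r
    permuted r c = sym (trans (scaled (Perm.flip π ⟨$⟩ʳ c) r) (cong (λ i → NRC (suc K) i r) (trans (sym (proj₂ πσ (Perm.flip π ⟨$⟩ʳ c))) (Perm.inverseʳ π))))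

  module Classification {d n : ℕ}
    (hyp : ∀ (G : Family (2 ℕ.+ d) ((2 ℕ.+ d) ℕ.+ (d ℕ.+ n))) → IsArc G → vInColSpaceH G n)
    (room : (2 ℕ.+ d) ℕ.+ (d ℕ.+ n) ≤ suc q) (room₃ : (2 ℕ.+ d) ℕ.+ 3 ℕ.+ d ≤ suc q)
    (G : Family (2 ℕ.+ d) (suc q)) (sp : Spanning G) (κ : Fin (2 ℕ.+ d) → Fin (suc q)) (κ-inj : Inj κ) where
    open Coordinates G sp κ κ-inj
    open Minors G sp κ κ-inj
    open Collinearity hyp room room₃ G sp κ κ-inj

    two : Σ (Fin 2 → Fin (suc q)) λ z → Inj z × Disjoint κ z
    two = extend 2 κ κ-inj (ℕP.≤-trans (ℕP.+-monoʳ-≤ (2 ℕ.+ d) (ℕP.n≤1+n 2)) (ℕP.≤-trans (ℕP.m≤m+n ((2 ℕ.+ d) ℕ.+ 3) d) room₃))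

    z₁ z₂ : Fin (suc q)
    z₁ = proj₁ two zero
    z₂ = proj₁ two (suc zero)

    off₁ : Off z₁
    off₁ i = proj₂ (proj₂ two) i zero

    off₂ : Off z₂
    off₂ i = proj₂ (proj₂ two) i (suc zero)

    z₁≢z₂ : z₁ ≢ z₂
    z₁≢z₂ e = contradiction (proj₁ (proj₂ two) e) (λ ())

    u v : Fin (2 ℕ.+ d) → Carrier
    u c = ζ c z₁
    v c = ζ c z₂

    D : Carrier
    D = ζ₀₁ z₁ z₂

    D≢0 : D ≢ 0#
    D≢0 = ζ-minor≢0 off₁ off₂ z₁≢z₂ {zero} {suc zero} (λ ())

    -- The inverted coordinates of all points off the basis lie on the line
    -- through those of z₁ and z₂.
    param : Fin (suc q) → V2
    param g = - ζ₀₁ z₂ g , ζ₀₁ z₁ g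

    on-line : ∀ {g} → Off g → ∀ c → D * ζ c g ≡ (- ζ₀₁ z₂ g) * u c + ζ₀₁ z₁ g * v c
    on-line {g} off c = go (z₁ FinP.≟ g) (z₂ FinP.≟ g)
      where
      go : Dec (z₁ ≡ g) → Dec (z₂ ≡ g) → D * ζ c g ≡ (- ζ₀₁ z₂ g) * u c + ζ₀₁ z₁ g * v c
      -- `Triple` concerns three distinct points. If g is z₁ or z₂, the equation is a polynomial
      -- identity.
      go (yes refl) _ = solve 6 (λ a₁ b₁ a₂ b₂ x y → (a₁ :* b₂ :+ :- (b₁ :* a₂)) :* x :=
        (:- (a₂ :* b₁ :+ :- (b₂ :* a₁))) :* x :+ (a₁ :* b₁ :+ :- (b₁ :* a₁)) :* y) refl
        (ζ zero z₁) (ζ (suc zero) z₁) (ζ zero z₂) (ζ (suc zero) z₂) (u c) (v c)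
      go (no _) (yes refl) = solve 6 (λ a₁ b₁ a₂ b₂ x y → (a₁ :* b₂ :+ :- (b₁ :* a₂)) :* y :=
        (:- (a₂ :* b₂ :+ :- (b₂ :* a₂))) :* x :+ (a₁ :* b₂ :+ :- (b₁ :* a₂)) :* y) refl
        (ζ zero z₁) (ζ (suc zero) z₁) (ζ zero z₂) (ζ (suc zero) z₂) (u c) (v c)
      go (no z₁≢g) (no z₂≢g) = trans (x+y≡0⇒x≡-y (trans (+-comm (D * ζ c g) _) (Triple.η≡0 z₁ z₂ g off₁ off₂ off z₁≢z₂ z₁≢g z₂≢g c)))
        (solve 4 (λ a x b y → :- (a :* x :+ (:- b) :* y) := (:- a) :* x :+ b :* y) refl (ζ₀₁ z₂ g) (u c) (ζ₀₁ z₁ g) (v c))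

    -- The zero of the linear form (s , t) ↦ s * u c + t * v c, that is, the parameter at which the
    -- inverted coordinate c vanishes. The curve passes through the vertex κ c there.
    node : Fin (2 ℕ.+ d) → V2
    node c = v c , - u c

    br-node-param : ∀ {g} → Off g → ∀ c → br (node c) (param g) ≡ D * ζ c g
    br-node-param {g} off c = trans (solve 4 (λ u v s t → v :* t :+ :- ((:- u) :* s) := s :* u :+ t :* v) refl (u c) (v c) (- ζ₀₁ z₂ g) (ζ₀₁ z₁ g)) (sym (on-line off c))

    br-node-param≢0 : ∀ {g} → Off g → ∀ c → br (node c) (param g) ≢ 0#
    br-node-param≢0 {g} off c e = *-≢0 D≢0 (inv≢0 (ℓ c (G g))) (trans (sym (br-node-param off c)) e)

    node-independent : PairwiseIndependent node
    node-independent {c} {c′} ne e = ζ-minor≢0 off₁ off₂ z₁≢z₂ ne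
      (trans (solve 4 (λ u v u′ v′ → u :* v′ :+ :- (u′ :* v) := v :* (:- u′) :+ :- ((:- u) :* v′)) refl (u c) (v c) (u c′) (v c′)) e)

    -- Multiplicativity of 2×2 determinants: D * D times the minor of the inverted coordinates of g
    -- and g′ is the bracket of their parameters times the minor of z₁ and z₂.
    param-independent : ∀ {g g′} → Off g → Off g′ → g ≢ g′ → br (param g) (param g′) ≢ 0#
    param-independent {g} {g′} off off′ ne e = *-≢0 (*-≢0 D≢0 D≢0) (ζ-minor≢0 off off′ ne {zero} {suc zero} (λ ())) (begin
      (D * D) * ζ₀₁ g g′
        ≡⟨ solve 5 (λ D a b′ b a′ → (D :* D) :* (a :* b′ :+ :- (b :* a′)) := (D :* a) :* (D :* b′) :+ :- ((D :* b) :* (D :* a′))) refl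
             D (ζ zero g) (ζ (suc zero) g′) (ζ (suc zero) g) (ζ zero g′) ⟩
      (D * ζ zero g) * (D * ζ (suc zero) g′) + - ((D * ζ (suc zero) g) * (D * ζ zero g′))
        ≡⟨ cong₂ (λ x y → x + - y) (cong₂ _*_ (on-line off zero) (on-line off′ (suc zero))) (cong₂ _*_ (on-line off (suc zero)) (on-line off′ zero)) ⟩
      (s * u₀ + t * v₀) * (s′ * u₁ + t′ * v₁) + - ((s * u₁ + t * v₁) * (s′ * u₀ + t′ * v₀))
        ≡⟨ solve 8 (λ s t s′ t′ u₀ v₀ u₁ v₁ → (s :* u₀ :+ t :* v₀) :* (s′ :* u₁ :+ t′ :* v₁) :+ :- ((s :* u₁ :+ t :* v₁) :* (s′ :* u₀ :+ t′ :* v₀)) :=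
             (s :* t′ :+ :- (t :* s′)) :* (u₀ :* v₁ :+ :- (u₁ :* v₀))) refl s t s′ t′ u₀ v₀ u₁ v₁ ⟩
      br (param g) (param g′) * (u₀ * v₁ + - (u₁ * v₀))
        ≡⟨ trans (cong (_* (u₀ * v₁ + - (u₁ * v₀))) e) (zeroˡ _) ⟩
      0# ∎)
      where
      s t s′ t′ u₀ v₀ u₁ v₁ : Carrier
      s  = - ζ₀₁ z₂ g
      t  = ζ₀₁ z₁ g
      s′ = - ζ₀₁ z₂ g′
      t′ = ζ₀₁ z₁ g′
      u₀ = u zero
      v₀ = v zero
      u₁ = u (suc zero)
      v₁ = v (suc zero)

    -- At `node c` the factor i = c is `inv 0#`, so one formula serves both the points off the basis
    -- and the Lagrange denominators at the nodes.
    Π : V2 → Carrier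
    Π e = ∏ (λ i → inv (br (node i) e))

    Π≢0 : ∀ e → Π e ≢ 0#
    Π≢0 e = ∏-≢0 (λ i → inv (br (node i) e)) (λ i → inv≢0 (br (node i) e))

    abstract
      locate : ∀ g → (∃ λ c → κ c ≡ g) ⊎ Off g
      locate g with FinP.any? (λ c → κ c FinP.≟ g)
      ... | yes h = inj₁ h
      ... | no ¬h = inj₂ (λ c e → ¬h (c , e))

    onBasis : ∀ {A : Set} → (Fin (2 ℕ.+ d) → A) → (Fin (suc q) → A) → Fin (suc q) → A
    onBasis f h g with locate g
    ... | inj₁ (c , _) = f c
    ... | inj₂ _       = h g

    onBasis-κ : ∀ {A : Set} (f : Fin (2 ℕ.+ d) → A) h c → onBasis f h (κ c) ≡ f c
    onBasis-κ f h c with locate (κ c)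
    ... | inj₁ (c′ , e) = cong f (κ-inj e)
    ... | inj₂ off      = contradiction refl (off c)

    onBasis-off : ∀ {A : Set} (f : Fin (2 ℕ.+ d) → A) h {g} → Off g → onBasis f h g ≡ h g
    onBasis-off f h {g} off with locate g
    ... | inj₁ (c , e) = contradiction e (off c)
    ... | inj₂ _       = refl

    cases : (Q : Fin (suc q) → Set) → (∀ c → Q (κ c)) → (∀ g → Off g → Q g) → ∀ g → Q g
    cases Q f h g with locate g
    ... | inj₁ (c , refl) = f c
    ... | inj₂ off        = h g off

    P : Fin (suc q) → V2
    P = onBasis node param

    -- Off the basis, ℓ c (G g) is D divided by br (node c) (param g). Interpolation thus expresses
    -- Π (param g) times a monomial at param g through the same monomial at the nodes, with weights
    -- Π (node c) * ℓ c (G g) / D. The scalings are chosen so that these weights turn into the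
    -- coordinates of G g in the basis.
    ν : Fin (suc q) → Carrier
    ν = onBasis (λ c → ℓ c (G (κ c)) * Π (node c)) (λ g → D * Π (param g))

    P-κ : ∀ c → P (κ c) ≡ node c
    P-κ = onBasis-κ node param

    P-off : ∀ {g} → Off g → P g ≡ param g
    P-off = onBasis-off node param

    ν-κ : ∀ c → ν (κ c) ≡ ℓ c (G (κ c)) * Π (node c)
    ν-κ = onBasis-κ (λ c → ℓ c (G (κ c)) * Π (node c)) (λ g → D * Π (param g))

    ν-off : ∀ {g} → Off g → ν g ≡ D * Π (param g)
    ν-off = onBasis-off (λ c → ℓ c (G (κ c)) * Π (node c)) (λ g → D * Π (param g))

    ν≢0 : ∀ g → ν g ≢ 0#
    ν≢0 = cases (λ g → ν g ≢ 0#)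
      (λ c → subst (_≢ 0#) (sym (ν-κ c)) (*-≢0 (ℓ-κ c) (Π≢0 (node c))))
      (λ g off → subst (_≢ 0#) (sym (ν-off off)) (*-≢0 D≢0 (Π≢0 (param g))))

    P-independent : PairwiseIndependent P
    P-independent {g} {g′} = cases (λ g → ∀ g′ → g ≢ g′ → br (P g) (P g′) ≢ 0#)
      (λ c → cases (λ g′ → κ c ≢ g′ → br (P (κ c)) (P g′) ≢ 0#)
        (λ c′ ne → rewritten (P-κ c) (P-κ c′) (node-independent (ne ∘ cong κ)))
        (λ g′ off _ → rewritten (P-κ c) (P-off off) (br-node-param≢0 off c)))
      (λ g off → cases (λ g′ → g ≢ g′ → br (P g) (P g′) ≢ 0#)
        (λ c′ _ → rewritten (P-off off) (P-κ c′) (br-sym≢0 (node c′) (param g) (br-node-param≢0 off c′)))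
        (λ g′ off′ ne → rewritten (P-off off) (P-off off′) (param-independent off off′ ne)))
      g g′
      where
      rewritten : ∀ {a b a′ b′} → a ≡ a′ → b ≡ b′ → br a′ b′ ≢ 0# → br a b ≢ 0#
      rewritten refl refl ne = ne

    P≢0₂ : ∀ g → P g ≢ 0₂
    P≢0₂ g z = go (g FinP.≟ κ zero)
      where
      avoid : ∀ g′ → g ≢ g′ → _
      avoid g′ ne = P-independent ne (trans (cong (λ w → br w (P g′)) z) (br-0₂ (P g′)))
      go : Dec (g ≡ κ zero) → _
      go (no ne)    = avoid (κ zero) ne
      go (yes refl) = avoid (κ (suc zero)) (λ e → contradiction (κ-inj e) (λ ()))

    H : Family (2 ℕ.+ d) (suc q)
    H g j = ν g * mono (suc d) (toℕ j) (P g)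

    x : Fin (suc q) → Fin (2 ℕ.+ d) → Carrier
    x g c = ℓ c (G g) * inv (ℓ c (G (κ c)))

    H-κ : ∀ c j → H (κ c) j ≡ (ℓ c (G (κ c)) * Π (node c)) * mono (suc d) (toℕ j) (node c)
    H-κ c j = cong₂ (λ a p → a * mono (suc d) (toℕ j) p) (ν-κ c) (P-κ c)

    -- On the basis the coordinates are unit vectors; elsewhere this is Lagrange interpolation at
    -- the nodes, as `inv-br` shows. By it G and the scaled monomial family H have equal
    -- coordinates, which makes them row equivalent.
    H-coordinates : ∀ g j → ∑ (λ c → x g c * H (κ c) j) ≡ H g j
    H-coordinates = cases (λ g → ∀ j → ∑ (λ c → x g c * H (κ c) j) ≡ H g j) on-basis off-basis
      where
      on-basis : ∀ c₀ j → ∑ (λ c → x (κ c₀) c * H (κ c) j) ≡ H (κ c₀) j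
      on-basis c₀ j = trans (∑-single c₀ {λ c → x (κ c₀) c * H (κ c) j}
          (λ c ne → trans (cong (λ w → w * inv (ℓ c (G (κ c))) * H (κ c) j) (ℓ-κ≢ (ne ∘ sym))) (solve 2 (λ a b → :0 :* a :* b := :0) refl (inv (ℓ c (G (κ c)))) (H (κ c) j))))
        (trans (cong (_* H (κ c₀) j) (*-inv (ℓ-κ c₀))) (*-identityˡ (H (κ c₀) j)))
      off-basis : ∀ g → Off g → ∀ j → ∑ (λ c → x g c * H (κ c) j) ≡ H g j
      off-basis g off j = begin
        ∑ (λ c → x g c * H (κ c) j)
          ≡⟨ ∑-cong {2 ℕ.+ d} {λ c → x g c * H (κ c) j} {t} summand ⟩
        ∑ t
          ≡⟨ *-cancelˡ (inv≢0 D) scaled ⟩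
        (D * Π (param g)) * m (param g)
          ≡⟨ sym (cong₂ (λ a p → a * m p) (ν-off off) (P-off off)) ⟩
        H g j ∎
        where
        m : V2 → Carrier
        m = mono (suc d) (toℕ j)
        t : Fin (2 ℕ.+ d) → Carrier
        t c = m (node c) * (ℓ c (G g) * Π (node c))
        summand : ∀ c → x g c * H (κ c) j ≡ t c
        summand c = begin
          x g c * H (κ c) j
            ≡⟨ cong (x g c *_) (H-κ c j) ⟩
          (ℓ c (G g) * inv l) * ((l * Π (node c)) * m (node c))
            ≡⟨ solve 5 (λ a i l p m → (a :* i) :* ((l :* p) :* m) := (l :* i) :* (m :* (a :* p))) refl (ℓ c (G g)) (inv l) l (Π (node c)) (m (node c)) ⟩
          (l * inv l) * t c
            ≡⟨ trans (cong (_* t c) (*-inv (ℓ-κ c))) (*-identityˡ (t c)) ⟩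
          t c ∎
          where
          l : Carrier
          l = ℓ c (G (κ c))
        inv-br : ∀ c → inv (br (param g) (node c)) ≡ - (inv D * ℓ c (G g))
        inv-br c = trans (cong inv (trans (br-anti (param g) (node c)) (cong -_ (br-node-param off c))))
          (trans (inv-neg (*-≢0 D≢0 (inv≢0 (ℓ c (G g))))) (cong -_ (trans (inv-distrib-* D≢0 (inv≢0 (ℓ c (G g)))) (cong (inv D *_) (inv-involutive (ℓ-off c off))))))
        scaled : inv D * ∑ t ≡ inv D * ((D * Π (param g)) * m (param g))
        scaled = begin
          inv D * ∑ t
            ≡⟨ solve 1 (λ a → a := :- ((:- :1) :* a)) refl (inv D * ∑ t) ⟩
          - (- 1# * (inv D * ∑ t))
            ≡⟨ cong -_ (trans (cong (- 1# *_) (*-∑ (inv D) t)) (*-∑ (- 1#) (λ c → inv D * t c))) ⟩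
          - ∑ (λ c → - 1# * (inv D * t c))
            ≡⟨ cong -_ (∑-cong {2 ℕ.+ d} {λ c → - 1# * (inv D * t c)} {λ c → m (node c) * (inv (br (param g) (node c)) * Π (node c))} (λ c → trans
                 (solve 4 (λ i m a p → (:- :1) :* (i :* (m :* (a :* p))) := m :* ((:- (i :* a)) :* p)) refl (inv D) (m (node c)) (ℓ c (G g)) (Π (node c)))
                 (cong (λ w → m (node c) * (w * Π (node c))) (sym (inv-br c))))) ⟩
          - ∑ (λ c → m (node c) * (inv (br (param g) (node c)) * Π (node c)))
            ≡⟨ sym (x+y≡0⇒x≡-y (interpolation-∑ (param g) node (λ c → br-sym≢0 (node c) (param g) (br-node-param≢0 off c)) node-independent (ℕP.≤-pred (FinP.toℕ<n j)))) ⟩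
          m (param g) * Π (param g)
            ≡⟨ trans (sym (*-identityˡ _)) (cong (_* (m (param g) * Π (param g))) (sym (inv-* D≢0))) ⟩
          (inv D * D) * (m (param g) * Π (param g))
            ≡⟨ solve 4 (λ i d p m → (i :* d) :* (m :* p) := i :* ((d :* p) :* m)) refl (inv D) D (Π (param g)) (m (param g)) ⟩
          inv D * ((D * Π (param g)) * m (param g)) ∎

    equivalent : LinEquiv G (NRC (2 ℕ.+ d))
    equivalent = same-coordinates⇒equivalent G H κ independent (scaled-independent H ν P ν≢0 P-independent (λ g j → refl) κ κ-inj)
        x (λ g → expansion (G g)) H-coordinates
      ◅◅ monomial⇒NRC H ν P ν≢0 P-independent P≢0₂ (λ g j → refl)

-- The theorem for k ≥ 2

open import Data.Nat using (_+_; _*_; _∸_)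

-- The size 2(k - 1) + n of the hypothesis has to be read as k + ((k - 2) + n): a basis, the points
-- Y and n fillers.
resize : ∀ {q k n N N′} (F : FiniteField q) → N ≡ N′ →
  (∀ (G : FF.Family F k N) → FF.IsArc F G → FF.vInColSpaceH F G n) →
  ∀ (G : FF.Family F k N′) → FF.IsArc F G → FF.vInColSpaceH F G n
resize F refl hyp = hyp

theorem1p12 : ∀ {q : ℕ} (F : FiniteField q) (k n : ℕ) → 2 ≤ k → n + 2 * k ≤ q →
    (∀ (G : FF.Family F k ((k ∸ 1) + (k ∸ 1) + n)) → FF.IsArc F G → FF.vInColSpaceH F G n) →
    FF.IsArc F (FF.NRC F k) ×
    (∀ (G : FF.Family F k (suc q)) → FF.IsArc F G → FF.LinEquiv F G (FF.NRC F k))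
theorem1p12 {q} F (suc (suc d)) n (s≤s (s≤s z≤n)) le hyp =
  RationalCurve.NRC-arc F (suc d) (ℕP.≤-trans (ℕP.≤-trans (ℕP.n≤1+n (suc d)) (ℕP.m≤m+n (2 + d) (d + n))) N≤q) ,
  λ G arc → Uniqueness.Classification.equivalent F (resize F size hyp) (ℕP.m≤n⇒m≤1+n N≤q) room₃ G
    (SpanningFamilies.arc⇒spanning F G arc) (λ i → Fin.inject≤ i k≤) (FinP.inject≤-injective k≤ k≤ _ _)
  where
  open +-*-Solver
  size : suc d + suc d + n ≡ (2 + d) + (d + n)
  size = solve 2 (λ d n → (con 1 :+ d) :+ (con 1 :+ d) :+ n := (con 2 :+ d) :+ (d :+ n)) refl d n
  N≤q : (2 + d) + (d + n) ≤ q
  N≤q = ℕP.≤-trans (ℕP.≤-trans (ℕP.m≤m+n _ 2) (ℕP.≤-reflexive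
    (solve 2 (λ d n → ((con 2 :+ d) :+ (d :+ n)) :+ con 2 := n :+ con 2 :* (con 2 :+ d)) refl d n))) le
  room₃ : (2 + d) + 3 + d ≤ suc q
  room₃ = ℕP.≤-trans (ℕP.≤-trans (ℕP.m≤m+n _ n) (ℕP.≤-reflexive
    (solve 2 (λ d n → ((con 2 :+ d) :+ con 3 :+ d) :+ n := con 1 :+ (n :+ con 2 :* (con 2 :+ d))) refl d n))) (s≤s le)
  k≤ : 2 + d ≤ suc q
  k≤ = ℕP.m≤n⇒m≤1+n (ℕP.≤-trans (ℕP.m≤m+n (2 + d) (d + n)) N≤q)
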